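{- Let $G$ be a cyclically five-connected cubic graph with $|V(G)|\ge 14$, and let $D$ be a crossed domino in $G$ with attachment sequence $(x_1,\dots,x_5)$. Let $g\notin E(D)$ be the edge of $G$ incident with $x_5$. Let $H$ be a cyclically five-connected cubic graph and let $\eta$ be a homeomorphic embedding of $G$ in $H$. Then one of the following holds: (i) there exists $X\subseteq V(H)$ with $|\delta_H(X)|=5$ such that for all $v\in V(G)$, $\eta(v)\in X$ if and only if $v\in V(D)$; (ii) $H$ contains the Petersen graph; (iii) for some $e\in E(D)$ and $f\in E(G\setminus V(D))$ there is a homeomorphic embedding of $G+(e,f)$ in $H$; (iv) for some $e\in\{x_1x_2,x_3x_4\}$ and some $f\in E(G\setminus V(D))$ such that $f,g$ are diverse in $G$, there is a homeomorphic embedding of $G+(e,g)+(yx_5,f)$ in $H$, where $x,y$ are the new vertices of $G+(e,g)$.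
   Context: All graphs finite and simple. $\delta_H(X)$ is the set of edges with exactly one end in $X$; a cubic graph is cyclically $k$-connected if it has girth $\ge k$ and $|\delta(X)|\ge k$ for all $X$ such that both $X$ and its complement contain the vertex set of a circuit. $G\setminus V(D)$ denotes $G$ with the vertices of $D$ deleted. A homeomorphic embedding of $G$ in $H$ is a map $\eta$: injective on vertices; each edge $e=v_1v_2$ maps to a path $\eta(e)$ with ends $\eta(v_1),\eta(v_2)$; for distinct edges no edge or internal vertex of $\eta(e_1)$ lies in $\eta(e_2)$; $\eta(v)\in V(\eta(e))$ iff $v$ is an end of $e$. $H$ contains a graph $K$ if there is a homeomorphic embedding of $K$ in $H$. For distinct edges $ab,cd$, $G+(ab,cd)$ deletes $ab,cd$ and adds new vertices $x,y$ (in this order, the "new vertices") and edges $xa,xb,yc,yd,xy$; $G+(e,g)+(h,f)$ means applying this twice. Edges $ab,cd$ are diverse in $G$ if $a,b,c,d$ are distinct and neither of $a,b$ is adjacent to $c$ or $d$. A domino in a cubic graph $G$ is a subgraph $D$ with $|V(D)|=7$ that is the union of three paths $P_1,P_2,P_3$ of lengths two, three and three respectively, having common ends and otherwise disjoint. The middle vertex of $P_1$ is the centre; the other four vertices of degree two in $D$ are the corners. An attachment sequence is a sequence $(x_1,\dots,x_5)$ where $x_1,\dots,x_4$ are the corners, $x_5$ is the centre, $x_1x_2$ is an edge, and $x_2,x_3$ have a common neighbour. A domino $D$ with attachment sequence $(x_1,\dots,x_5)$ is crossed if (a) there are two disjoint connected subgraphs $P,Q$ of $G$, both edge-disjoint from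 $D$, with $V(P\cap D)=\{x_1,x_3\}$ and $V(Q\cap D)=\{x_2,x_4,x_5\}$, and (b) there are two disjoint connected subgraphs $P,Q$ of $G$, both edge-disjoint from $D$, with $V(P\cap D)=\{x_1,x_3,x_5\}$ and $V(Q\cap D)=\{x_2,x_4\}$. -}

module Defs where

open import Data.Nat using (ℕ; zero; suc; _+_; _≤_; _≡ᵇ_)
open import Data.Fin using (Fin; zero; suc; toℕ) renaming (_≟_ to _≟F_)
open import Data.Bool using (Bool; true; false; _∧_; _∨_; not)
open import Data.List using (List; []; _∷_; _++_; length; filterᵇ; allFin; map; reverse)
open import Data.Nat.ListAction using (sum)
open import Data.Bool.ListAction using (any)
open import Data.List.Relation.Unary.All using (All)
open import Data.List.Relation.Unary.Linked using (Linked)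
open import Data.List.Relation.Unary.Unique.Propositional using (Unique)
open import Data.List.Membership.Propositional using (_∈_; _∉_)
open import Data.Product using (Σ; ∃; _×_; _,_)
open import Data.Sum using (_⊎_)
open import Data.Empty using (⊥)
open import Relation.Nullary using (¬_)
open import Relation.Nullary.Decidable using (⌊_⌋)
open import Relation.Binary.PropositionalEquality using (_≡_)
open import Function.Bundles using (_⇔_)

record Graph : Set where
  field
    size : ℕ
    adj  : Fin size → Fin size → Bool

open Graph public

V : Graph → Set
V G = Fin (size G)

Adj : (G : Graph) → V G → V G → Set
Adj G u v = adj G u v ≡ true

IsSimple : Graph → Set
IsSimple G = (∀ u v → adj G u v ≡ adj G v u) × (∀ v → adj G v v ≡ false)

degree : (G : Graph) → V G → ℕ
degree G v = length (filterᵇ (adj G v) (allFin (size G)))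

IsCubic : Graph → Set
IsCubic G = IsSimple G × (∀ v → degree G v ≡ 3)

SameEdge : {A : Set} → A → A → A → A → Set
SameEdge u v u' v' = (u ≡ u' × v ≡ v') ⊎ (u ≡ v' × v ≡ u')

IsCircuit : (G : Graph) → List (V G) → Set
IsCircuit G []         = ⊥
IsCircuit G (v ∷ rest) =
  (2 ≤ length rest) × Unique (v ∷ rest) × Linked (Adj G) (v ∷ rest ++ v ∷ [])

GirthAtLeast : ℕ → Graph → Set
GirthAtLeast k G = ∀ cs → IsCircuit G cs → k ≤ length cs

-- |δ_G(X)| : number of edges with exactly one end in X
-- (each such edge counted once, via its end in X)
cutSize : (G : Graph) → (V G → Bool) → ℕ
cutSize G X = sum (map (λ u → length (filterᵇ (λ v → X u ∧ not (X v) ∧ adj G u v)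
                                               (allFin (size G))))
                       (allFin (size G)))

ContainsCircuit : (G : Graph) → (V G → Bool) → Set
ContainsCircuit G X = Σ (List (V G)) λ cs → IsCircuit G cs × All (λ v → X v ≡ true) cs

CyclicallyConnected : ℕ → Graph → Set
CyclicallyConnected k G =
  GirthAtLeast k G ×
  (∀ (X : V G → Bool) → ContainsCircuit G X → ContainsCircuit G (λ v → not (X v))
     → k ≤ cutSize G X)

data Walk {n : ℕ} (R : Fin n → Fin n → Bool) : Fin n → Fin n → Set where
  stop : ∀ {u} → Walk R u u
  step : ∀ {u w v} → R u w ≡ true → Walk R w v → Walk R u v

Consec : {A : Set} → A → A → List A → Set
Consec {A} p q xs = Σ (List A) λ ys → Σ (List A) λ zs → xs ≡ ys ++ p ∷ q ∷ zs

fullPath : {A : Set} → A → List A → A → List A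
fullPath a mid b = a ∷ mid ++ b ∷ []

IsPath : (H : Graph) → V H → List (V H) → V H → Set
IsPath H a mid b = Unique (fullPath a mid b) × Linked (Adj H) (fullPath a mid b)

record Embedding (G H : Graph) : Set where
  field
    vmap       : V G → V H
    vmap-inj   : ∀ u v → vmap u ≡ vmap v → u ≡ v
    -- interior vertices of the path η(uv), listed from η(u) to η(v)
    inner      : V G → V G → List (V H)
    inner-sym  : ∀ u v → Adj G u v → inner v u ≡ reverse (inner u v)
    isPath     : ∀ u v → Adj G u v → IsPath H (vmap u) (inner u v) (vmap v)
    edge-disj  : ∀ a b c d → Adj G a b → Adj G c d → ¬ SameEdge a b c d →
                 ∀ p q → Consec p q (fullPath (vmap a) (inner a b) (vmap b)) →
                 ¬ (Consec p q (fullPath (vmap c) (inner c d) (vmap d))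
                    ⊎ Consec q p (fullPath (vmap c) (inner c d) (vmap d)))
    vert-disj  : ∀ a b c d → Adj G a b → Adj G c d → ¬ SameEdge a b c d →
                 ∀ w → w ∈ inner a b → w ∉ fullPath (vmap c) (inner c d) (vmap d)
    ends       : ∀ u v → Adj G u v → ∀ w →
                 (vmap w ∈ fullPath (vmap u) (inner u v) (vmap v)) ⇔ (w ≡ u ⊎ w ≡ v)

Contains : Graph → Graph → Set
Contains H K = Embedding K H

-- Petersen graph on Fin 10: outer 5-cycle 0..4, spokes i–i+5, inner pentagram

petersenEdges : List (ℕ × ℕ)
petersenEdges =
  (0 , 1) ∷ (1 , 2) ∷ (2 , 3) ∷ (3 , 4) ∷ (4 , 0) ∷
  (0 , 5) ∷ (1 , 6) ∷ (2 , 7) ∷ (3 , 8) ∷ (4 , 9) ∷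
  (5 , 7) ∷ (7 , 9) ∷ (9 , 6) ∷ (6 , 8) ∷ (8 , 5) ∷ []

petersenAdj : Fin 10 → Fin 10 → Bool
petersenAdj u v = any (λ { (i , j) → ((toℕ u ≡ᵇ i) ∧ (toℕ v ≡ᵇ j)) ∨ ((toℕ u ≡ᵇ j) ∧ (toℕ v ≡ᵇ i)) })
                      petersenEdges

Petersen : Graph
Petersen = record { size = 10 ; adj = petersenAdj }

_==_ : {n : ℕ} → Fin n → Fin n → Bool
u == v = ⌊ u ≟F v ⌋

isPair : {n : ℕ} → Fin n → Fin n → Fin n → Fin n → Bool
isPair u v a b = (u == a ∧ v == b) ∨ (u == b ∧ v == a)

old : {n : ℕ} → Fin n → Fin (suc (suc n))
old v = suc (suc v)

newX newY : {n : ℕ} → Fin (suc (suc n))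
newX = zero
newY = suc zero

plusAdj : {n : ℕ} → (Fin n → Fin n → Bool) → Fin n → Fin n → Fin n → Fin n →
          Fin (suc (suc n)) → Fin (suc (suc n)) → Bool
plusAdj A a b c d zero          zero          = false
plusAdj A a b c d zero          (suc zero)    = true
plusAdj A a b c d zero          (suc (suc v)) = (v == a) ∨ (v == b)
plusAdj A a b c d (suc zero)    zero          = true
plusAdj A a b c d (suc zero)    (suc zero)    = false
plusAdj A a b c d (suc zero)    (suc (suc v)) = (v == c) ∨ (v == d)
plusAdj A a b c d (suc (suc u)) zero          = (u == a) ∨ (u == b)
plusAdj A a b c d (suc (suc u)) (suc zero)    = (u == c) ∨ (u == d)
plusAdj A a b c d (suc (suc u)) (suc (suc v)) =
  A u v ∧ not (isPair u v a b) ∧ not (isPair u v c d)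

plus : (G : Graph) → (a b c d : V G) → Graph
plus G a b c d = record { size = suc (suc (size G)) ; adj = plusAdj (adj G) a b c d }

-- Dominoes: P₁ = s c t, P₂ = s a₁ a₂ t, P₃ = s b₁ b₂ t

dVerts : {A : Set} → (s t c a₁ a₂ b₁ b₂ : A) → List A
dVerts s t c a₁ a₂ b₁ b₂ = s ∷ t ∷ c ∷ a₁ ∷ a₂ ∷ b₁ ∷ b₂ ∷ []

dEdges : {A : Set} → (s t c a₁ a₂ b₁ b₂ : A) → List (A × A)
dEdges s t c a₁ a₂ b₁ b₂ =
  (s , c) ∷ (c , t) ∷
  (s , a₁) ∷ (a₁ , a₂) ∷ (a₂ , t) ∷
  (s , b₁) ∷ (b₁ , b₂) ∷ (b₂ , t) ∷ []

record Domino (G : Graph) : Set where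
  field
    s t c a₁ a₂ b₁ b₂ : V G
    distinct : Unique (dVerts s t c a₁ a₂ b₁ b₂)
    edges    : All (λ { (u , v) → Adj G u v }) (dEdges s t c a₁ a₂ b₁ b₂)

module _ {G : Graph} (D : Domino G) where
  open Domino D

  centre : V G
  centre = c

  corners : List (V G)
  corners = a₁ ∷ a₂ ∷ b₁ ∷ b₂ ∷ []

  InVD : V G → Set
  InVD v = v ∈ dVerts s t c a₁ a₂ b₁ b₂

  InED : V G → V G → Set
  InED u v = (u , v) ∈ dEdges s t c a₁ a₂ b₁ b₂ ⊎ (v , u) ∈ dEdges s t c a₁ a₂ b₁ b₂

  InEGminusD : V G → V G → Set
  InEGminusD u v = Adj G u v × ¬ InVD u × ¬ InVD v

  IsAttachmentSeq : (x₁ x₂ x₃ x₄ x₅ : V G) → Set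
  IsAttachmentSeq x₁ x₂ x₃ x₄ x₅ =
    Unique (x₁ ∷ x₂ ∷ x₃ ∷ x₄ ∷ []) ×
    All (λ x → x ∈ corners) (x₁ ∷ x₂ ∷ x₃ ∷ x₄ ∷ []) ×
    x₅ ≡ centre ×
    Adj G x₁ x₂ ×
    (Σ (V G) λ w → Adj G x₂ w × Adj G x₃ w)

  record ConnSubgraphOffD : Set where
    field
      vs     : V G → Bool
      es     : V G → V G → Bool
      es-sym : ∀ u v → es u v ≡ es v u
      es⊆G   : ∀ u v → es u v ≡ true → Adj G u v
      es-ends : ∀ u v → es u v ≡ true → vs u ≡ true × vs v ≡ true
      connected : ∀ u v → vs u ≡ true → vs v ≡ true → Walk es u v
      off-D  : ∀ u v → es u v ≡ true → ¬ InED u v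

  MeetsDIn : ConnSubgraphOffD → List (V G) → Set
  MeetsDIn P S = ∀ v → (ConnSubgraphOffD.vs P v ≡ true × InVD v) ⇔ v ∈ S

  VDisjoint : ConnSubgraphOffD → ConnSubgraphOffD → Set
  VDisjoint P Q = ∀ v → ConnSubgraphOffD.vs P v ≡ true → ConnSubgraphOffD.vs Q v ≡ false

  CrossedPair : List (V G) → List (V G) → Set
  CrossedPair S T = Σ ConnSubgraphOffD λ P → Σ ConnSubgraphOffD λ Q →
                      VDisjoint P Q × MeetsDIn P S × MeetsDIn Q T

  IsCrossed : (x₁ x₂ x₃ x₄ x₅ : V G) → Set
  IsCrossed x₁ x₂ x₃ x₄ x₅ =
    CrossedPair (x₁ ∷ x₃ ∷ []) (x₂ ∷ x₄ ∷ x₅ ∷ []) ×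
    CrossedPair (x₁ ∷ x₃ ∷ x₅ ∷ []) (x₂ ∷ x₄ ∷ [])

Diverse : (G : Graph) → (a b c d : V G) → Set
Diverse G a b c d =
  Unique (a ∷ b ∷ c ∷ d ∷ []) ×
  ¬ Adj G a c × ¬ Adj G a d × ¬ Adj G b c × ¬ Adj G b d

{-# OPTIONS --safe #-}
-- The proof is a residual search for a sixth path from η(D) to η(G∖V(D)).  Grow a vertex set Y of H from
-- η(D), keeping an initial segment of each of the five paths η(x_j z_j) inside.  If only the five path
-- edges leave Y, then Y is the set of (i).  Otherwise some edge leaves Y at a vertex p.  The invariant is
-- that Y contains, as a minor with the right exits, either D with p subdividing an edge e, or D with e far
-- from x₅ linked to a vertex y of the path η(x₅ z₅) and p on that path between x₅ and y.  If the new edge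
-- leads to an unused vertex, that vertex joins Y.  If it leads to the j-th path and e is close to x_j, the
-- branch sets can be rearranged so that the new part of the path satisfies the invariant; if e is not
-- close to x_j, contracting one of the two linkages of the crossed domino to two adjacent vertices exhibits
-- the Petersen graph, except that for j = 5 the second form of the invariant arises.  If it leads to
-- η(f) with f in G∖V(D), the two forms give (iii) and (iv); when f and g are not diverse, moving z₅
-- turns (iv) into (iii).
--
-- Minors replace embeddings throughout: for cubic K, a connected branch set contains a tripod joining the
-- ends of its three edges, so a minor model of K in H yields a homeomorphic embedding.

module Submission where

open import Defs
open import Data.Nat as ℕ using (ℕ; zero; suc; _+_; _≤_; _<_; z≤n; s≤s; NonZero)
open import Data.Nat.DivMod using (_mod_)
open import Data.Nat.ListAction using (sum)
import Data.Nat.Properties as ℕₚ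
open import Data.Fin as Fin using (Fin; zero; suc) renaming (_≟_ to _≟F_)
open import Data.Fin.Patterns
import Data.Fin.Properties as Finₚ
open import Data.Bool as Bool using (Bool; true; false; _∧_; _∨_; not; if_then_else_)
open import Data.Bool.Properties using (T-≡; T?)
open import Data.Maybe using (Maybe; just; nothing; _>>=_) renaming (map to mapMaybe)
open import Data.Maybe.Properties using (just-injective; ≡-dec)
open import Data.Vec using (Vec; []; _∷_; lookup)
open import Data.List as List
  using (List; []; _∷_; _++_; length; filterᵇ; allFin; map; reverse; cartesianProduct; removeAt)
open import Data.List.Properties
  using (∷-injective; ∷ʳ-injectiveʳ; ++-assoc; unfold-reverse; reverse-++; reverse-involutive;
         length-++; length-tabulate; filter-++)
open import Data.List.Relation.Unary.All as All using (All; []; _∷_)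
import Data.List.Relation.Unary.All.Properties as Allₚ
open import Data.List.Relation.Unary.Any as Any using (Any; here; there)
import Data.List.Relation.Unary.Any.Properties as Anyₚ
open import Data.List.Relation.Unary.AllPairs using ([]; _∷_)
open import Data.List.Relation.Unary.Linked using (Linked; []; [-]; _∷_)
open import Data.List.Relation.Unary.Unique.Propositional using (Unique)
import Data.List.Relation.Unary.Unique.Propositional.Properties as Uniqueₚ
import Data.List.Relation.Unary.Unique.DecPropositional as DecUnique
open import Data.List.Membership.Propositional using (_∈_; _∉_)
open import Data.List.Membership.Propositional.Properties
  using (∈-++⁺ˡ; ∈-++⁺ʳ; ∈-++⁻; ∈-∃++; ∈-insert; ∈-allFin; ∈-filter⁺; ∈-filter⁻; ∈-map⁺; ∈-map⁻; ∈-lookup;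
         ∈-cartesianProduct⁺)
import Data.List.Membership.DecPropositional as DecMembership
open import Data.Product using (Σ; ∃₂; _×_; _,_; proj₁; proj₂)
import Data.Product.Properties as Productₚ
open import Data.Sum using (_⊎_; inj₁; inj₂; [_,_]′)
open import Data.Empty using (⊥; ⊥-elim)
open import Data.Unit using (tt)
open import Relation.Nullary using (¬_; Dec; yes; no)
open import Relation.Nullary.Decidable
  using (⌊_⌋; True; toWitness; map′; ¬?; _×-dec_; _⊎-dec_; _→-dec_)
open import Relation.Binary.PropositionalEquality
  using (_≡_; _≢_; refl; sym; trans; cong; cong₂; subst; module ≡-Reasoning)
open import Relation.Binary.PropositionalEquality.WithK using (≡-irrelevant)
open import Function using (_∘_; id; case_of_)
open import Function.Bundles using (_⇔_; mk⇔; Equivalence)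

-- Different edges leaving Y may need different rearrangements of the same part of H, so no single
-- rearranged domino is maintained: each vertex where such an edge starts has its own placement of a
-- shape, and a step has to update all of them. This closes up because ten forms suffice: with five
-- exit paths there are fifty jumps, each settled by one explicit map between small graphs that is
-- checked by evaluation.
--
-- That H is cubic keeps the update small. The landing vertex of a jump has its third edge along the
-- path, so new placements are only needed for the vertices of the path strictly before it.
--
-- The hypotheses on G enter through short circuits and small cuts. Girth five makes the domino
-- induced and leaves z₅ only one neighbour in it. Adjacency of the two contracted sides of a
-- linkage comes from a cut: the side without the centre is joined to the domino by two edges only,
-- so if it could not be extended to touch the other side, these would separate a circuit in it from
-- a circuit of the domino.

private variable
  A B : Set

-- Walks, chains and tripods

unique-++⁻ : (xs : List A) {ys : List A} → Unique (xs ++ ys) →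
             Unique xs × Unique ys × (∀ {v} → v ∈ xs → v ∉ ys)
unique-++⁻ []       u       = [] , u , λ ()
unique-++⁻ (x ∷ xs) (p ∷ u) with unique-++⁻ xs u
... | uxs , uys , dis = Allₚ.++⁻ˡ xs p ∷ uxs , uys , λ where
  (here refl) v∈ys → All.lookup (Allₚ.++⁻ʳ xs p) v∈ys refl
  (there v∈)  v∈ys → dis v∈ v∈ys

unique-++⁺ : {xs ys : List A} → Unique xs → Unique ys →
             (∀ {v} → v ∈ xs → v ∉ ys) → Unique (xs ++ ys)
unique-++⁺ ux uy dis = Uniqueₚ.++⁺ ux uy (λ (p , q) → dis p q)

∈-reverse⁻ : {x : A} (xs : List A) → x ∈ reverse xs → x ∈ xs
∈-reverse⁻ xs = Anyₚ.reverse⁻ {xs = xs}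

∈-reverse⁺ : {x : A} {xs : List A} → x ∈ xs → x ∈ reverse xs
∈-reverse⁺ = Anyₚ.reverse⁺

All-reverse : {P : A → Set} (xs : List A) → All P xs → All P (reverse xs)
All-reverse xs ps = All.tabulate (λ i → All.lookup ps (∈-reverse⁻ xs i))

All-prefix : {P : A → Set} (X : List A) {c : A} {Z : List A} → All P (X ++ c ∷ Z) → All P (X ++ c ∷ [])
All-prefix X ps = Allₚ.++⁺ (Allₚ.++⁻ˡ X ps) (All.head (Allₚ.++⁻ʳ X ps) ∷ [])

unique-reverse : (xs : List A) → Unique xs → Unique (reverse xs)
unique-reverse []       _ = []
unique-reverse (x ∷ xs) (p ∷ u) rewrite unfold-reverse x xs =
  unique-++⁺ (unique-reverse xs u) ([] ∷ []) λ where
    v∈ (here refl) → All.lookup p (∈-reverse⁻ xs v∈) refl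

module _ {n : ℕ} where
  open DecMembership (_≟F_ {n}) public using (_∈?_)

Symmetric : Graph → Set
Symmetric H = ∀ {u v} → Adj H u v → Adj H v u

simple⇒symmetric : ∀ {H} → IsSimple H → Symmetric H
simple⇒symmetric (s , _) {u} {v} a = trans (s v u) a

simple⇒irreflexive : ∀ {H} → IsSimple H → ∀ {u} → ¬ Adj H u u
simple⇒irreflexive (_ , i) {u} a with trans (sym a) (i u)
... | ()

data Within (H : Graph) (F : V H → Set) : V H → V H → Set where
  here : ∀ {u} → F u → Within H F u u
  go   : ∀ {u w v} → F u → Adj H u w → Within H F w v → Within H F u v

data Chain (H : Graph) : V H → List (V H) → V H → Set where
  one : ∀ {u} → Chain H u (u ∷ []) u
  _◂_ : ∀ {u w L t} → Adj H u w → Chain H w L t → Chain H u (u ∷ L) t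

infixr 5 _◂_

module _ {H : Graph} where

  within-trans : ∀ {F u v w} → Within H F u v → Within H F v w → Within H F u w
  within-trans (here _)   q = q
  within-trans (go f a p) q = go f a (within-trans p q)

  within-map : ∀ {F F′ : V H → Set} {u v} → (∀ {h} → F h → F′ h) → Within H F u v → Within H F′ u v
  within-map g (here f)   = here (g f)
  within-map g (go f a p) = go (g f) a (within-map g p)

  within-source : ∀ {F u v} → Within H F u v → F u
  within-source (here f)   = f
  within-source (go f _ _) = f

  within-sym : Symmetric H → ∀ {F u v} → Within H F u v → Within H F v u
  within-sym s (here f)   = here f
  within-sym s (go f a p) =
    within-trans (within-sym s p) (go (within-source p) (s a) (here f))

  chain-++ : ∀ {u L t s M r} → Chain H u L t → Adj H t s → Chain H s M r → Chain H u (L ++ M) r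
  chain-++ one     a d = a ◂ d
  chain-++ (b ◂ c) a d = b ◂ chain-++ c a d

  chain-reverse : Symmetric H → ∀ {u L t} → Chain H u L t → Chain H t (reverse L) u
  chain-reverse s one = one
  chain-reverse s (_◂_ {u} {L = L} a c) rewrite unfold-reverse u L =
    chain-++ (chain-reverse s c) (s a) one

  chain-linked : ∀ {u L t} → Chain H u L t → Linked (Adj H) L
  chain-linked one           = [-]
  chain-linked (a ◂ one)     = a ∷ [-]
  chain-linked (a ◂ (b ◂ c)) = a ∷ chain-linked (b ◂ c)

  linked-chain : ∀ {a mid b} → Linked (Adj H) (a ∷ mid ++ b ∷ []) → Chain H a (a ∷ mid ++ b ∷ []) b
  linked-chain {mid = []}      (r ∷ [-]) = r ◂ one
  linked-chain {mid = m ∷ mid} (r ∷ l)   = r ◂ linked-chain l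

  chain-head : ∀ {u L t} → Chain H u L t → u ∈ L
  chain-head one     = here refl
  chain-head (_ ◂ _) = here refl

  chain-last : ∀ {u L t} → Chain H u L t → t ∈ L
  chain-last one     = here refl
  chain-last (_ ◂ c) = there (chain-last c)

  chain-within-∈ : ∀ {F u L t v} → Chain H u L t → All F L → v ∈ L → Within H F u v
  chain-within-∈ one     (f ∷ _)  (here refl) = here f
  chain-within-∈ (a ◂ c) (f ∷ _)  (here refl) = here f
  chain-within-∈ (a ◂ c) (f ∷ fs) (there v∈)  = go f a (chain-within-∈ c fs v∈)

  chain-split : ∀ {u L t} (X : List (V H)) {c Z} → Chain H u L t → L ≡ X ++ c ∷ Z →
                Chain H u (X ++ c ∷ []) c × Chain H c (c ∷ Z) t
  chain-split []      one     refl = one , one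
  chain-split []      (a ◂ d) refl = one , (a ◂ d)
  chain-split (x ∷ X) one     eq with ∷-injective eq
  chain-split (x ∷ []) one    eq | _ , ()
  chain-split (x ∷ _ ∷ _) one eq | _ , ()
  chain-split (x ∷ X) (a ◂ d) eq with ∷-injective eq
  ... | refl , eq′ with chain-split X d eq′
  ...   | p , q = (a ◂ p) , q

  -- When the new first vertex already occurs, everything before that occurrence is dropped.
  simple-chain : ∀ {F u t} → Within H F u t →
                 Σ (List (V H)) λ L → Chain H u L t × Unique L × All F L
  simple-chain (here f) = _ , one , ([] ∷ []) , (f ∷ [])
  simple-chain (go {u} f a p) with simple-chain p
  ... | L , c , uq , fs with u ∈? L
  ...   | no u∉L = u ∷ L , (a ◂ c) , (All.tabulate (λ i e → u∉L (subst (_∈ L) (sym e) i)) ∷ uq) , (f ∷ fs)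
  ...   | yes u∈L with ∈-∃++ u∈L
  ...     | X , Z , refl = u ∷ Z , proj₂ (chain-split X c refl)
                         , proj₁ (proj₂ (unique-++⁻ X uq)) , Allₚ.++⁻ʳ X fs

  first-hit : ∀ {u L t} (X : List (V H)) → Chain H u L t → t ∈ X →
              Σ (V H) λ c → Σ (List (V H)) λ Z → Σ (List (V H)) λ Z′ →
                c ∈ X × L ≡ Z ++ c ∷ Z′ × (∀ {v} → v ∈ Z → v ∉ X)
  first-hit X one t∈X = _ , [] , [] , t∈X , refl , λ ()
  first-hit X (_◂_ {u} a c) t∈X with u ∈? X
  ... | yes u∈X = u , [] , _ , u∈X , refl , λ ()
  ... | no u∉X with first-hit X c t∈X
  ...   | c′ , Z , Z′ , c∈X , eq , dis = c′ , u ∷ Z , Z′ , c∈X , cong (u ∷_) eq , λ where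
    (here refl) → u∉X
    (there v∈)  → dis v∈

record Tripod (H : Graph) (F : V H → Set) (t : Fin 3 → V H) : Set where
  field
    hub      : V H
    leg      : Fin 3 → List (V H)
    chain    : ∀ i → Chain H hub (hub ∷ leg i) (t i)
    unique   : ∀ i → Unique (hub ∷ leg i)
    inside   : ∀ i → All F (hub ∷ leg i)
    disjoint : ∀ i j → i ≢ j → ∀ {w} → w ∈ leg i → w ∉ leg j

module _ {H : Graph} (symH : Symmetric H) where

  -- Follow a simple path from `t 2` towards `t 0` until it first meets a simple path from `t 0` to
  -- `t 1`. The meeting vertex is the hub, and the three remaining pieces are disjoint by the choice
  -- of the first meeting.
  tripod : ∀ {F} (t : Fin 3 → V H) → (∀ i j → Within H F (t i) (t j)) → Tripod H F t
  tripod {F} t conn with simple-chain (conn zero 1F) | simple-chain (conn 2F zero)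
  ... | X , cX , uX , fX | Y , cY , uY , fY with first-hit X cY (chain-head cX)
  ...   | c , Z , Z′ , c∈X , refl , dis with ∈-∃++ c∈X
  ...     | X₁ , X₂ , refl = record
    { hub = c ; leg = leg ; chain = chain ; unique = uniq ; inside = ins ; disjoint = disj }
    where
    rev : (L : List (V H)) → c ∷ reverse L ≡ reverse (L ++ c ∷ [])
    rev L = sym (reverse-++ L (c ∷ []))
    leg : Fin 3 → List (V H)
    leg zero = reverse X₁
    leg 1F   = X₂
    leg 2F   = reverse Z
    chain : ∀ i → Chain H c (c ∷ leg i) (t i)
    chain zero rewrite rev X₁ = chain-reverse symH (proj₁ (chain-split X₁ cX refl))
    chain 1F = proj₂ (chain-split X₁ cX refl)
    chain 2F rewrite rev Z = chain-reverse symH (proj₁ (chain-split Z cY refl))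
    ins : ∀ i → All F (c ∷ leg i)
    ins zero rewrite rev X₁ = All-reverse (X₁ ++ c ∷ []) (All-prefix X₁ {Z = X₂} fX)
    ins 1F = Allₚ.++⁻ʳ X₁ fX
    ins 2F rewrite rev Z = All-reverse (Z ++ c ∷ []) (All-prefix Z {Z = Z′} fY)
    sX = unique-++⁻ X₁ uX
    sZ = unique-++⁻ Z uY
    uniq : ∀ i → Unique (c ∷ leg i)
    uniq zero rewrite rev X₁ = unique-reverse (X₁ ++ c ∷ []) (unique-++⁺ (proj₁ sX) ([] ∷ [])
      λ where v∈ (here refl) → proj₂ (proj₂ sX) v∈ (here refl))
    uniq 1F = proj₁ (proj₂ sX)
    uniq 2F rewrite rev Z = unique-reverse (Z ++ c ∷ []) (unique-++⁺ (proj₁ sZ) ([] ∷ [])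
      λ where v∈ (here refl) → proj₂ (proj₂ sZ) v∈ (here refl))
    d01 : ∀ {w} → w ∈ reverse X₁ → w ∉ X₂
    d01 p q = proj₂ (proj₂ sX) (∈-reverse⁻ X₁ p) (there q)
    d20 : ∀ {w} → w ∈ reverse Z → w ∉ reverse X₁
    d20 p q = dis (∈-reverse⁻ Z p) (∈-++⁺ˡ (∈-reverse⁻ X₁ q))
    d21 : ∀ {w} → w ∈ reverse Z → w ∉ X₂
    d21 p q = dis (∈-reverse⁻ Z p) (∈-++⁺ʳ X₁ (there q))
    disj : ∀ i j → i ≢ j → ∀ {w} → w ∈ leg i → w ∉ leg j
    disj zero zero n = ⊥-elim (n refl)
    disj zero 1F _ = d01
    disj zero 2F _ p q = d20 q p
    disj 1F zero _ p q = d01 q p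
    disj 1F 1F n = ⊥-elim (n refl)
    disj 1F 2F _ p q = d21 q p
    disj 2F zero _ = d20
    disj 2F 1F _ = d21
    disj 2F 2F n = ⊥-elim (n refl)

-- Minor models and embeddings

-- A model exhibits I with relation R as a minor of H: the vertices with a given label form a
-- connected branch set, and unlabelled vertices are discarded.
record Model (H : Graph) {I : Set} (R : I → I → Set) : Set where
  field
    lab  : V H → Maybe I
    conn : ∀ {i h h′} → lab h ≡ just i → lab h′ ≡ just i → Within H (λ v → lab v ≡ just i) h h′
    edge : ∀ {i j} → R i j → ∃₂ λ h h′ → lab h ≡ just i × lab h′ ≡ just j × Adj H h h′

data Linkage {I I′ : Set} (R : I → I → Set) (f : I → Maybe I′) (a : I′) : I → I → Set where
  stop : ∀ {i} → f i ≡ just a → Linkage R f a i i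
  move : ∀ {i j k} → f i ≡ just a → R i j ⊎ R j i → Linkage R f a j k → Linkage R f a i k

>>=-just : {A B : Set} (m : Maybe A) {f : A → Maybe B} {b : B} → (m >>= f) ≡ just b →
           Σ A λ a → m ≡ just a × f a ≡ just b
>>=-just (just a) eq = a , refl , eq

module _ {H : Graph} (symH : Symmetric H) where

  -- A minor of a minor is a minor: the branch sets over one fibre of `f` are united, and a
  -- `Linkage` supplies the edges of H that keep the union connected. Indices with `f i ≡ nothing`
  -- are deleted.
  coarsen : {I I′ : Set} {R : I → I → Set} {R′ : I′ → I′ → Set} (f : I → Maybe I′) →
            (∀ {i j a} → f i ≡ just a → f j ≡ just a → Linkage R f a i j) →
            (∀ {a b} → R′ a b → ∃₂ λ i j → f i ≡ just a × f j ≡ just b × (R i j ⊎ R j i)) →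
            Model H R → Model H R′
  coarsen {I} {I′} {R} {R′} f linked covered M = record { lab = lab′ ; conn = conn′ ; edge = edge′ }
    where
    open Model M
    lab′ : V H → Maybe I′
    lab′ h = lab h >>= f
    lift : ∀ {i a v} → f i ≡ just a → lab v ≡ just i → lab′ v ≡ just a
    lift {v = v} fi lv rewrite lv = fi
    walk : ∀ {i j a h h′} → Linkage R f a i j → lab h ≡ just i → lab h′ ≡ just j →
           Within H (λ v → lab′ v ≡ just a) h h′
    walk {i} (stop fi) li lj = within-map (lift fi) (conn li lj)
    walk (move {i} {j} fi r l) lh lh′ with orient r
      where
      orient : R i j ⊎ R j i → ∃₂ λ h h′ → lab h ≡ just i × lab h′ ≡ just j × Adj H h h′
      orient (inj₁ r) = edge r
      orient (inj₂ r) with edge r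
      ... | h , h′ , l , l′ , a = h′ , h , l′ , l , symH a
    ... | g , g′ , lg , lg′ , a =
      within-trans (within-map (lift fi) (conn lh lg)) (go (lift fi lg) a (walk l lg′ lh′))
    conn′ : ∀ {a h h′} → lab′ h ≡ just a → lab′ h′ ≡ just a → Within H (λ v → lab′ v ≡ just a) h h′
    conn′ {a} {h} {h′} p q with >>=-just (lab h) p | >>=-just (lab h′) q
    ... | i , li , fi | j , lj , fj = walk (linked fi fj) li lj
    edge′ : ∀ {a b} → R′ a b → ∃₂ λ h h′ → lab′ h ≡ just a × lab′ h′ ≡ just b × Adj H h h′
    edge′ r with covered r
    ... | i , j , fi , fj , inj₁ q with edge q
    ...   | h , h′ , l , l′ , a = h , h′ , lift fi l , lift fj l′ , a
    edge′ r | i , j , fi , fj , inj₂ q with edge q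
    ...   | h , h′ , l , l′ , a = h′ , h , lift fi l′ , lift fj l , symH a

-- Neighbours are enumerated by `Fin 3` so that the arms at `u` can be read off from the legs of one
-- tripod.
record ThreeNeighbours (K : Graph) (u : V K) : Set where
  field
    nb       : Fin 3 → V K
    adjacent : ∀ i → Adj K u (nb i)
    all      : ∀ {v} → Adj K u v → Σ (Fin 3) λ i → v ≡ nb i

Consec-∈ : {p q : A} {xs : List A} → Consec p q xs → p ∈ xs × q ∈ xs
Consec-∈ (ys , zs , refl) = ∈-++⁺ʳ ys (here refl) , ∈-++⁺ʳ ys (there (here refl))

Consec-≢ : {p q : A} {xs : List A} → Unique xs → Consec p q xs → p ≢ q
Consec-≢ u (ys , zs , refl) refl with proj₁ (proj₂ (unique-++⁻ ys u))
... | (p≢q ∷ _) ∷ _ = p≢q refl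

-- Star-shaped subtrees of the branch sets, one arm towards each neighbour.
record Arms (K H : Graph) : Set where
  field
    lab : V H → Maybe (V K)
    hub : V K → V H
    leg : V K → V K → List (V H)
    attach : ∀ u v → Adj K u v → V H
    attach-adj : ∀ u v p q → Adj H (attach u v p) (attach v u q)
    hub-fibre  : ∀ u → lab (hub u) ≡ just u
    arm-chain  : ∀ u v p → Chain H (hub u) (hub u ∷ leg u v) (attach u v p)
    arm-unique : ∀ u v → Adj K u v → Unique (hub u ∷ leg u v)
    arm-fibre  : ∀ u v → Adj K u v → All (λ h → lab h ≡ just u) (hub u ∷ leg u v)
    leg-disjoint : ∀ u v v′ → Adj K u v → Adj K u v′ → v ≢ v′ → ∀ {w} → w ∈ leg u v → w ∉ leg u v′

module _ {K H : Graph} (symK : Symmetric K) (irrK : ∀ {u} → ¬ Adj K u u) (symH : Symmetric H)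
         (cubic : ∀ u → ThreeNeighbours K u) (M : Model H (Adj K)) where
  private
   open Model M
   module N u = ThreeNeighbours (cubic u)

   Fibre : V K → V H → Set
   Fibre u h = lab h ≡ just u

   -- Oriented so that attach u v and attach v u are the two ends of one edge of H.
   attach : ∀ u v → Adj K u v → V H
   attach u v p with u Finₚ.<? v
   ... | yes _ = proj₁ (edge p)
   ... | no _  = proj₁ (proj₂ (edge (symK p)))

   attach-fibre : ∀ u v p → Fibre u (attach u v p)
   attach-fibre u v p with u Finₚ.<? v
   ... | yes _ = proj₁ (proj₂ (proj₂ (edge p)))
   ... | no _  = proj₁ (proj₂ (proj₂ (proj₂ (edge (symK p)))))

   attach-adj : ∀ u v p q → Adj H (attach u v p) (attach v u q)
   attach-adj u v p q with u Finₚ.<? v | v Finₚ.<? u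
   ... | yes a | yes b = ⊥-elim (ℕₚ.<-asym a b)
   ... | no a  | no b  = ⊥-elim (irrK (subst (Adj K u) (sym u≡v) p))
     where u≡v = Finₚ.≤-antisym (ℕₚ.≮⇒≥ b) (ℕₚ.≮⇒≥ a)
   ... | yes _ | no _ rewrite ≡-irrelevant (symK q) p = proj₂ (proj₂ (proj₂ (proj₂ (edge p))))
   ... | no _ | yes _ rewrite ≡-irrelevant (symK p) q = symH (proj₂ (proj₂ (proj₂ (proj₂ (edge q)))))

   tripods : ∀ u → Tripod H (Fibre u) (λ i → attach u (N.nb u i) (N.adjacent u i))
   tripods u = tripod symH _ λ i j → conn (attach-fibre u (N.nb u i) (N.adjacent u i)) (attach-fibre u (N.nb u j) (N.adjacent u j))
   module T u = Tripod (tripods u)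

   legOf : ∀ u v → Dec (Adj K u v) → List (V H)
   legOf u v (yes p) = T.leg u (proj₁ (N.all u p))
   -- A dummy value for non-adjacent pairs: `leg` has to be total because `inner` of an embedding
   -- is.
   legOf u v (no _)  = []

   leg : V K → V K → List (V H)
   leg u v = legOf u v (adj K u v Bool.≟ true)

   leg-≡ : ∀ u v (p : Adj K u v) → leg u v ≡ T.leg u (proj₁ (N.all u p))
   leg-≡ u v p with adj K u v Bool.≟ true
   ... | yes p′ rewrite ≡-irrelevant p′ p = refl
   ... | no ¬p = ⊥-elim (¬p p)

   arm-chain : ∀ u v p → Chain H (T.hub u) (T.hub u ∷ leg u v) (attach u v p)
   arm-chain u v p rewrite leg-≡ u v p with N.all u p
   ... | i , refl rewrite ≡-irrelevant p (N.adjacent u i) = T.chain u i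

   arm-unique : ∀ u v → Adj K u v → Unique (T.hub u ∷ leg u v)
   arm-unique u v p rewrite leg-≡ u v p = T.unique u _

   arm-fibre : ∀ u v → Adj K u v → All (Fibre u) (T.hub u ∷ leg u v)
   arm-fibre u v p rewrite leg-≡ u v p = T.inside u _

   hub-fibre : ∀ u → Fibre u (T.hub u)
   hub-fibre u = All.head (T.inside u zero)

   leg-disjoint : ∀ u v v′ → Adj K u v → Adj K u v′ → v ≢ v′ → ∀ {w} → w ∈ leg u v → w ∉ leg u v′
   leg-disjoint u v v′ p p′ v≢v′ rewrite leg-≡ u v p | leg-≡ u v′ p′ =
     T.disjoint u _ _ λ e → v≢v′ (trans (proj₂ (N.all u p)) (trans (cong (N.nb u) e) (sym (proj₂ (N.all u p′)))))

  model⇒arms : Arms K H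
  model⇒arms = record
    { lab = lab ; hub = T.hub ; leg = leg ; attach = attach ; attach-adj = attach-adj
    ; hub-fibre = hub-fibre ; arm-chain = arm-chain ; arm-unique = arm-unique
    ; arm-fibre = arm-fibre ; leg-disjoint = leg-disjoint }

module _ {K H : Graph} (symK : Symmetric K) (irrK : ∀ {u} → ¬ Adj K u u) (symH : Symmetric H)
         (arms : Arms K H) where
  open Arms arms

  private
   Fibre : V K → V H → Set
   Fibre u h = lab h ≡ just u

   arm : V K → V K → List (V H)
   arm u v = hub u ∷ leg u v

   fibre-unique : ∀ {u v h} → Fibre u h → Fibre v h → u ≡ v
   fibre-unique p q = just-injective (trans (sym p) q)

   mid : V K → V K → List (V H)
   mid u v = leg u v ++ reverse (leg v u)

   full-≡ : ∀ u v → fullPath (hub u) (mid u v) (hub v) ≡ arm u v ++ reverse (arm v u)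
   full-≡ u v = cong (hub u ∷_) (begin
     (leg u v ++ reverse (leg v u)) ++ hub v ∷ [] ≡⟨ ++-assoc (leg u v) _ _ ⟩
     leg u v ++ reverse (leg v u) ++ hub v ∷ []   ≡⟨ cong (leg u v ++_) (unfold-reverse (hub v) (leg v u)) ⟨
     leg u v ++ reverse (arm v u)                   ∎)
     where open ≡-Reasoning

   full : V K → V K → List (V H)
   full u v = fullPath (hub u) (mid u v) (hub v)

   full-unique : ∀ u v → Adj K u v → Unique (full u v)
   full-unique u v p rewrite full-≡ u v =
     unique-++⁺ (arm-unique u v p) (unique-reverse (arm v u) (arm-unique v u (symK p))) λ a b →
       irrK (subst (Adj K u) (sym (fibre-unique (All.lookup (arm-fibre u v p) a)
         (All.lookup (arm-fibre v u (symK p)) (∈-reverse⁻ (arm v u) b)))) p)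

   full-linked : ∀ u v → Adj K u v → Linked (Adj H) (full u v)
   full-linked u v p rewrite full-≡ u v =
     chain-linked (chain-++ (arm-chain u v p) (attach-adj u v p (symK p))
                            (chain-reverse symH (arm-chain v u (symK p))))

   full-arms : ∀ u v {w} → w ∈ full u v → w ∈ arm u v ⊎ w ∈ arm v u
   full-arms u v w∈ rewrite full-≡ u v with ∈-++⁻ (arm u v) w∈
   ... | inj₁ q = inj₁ q
   ... | inj₂ q = inj₂ (∈-reverse⁻ (arm v u) q)

   -- An arm stays in the branch set of its own vertex, so arms that meet start at the same hub;
   -- beyond the hub the legs towards different neighbours are disjoint.
   arms-meet : ∀ a b c d → Adj K a b → Adj K c d → ¬ (a ≡ c × b ≡ d) →
               ∀ {w} → w ∈ arm a b → w ∈ arm c d → a ≡ c × w ≡ hub a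
   arms-meet a b c d p q ne w∈ w∈′
     with fibre-unique (All.lookup (arm-fibre a b p) w∈) (All.lookup (arm-fibre c d q) w∈′)
   arms-meet a b .a d p q ne (here e)   _          | refl = refl , e
   arms-meet a b .a d p q ne (there _)  (here e)   | refl = refl , e
   arms-meet a b .a d p q ne (there w∈) (there w∈′) | refl =
     ⊥-elim (leg-disjoint a b d p q (λ e → ne (refl , e)) w∈ w∈′)

   paths-meet : ∀ a b c d → Adj K a b → Adj K c d → ¬ SameEdge a b c d →
                ∀ {w} → w ∈ full a b → w ∈ full c d →
                Σ (V K) λ k → w ≡ hub k × (k ≡ a ⊎ k ≡ b) × (k ≡ c ⊎ k ≡ d)
   paths-meet a b c d p q ne w∈ w∈′ with full-arms a b w∈ | full-arms c d w∈′
   ... | inj₁ x | inj₁ y with arms-meet a b c d p q (ne ∘ inj₁) x y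
   ...   | refl , e = a , e , inj₁ refl , inj₁ refl
   paths-meet a b c d p q ne w∈ w∈′ | inj₁ x | inj₂ y with arms-meet a b d c p (symK q) (ne ∘ inj₂) x y
   ...   | refl , e = a , e , inj₁ refl , inj₂ refl
   paths-meet a b c d p q ne w∈ w∈′ | inj₂ x | inj₁ y
     with arms-meet b a c d (symK p) q (λ (e , e′) → ne (inj₂ (e′ , e))) x y
   ...   | refl , e = b , e , inj₂ refl , inj₁ refl
   paths-meet a b c d p q ne w∈ w∈′ | inj₂ x | inj₂ y
     with arms-meet b a d c (symK p) (symK q) (λ (e , e′) → ne (inj₁ (e′ , e))) x y
   ...   | refl , e = b , e , inj₂ refl , inj₂ refl

   two-common : ∀ {a b c d k l : V K} → k ≢ l → k ≡ a ⊎ k ≡ b → k ≡ c ⊎ k ≡ d →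
                l ≡ a ⊎ l ≡ b → l ≡ c ⊎ l ≡ d → SameEdge a b c d
   two-common n (inj₁ refl) (inj₁ refl) (inj₁ refl) _ = ⊥-elim (n refl)
   two-common n (inj₁ refl) (inj₁ refl) (inj₂ refl) (inj₁ refl) = ⊥-elim (n refl)
   two-common n (inj₁ refl) (inj₁ refl) (inj₂ refl) (inj₂ refl) = inj₁ (refl , refl)
   two-common n (inj₁ refl) (inj₂ refl) (inj₁ refl) _ = ⊥-elim (n refl)
   two-common n (inj₁ refl) (inj₂ refl) (inj₂ refl) (inj₁ refl) = inj₂ (refl , refl)
   two-common n (inj₁ refl) (inj₂ refl) (inj₂ refl) (inj₂ refl) = ⊥-elim (n refl)
   two-common n (inj₂ refl) (inj₁ refl) (inj₁ refl) (inj₁ refl) = ⊥-elim (n refl)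
   two-common n (inj₂ refl) (inj₁ refl) (inj₁ refl) (inj₂ refl) = inj₂ (refl , refl)
   two-common n (inj₂ refl) (inj₁ refl) (inj₂ refl) _ = ⊥-elim (n refl)
   two-common n (inj₂ refl) (inj₂ refl) (inj₁ refl) (inj₁ refl) = inj₁ (refl , refl)
   two-common n (inj₂ refl) (inj₂ refl) (inj₁ refl) (inj₂ refl) = ⊥-elim (n refl)
   two-common n (inj₂ refl) (inj₂ refl) (inj₂ refl) _ = ⊥-elim (n refl)

   -- Two paths meet only in hubs of common ends, so a shared step would give two different common
   -- ends, and the two edges would coincide.
   no-shared-step : ∀ a b c d → Adj K a b → Adj K c d → ¬ SameEdge a b c d → ∀ {p q} →
                    Consec p q (full a b) → p ∈ full c d → q ∈ full c d → ⊥
   no-shared-step a b c d e e′ ne con p∈ q∈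
     with paths-meet a b c d e e′ ne (proj₁ (Consec-∈ con)) p∈
        | paths-meet a b c d e e′ ne (proj₂ (Consec-∈ con)) q∈
   ... | k , refl , x , y | l , refl , x′ , y′ =
     ne (two-common (λ k≡l → Consec-≢ (full-unique a b e) con (cong hub k≡l)) x y x′ y′)

   hub∉mid : ∀ u v → Adj K u v → ∀ {k w} → k ≡ u ⊎ k ≡ v → w ≡ hub k → w ∉ mid u v
   hub∉mid u v p k∈ w≡ w∈ with full-unique u v p
   hub∉mid u v p (inj₁ refl) refl w∈ | ne ∷ _ = All.lookup ne (∈-++⁺ˡ w∈) refl
   hub∉mid u v p (inj₂ refl) refl w∈ | _ ∷ uq = proj₂ (proj₂ (unique-++⁻ (mid u v) uq)) w∈ (here refl)

  arms⇒embedding : Embedding K H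
  arms⇒embedding = record
    { vmap      = hub
    ; vmap-inj  = λ u v e → fibre-unique (hub-fibre u) (subst (Fibre v) (sym e) (hub-fibre v))
    ; inner     = mid
    ; inner-sym = λ u v _ → sym (trans (reverse-++ (leg u v) (reverse (leg v u)))
                                       (cong (_++ reverse (leg u v)) (reverse-involutive (leg v u))))
    ; isPath    = λ u v p → full-unique u v p , full-linked u v p
    ; edge-disj = λ where
        a b c d e e′ ne p q con (inj₁ con′) →
          no-shared-step a b c d e e′ ne con (proj₁ (Consec-∈ con′)) (proj₂ (Consec-∈ con′))
        a b c d e e′ ne p q con (inj₂ con′) →
          no-shared-step a b c d e e′ ne con (proj₂ (Consec-∈ con′)) (proj₁ (Consec-∈ con′))
    ; vert-disj = λ a b c d e e′ ne w w∈ w∈′ →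
        let k , w≡ , k∈ , _ = paths-meet a b c d e e′ ne (there (∈-++⁺ˡ w∈)) w∈′
        in hub∉mid a b e k∈ w≡ w∈
    ; ends      = λ u v p w → mk⇔ (to u v p w) (from u v w)
    }
    where
    to : ∀ u v → Adj K u v → ∀ w → hub w ∈ full u v → w ≡ u ⊎ w ≡ v
    to u v p w w∈ with full-arms u v w∈
    ... | inj₁ x = inj₁ (fibre-unique (hub-fibre w) (All.lookup (arm-fibre u v p) x))
    ... | inj₂ x = inj₂ (fibre-unique (hub-fibre w) (All.lookup (arm-fibre v u (symK p)) x))
    from : ∀ u v w → w ≡ u ⊎ w ≡ v → hub w ∈ full u v
    from u v w (inj₁ refl) = here refl
    from u v w (inj₂ refl) = there (∈-++⁺ʳ (mid u v) (here refl))

record Trivalent (K : Graph) : Set where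
  field
    symmetric   : Symmetric K
    irreflexive : ∀ {u} → ¬ Adj K u u
    three       : ∀ u → ThreeNeighbours K u

model⇒embedding : ∀ {K H} → Trivalent K → Symmetric H → Model H (Adj K) → Embedding K H
model⇒embedding t symH M = arms⇒embedding symmetric irreflexive symH (model⇒arms symmetric irreflexive symH three M)
  where open Trivalent t

-- Cubic graphs and added edges

unique-⊆-length : {xs ys : List A} → Unique xs → (∀ {v} → v ∈ xs → v ∈ ys) → length xs ≤ length ys
unique-⊆-length [] sub = z≤n
unique-⊆-length {xs = x ∷ xs} (p ∷ u) sub with ∈-∃++ (sub (here refl))
... | X , Z , refl = begin
  suc (length xs)             ≤⟨ s≤s (unique-⊆-length u sub′) ⟩
  suc (length (X ++ Z))       ≡⟨ cong suc (length-++ X) ⟩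
  suc (length X + length Z)   ≡⟨ ℕₚ.+-suc (length X) (length Z) ⟨
  length X + length (x ∷ Z)   ≡⟨ length-++ X ⟨
  length (X ++ x ∷ Z)         ∎
  where
  open ℕₚ.≤-Reasoning
  sub′ : ∀ {v} → v ∈ xs → v ∈ X ++ Z
  sub′ v∈ with ∈-++⁻ X (sub (there v∈))
  ... | inj₁ q         = ∈-++⁺ˡ q
  ... | inj₂ (here e)  = ⊥-elim (All.lookup p v∈ (sym e))
  ... | inj₂ (there q) = ∈-++⁺ʳ X q

∨⁻ : ∀ {x y} → x ∨ y ≡ true → x ≡ true ⊎ y ≡ true
∨⁻ {true}  _ = inj₁ refl
∨⁻ {false} e = inj₂ e

∨⁺ : ∀ {x y} → x ≡ true ⊎ y ≡ true → x ∨ y ≡ true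
∨⁺ (inj₁ refl)         = refl
∨⁺ {true}  (inj₂ refl) = refl
∨⁺ {false} (inj₂ refl) = refl

∧⁻ : ∀ {x y} → x ∧ y ≡ true → x ≡ true × y ≡ true
∧⁻ {true} e = refl , e

∧⁺ : ∀ {x y} → x ≡ true → y ≡ true → x ∧ y ≡ true
∧⁺ refl refl = refl

not⁻ : ∀ {x} → not x ≡ true → x ≡ false
not⁻ {false} _ = refl

≢true⇒false : ∀ {x} → x ≢ true → x ≡ false
≢true⇒false {true}  n = ⊥-elim (n refl)
≢true⇒false {false} _ = refl

true≢false : ∀ {x} → x ≡ true → x ≢ false
true≢false refl ()

∈-filterᵇ⁺ : {p : A → Bool} {x : A} {xs : List A} → x ∈ xs → p x ≡ true → x ∈ filterᵇ p xs
∈-filterᵇ⁺ {p = p} x∈ px = ∈-filter⁺ (T? ∘ p) x∈ (Equivalence.from T-≡ px)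

∈-filterᵇ⁻ : {p : A → Bool} {x : A} {xs : List A} → x ∈ filterᵇ p xs → x ∈ xs × p x ≡ true
∈-filterᵇ⁻ {p = p} {xs = xs} x∈ with ∈-filter⁻ (T? ∘ p) {xs = xs} x∈
... | q , t = q , Equivalence.to T-≡ t

unique-filterᵇ : (p : A → Bool) {xs : List A} → Unique xs → Unique (filterᵇ p xs)
unique-filterᵇ p = Uniqueₚ.filter⁺ (T? ∘ p)

==⁻ : ∀ {n} {u v : Fin n} → (u == v) ≡ true → u ≡ v
==⁻ {u = u} {v} e with u ≟F v
... | yes p = p
==⁻ {u = u} {v} () | no _

==⁺ : ∀ {n} {u v : Fin n} → u ≡ v → (u == v) ≡ true
==⁺ {u = u} refl with u ≟F u
... | yes _ = refl
... | no n  = ⊥-elim (n refl)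

isPair⁻ : ∀ {n} {u v a b : Fin n} → isPair u v a b ≡ true → SameEdge u v a b
isPair⁻ e with ∨⁻ e
... | inj₁ x with ∧⁻ x
...   | p , q = inj₁ (==⁻ p , ==⁻ q)
isPair⁻ e | inj₂ x with ∧⁻ x
...   | p , q = inj₂ (==⁻ p , ==⁻ q)

isPair⁺ : ∀ {n} {u v a b : Fin n} → SameEdge u v a b → isPair u v a b ≡ true
isPair⁺ (inj₁ (p , q)) = ∨⁺ (inj₁ (∧⁺ (==⁺ p) (==⁺ q)))
isPair⁺ (inj₂ (p , q)) = ∨⁺ (inj₂ (∧⁺ (==⁺ p) (==⁺ q)))

SameEdge-swap : {a b c d : A} → SameEdge a b c d → SameEdge b a c d
SameEdge-swap (inj₁ (p , q)) = inj₂ (q , p)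
SameEdge-swap (inj₂ (p , q)) = inj₁ (q , p)

neighbours : (G : Graph) → V G → List (V G)
neighbours G v = filterᵇ (adj G v) (allFin (size G))

module _ {G : Graph} where

  ∈-neighbours⁺ : ∀ {v w} → Adj G v w → w ∈ neighbours G v
  ∈-neighbours⁺ {w = w} a = ∈-filterᵇ⁺ (∈-allFin w) a

  ∈-neighbours⁻ : ∀ {v w} → w ∈ neighbours G v → Adj G v w
  ∈-neighbours⁻ w∈ = proj₂ (∈-filterᵇ⁻ {xs = allFin (size G)} w∈)

  unique-neighbours : ∀ v → Unique (neighbours G v)
  unique-neighbours v = unique-filterᵇ (adj G v) (Uniqueₚ.allFin⁺ (size G))

  degree-bound : ∀ {v} → degree G v ≡ 3 → {ws : List (V G)} → Unique ws → All (Adj G v) ws → length ws ≤ 3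
  degree-bound {v} d u as = subst (_ ≤_) d (unique-⊆-length u λ w∈ → ∈-neighbours⁺ (All.lookup as w∈))

  cubic-three : ∀ {v} → degree G v ≡ 3 → ThreeNeighbours G v
  cubic-three {v} d = go′ (neighbours G v) d ∈-neighbours⁻ ∈-neighbours⁺
    where
    go′ : (L : List (V G)) → length L ≡ 3 → (∀ {w} → w ∈ L → Adj G v w) → (∀ {w} → Adj G v w → w ∈ L) →
          ThreeNeighbours G v
    go′ (a ∷ b ∷ c ∷ []) refl to from = record { nb = nb ; adjacent = adjacent ; all = all′ ∘ from }
      where
      nb : Fin 3 → V G
      nb = lookup (a ∷ b ∷ c ∷ [])
      adjacent : ∀ i → Adj G v (nb i)
      adjacent zero = to (here refl)
      adjacent 1F   = to (there (here refl))
      adjacent 2F   = to (there (there (here refl)))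
      all′ : ∀ {w} → w ∈ a ∷ b ∷ c ∷ [] → Σ (Fin 3) λ i → w ≡ nb i
      all′ (here e)                 = zero , e
      all′ (there (here e))         = suc zero , e
      all′ (there (there (here e))) = suc 1F , e

  no-four : ∀ {v a b c e} → degree G v ≡ 3 → Unique (a ∷ b ∷ c ∷ e ∷ []) → ¬ All (Adj G v) (a ∷ b ∷ c ∷ e ∷ [])
  no-four d u as = ℕₚ.<⇒≱ ℕₚ.≤-refl (degree-bound d u as)

  another-neighbour : ∀ {v} → degree G v ≡ 3 → (L : List (V G)) → length L < 3 → Σ (V G) λ c → Adj G v c × c ∉ L
  another-neighbour {v} d L short with Finₚ.any? (λ c → (adj G v c Bool.≟ true) ×-dec ¬? (c ∈? L))
  ... | yes found = found
  ... | no none = ⊥-elim (ℕₚ.<⇒≱ short (subst (_≤ length L) d (unique-⊆-length (unique-neighbours v) inside)))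
    where
    inside : ∀ {w} → w ∈ neighbours G v → w ∈ L
    inside {w} w∈ with w ∈? L
    ... | yes i = i
    ... | no w∉ = ⊥-elim (none (w , ∈-neighbours⁻ w∈ , w∉))

  second-neighbour : ∀ {v a} → degree G v ≡ 3 → Σ (V G) λ b → Adj G v b × b ≢ a
  second-neighbour {a = a} d with another-neighbour d (a ∷ []) (s≤s (s≤s z≤n))
  ... | b , vb , b∉ = b , vb , λ e → b∉ (here e)

  third-neighbour : ∀ {v a b} → degree G v ≡ 3 → Adj G v a → Adj G v b → a ≢ b →
    Σ (V G) λ c → Adj G v c × c ≢ a × c ≢ b × (∀ {w} → Adj G v w → w ≡ a ⊎ w ≡ b ⊎ w ≡ c)
  third-neighbour {v} {a} {b} d va vb a≢b with another-neighbour d (a ∷ b ∷ []) (s≤s (s≤s (s≤s z≤n)))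
  ... | c , vc , c∉ = c , vc , (λ e → c∉ (here e)) , (λ e → c∉ (there (here e))) , cover
    where
    cover : ∀ {w} → Adj G v w → w ≡ a ⊎ w ≡ b ⊎ w ≡ c
    cover {w} vw with w ≟F a | w ≟F b | w ≟F c
    ... | yes p | _ | _ = inj₁ p
    ... | no _ | yes p | _ = inj₂ (inj₁ p)
    ... | no _ | no _ | yes p = inj₂ (inj₂ p)
    ... | no n₁ | no n₂ | no n₃ = ⊥-elim (no-four d
      ((n₁ ∷ n₂ ∷ n₃ ∷ []) ∷ (a≢b ∷ (λ e → c∉ (here (sym e))) ∷ []) ∷ ((λ e → c∉ (there (here (sym e)))) ∷ []) ∷ [] ∷ [])
      (vw ∷ va ∷ vb ∷ vc ∷ []))

one-of⁻ : ∀ {n} {v a b : Fin n} → (v == a) ∨ (v == b) ≡ true → v ≡ a ⊎ v ≡ b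
one-of⁻ {v = v} {a} {b} e with ∨⁻ {v == a} {v == b} e
... | inj₁ x = inj₁ (==⁻ x)
... | inj₂ x = inj₂ (==⁻ x)

one-of⁺ : ∀ {n} (v a b : Fin n) → v ≡ a ⊎ v ≡ b → (v == a) ∨ (v == b) ≡ true
one-of⁺ v a b (inj₁ e) = ∨⁺ {v == a} {v == b} (inj₁ (==⁺ e))
one-of⁺ v a b (inj₂ e) = ∨⁺ {v == a} {v == b} (inj₂ (==⁺ e))

SameEdge-end : {a b c d : A} → SameEdge a b c d → a ≡ c ⊎ a ≡ d
SameEdge-end (inj₁ (e , _)) = inj₁ e
SameEdge-end (inj₂ (e , _)) = inj₂ e

plus-old⁻ : ∀ {G a b c d u v} → Adj (plus G a b c d) (old u) (old v) →
            Adj G u v × ¬ SameEdge u v a b × ¬ SameEdge u v c d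
plus-old⁻ {G} {a} {b} {c} {d} {u} {v} e
  with ∧⁻ {adj G u v} {not (isPair u v a b) ∧ not (isPair u v c d)} e
... | x , yz with ∧⁻ {not (isPair u v a b)} {not (isPair u v c d)} yz
...   | y , z = x , (λ s → true≢false (isPair⁺ s) (not⁻ y)) , (λ s → true≢false (isPair⁺ s) (not⁻ z))

plus-old⁺ : ∀ {G a b c d u v} → Adj G u v → ¬ SameEdge u v a b → ¬ SameEdge u v c d → Adj (plus G a b c d) (old u) (old v)
plus-old⁺ {G} {a} {b} {c} {d} {u} {v} e n n′ = ∧⁺ {adj G u v} e (∧⁺ {not (isPair u v a b)}
  (cong not (≢true⇒false (n ∘ isPair⁻))) (cong not (≢true⇒false (n′ ∘ isPair⁻))))

module _ {G : Graph} (symG : Symmetric G) (irrG : ∀ {u} → ¬ Adj G u u)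
         (a b c d : V G) (ab : Adj G a b) (cd : Adj G c d) (ne : ¬ SameEdge c d a b) where
  private
    G⁺ : Graph
    G⁺ = plus G a b c d

    not-pair : ∀ {u v} → ¬ SameEdge u v a b → isPair u v a b ≡ false
    not-pair n = ≢true⇒false (n ∘ isPair⁻)

  plus-symmetric : Symmetric G⁺
  plus-symmetric {zero}        {suc zero}    e = refl
  plus-symmetric {zero}        {suc (suc v)} e = e
  plus-symmetric {suc zero}    {zero}        e = refl
  plus-symmetric {suc zero}    {suc (suc v)} e = e
  plus-symmetric {suc (suc u)} {zero}        e = e
  plus-symmetric {suc (suc u)} {suc zero}    e = e
  plus-symmetric {suc (suc u)} {suc (suc v)} e with ∧⁻ e
  ... | x , yz with ∧⁻ yz
  ...   | y , z = ∧⁺ (symG x) (∧⁺ (flip-pair y) (flip-pair z))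
    where
    flip-pair : ∀ {p q} → not (isPair u v p q) ≡ true → not (isPair v u p q) ≡ true
    flip-pair {p} {q} n = cong not (≢true⇒false λ t →
      true≢false (isPair⁺ (SameEdge-swap (isPair⁻ {u = v} {u} {p} {q} t))) (not⁻ n))

  plus-irreflexive : ∀ {u} → ¬ Adj G⁺ u u
  plus-irreflexive {zero} ()
  plus-irreflexive {suc zero} ()
  plus-irreflexive {suc (suc u)} e = irrG (proj₁ (∧⁻ e))

  private
    -- Deleting and subdividing only replaces far ends in the neighbour list of an old vertex, so
    -- the old enumeration composed with `swap` is again an enumeration of three neighbours.
    swap : V G → V G → V G⁺
    swap u v = if isPair u v a b then newX else if isPair u v c d then newY else old v

    swap-adj : ∀ {u v} → Adj G u v → Adj G⁺ (old u) (swap u v)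
    swap-adj {u} {v} e with isPair u v a b in p
    ... | true = one-of⁺ u a b (SameEdge-end (isPair⁻ {u = u} {v} {a} {b} p))
    ... | false with isPair u v c d in q
    ...   | true = one-of⁺ u c d (SameEdge-end (isPair⁻ {u = u} {v} {c} {d} q))
    ...   | false rewrite p | q = ∧⁺ e refl

    swap-X : ∀ {u v} → SameEdge u v a b → newX ≡ swap u v
    swap-X s rewrite isPair⁺ s = refl

    first-not-second : ∀ {u v} → SameEdge u v c d → ¬ SameEdge u v a b
    first-not-second (inj₁ (refl , refl)) t = ne t
    first-not-second (inj₂ (refl , refl)) t = ne (SameEdge-swap t)

    swap-Y : ∀ {u v} → SameEdge u v c d → newY ≡ swap u v
    swap-Y {u} {v} s rewrite not-pair {u} {v} (first-not-second s) | isPair⁺ s = refl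

  plus-three : (∀ u → ThreeNeighbours G u) → ∀ u → ThreeNeighbours G⁺ u
  plus-three N zero = record
    { nb = lookup (newY ∷ old a ∷ old b ∷ [])
    ; adjacent = λ where
        zero → refl
        1F → one-of⁺ a a b (inj₁ refl)
        2F → one-of⁺ b a b (inj₂ refl)
    ; all = all′ }
    where
    all′ : ∀ {v} → Adj G⁺ newX v → Σ (Fin 3) λ i → v ≡ lookup (newY ∷ old a ∷ old b ∷ []) i
    all′ {suc zero} _ = zero , refl
    all′ {suc (suc v)} e = [ (λ x → suc zero , cong old x) , (λ x → suc 1F , cong old x) ]′ (one-of⁻ {v = v} {a} {b} e)
  plus-three N 1F = record
    { nb = lookup (newX ∷ old c ∷ old d ∷ [])
    ; adjacent = λ where
        zero → refl
        1F → one-of⁺ c c d (inj₁ refl)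
        2F → one-of⁺ d c d (inj₂ refl)
    ; all = all′ }
    where
    all′ : ∀ {v} → Adj G⁺ newY v → Σ (Fin 3) λ i → v ≡ lookup (newX ∷ old c ∷ old d ∷ []) i
    all′ {zero} _ = zero , refl
    all′ {suc (suc v)} e = [ (λ x → suc zero , cong old x) , (λ x → suc 1F , cong old x) ]′ (one-of⁻ {v = v} {c} {d} e)
  plus-three N (suc (suc u)) = record
    { nb = λ i → swap u (nb i) ; adjacent = λ i → swap-adj (adjacent i) ; all = all′ }
    where
    open ThreeNeighbours (N u)
    via : ∀ {v w} → Adj G u v → w ≡ swap u v → Σ (Fin 3) λ i → w ≡ swap u (nb i)
    via e w≡ with all e
    ... | i , refl = i , w≡
    all′ : ∀ {v} → Adj G⁺ (old u) v → Σ (Fin 3) λ i → v ≡ swap u (nb i)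
    all′ {zero} e with one-of⁻ {v = u} {a} {b} e
    ... | inj₁ refl = via ab (swap-X (inj₁ (refl , refl)))
    ... | inj₂ refl = via (symG ab) (swap-X (inj₂ (refl , refl)))
    all′ {suc zero} e with one-of⁻ {v = u} {c} {d} e
    ... | inj₁ refl = via cd (swap-Y (inj₁ (refl , refl)))
    ... | inj₂ refl = via (symG cd) (swap-Y (inj₂ (refl , refl)))
    all′ {suc (suc v)} e with plus-old⁻ {G} {a} {b} {c} {d} {u} {v} e
    ... | x , y , z = via x old≡
      where
      old≡ : old v ≡ swap u v
      old≡ rewrite ≢true⇒false (y ∘ isPair⁻) | ≢true⇒false (z ∘ isPair⁻) = refl

plus-trivalent : ∀ {G a b c d} → Trivalent G → Adj G a b → Adj G c d → ¬ SameEdge c d a b → Trivalent (plus G a b c d)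
plus-trivalent {a = a} {b} {c} {d} t ab cd ne = record
  { symmetric   = λ {u} {v} → plus-symmetric symmetric irreflexive a b c d ab cd ne {u} {v}
  ; irreflexive = λ {u} → plus-irreflexive symmetric irreflexive a b c d ab cd ne {u}
  ; three       = plus-three symmetric irreflexive a b c d ab cd ne three }
  where open Trivalent t

-- The Petersen graph as a cubic graph

petersen-three : ∀ u → ThreeNeighbours Petersen u
petersen-three u = record { nb = lookup (lookup table u) ; adjacent = adjacent u ; all = λ {v} → all u v }
  where
  table : Vec (Vec (Fin 10) 3) 10
  table = (1F ∷ 4F ∷ 5F ∷ []) ∷ (0F ∷ 2F ∷ 6F ∷ []) ∷ (1F ∷ 3F ∷ 7F ∷ []) ∷ (2F ∷ 4F ∷ 8F ∷ [])
        ∷ (3F ∷ 0F ∷ 9F ∷ []) ∷ (0F ∷ 7F ∷ 8F ∷ []) ∷ (1F ∷ 8F ∷ 9F ∷ []) ∷ (2F ∷ 5F ∷ 9F ∷ [])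
        ∷ (3F ∷ 5F ∷ 6F ∷ []) ∷ (4F ∷ 6F ∷ 7F ∷ []) ∷ []
  adjacent : ∀ u i → petersenAdj u (lookup (lookup table u) i) ≡ true
  adjacent = toWitness {a? = Finₚ.all? λ u → Finₚ.all? λ i → petersenAdj u (lookup (lookup table u) i) Bool.≟ true} tt
  all : ∀ u v → petersenAdj u v ≡ true → Σ (Fin 3) λ i → v ≡ lookup (lookup table u) i
  all = toWitness {a? = Finₚ.all? λ u → Finₚ.all? λ v →
    (petersenAdj u v Bool.≟ true) →-dec Finₚ.any? λ i → v ≟F lookup (lookup table u) i} tt

petersen-symmetric : Symmetric Petersen
petersen-symmetric {u} {v} = toWitness {a? = Finₚ.all? λ u → Finₚ.all? λ v →
  (petersenAdj u v Bool.≟ true) →-dec (petersenAdj v u Bool.≟ true)} tt u v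

petersen-irreflexive : ∀ {u} → ¬ Adj Petersen u u
petersen-irreflexive {u} e = true≢false e (toWitness {a? = Finₚ.all? λ u → petersenAdj u u Bool.≟ false} tt u)

petersen-trivalent : Trivalent Petersen
petersen-trivalent = record
  { symmetric = λ {u} {v} → petersen-symmetric {u} {v} ; irreflexive = λ {u} → petersen-irreflexive {u}
  ; three = petersen-three }

cubic-trivalent : ∀ {G} → IsCubic G → Trivalent G
cubic-trivalent {G} (simple , cubic) = record
  { symmetric = simple⇒symmetric simple ; irreflexive = simple⇒irreflexive simple ; three = λ v → cubic-three {G} (cubic v) }

-- Shapes

-- Vertices 0, 1, 2, 3 are the corners x₁, …, x₄, vertex 4 is the centre, 5 is the common
-- neighbour of x₁, x₄, x₅ and 6 that of x₂, x₃, x₅.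
dominoEdges : List (Fin 7 × Fin 7)
dominoEdges = (0F , 1F) ∷ (2F , 3F) ∷ (0F , 5F) ∷ (3F , 5F) ∷ (4F , 5F)
            ∷ (1F , 6F) ∷ (2F , 6F) ∷ (4F , 6F) ∷ []

-- What is known about the explored part of the host graph: the exits are where the five paths
-- to the rest of G leave it, and the mark is where the next jump starts.
record Shape : Set where
  constructor shape
  field
    order : ℕ
    links : List (Fin order × Fin order)
    exit  : Fin 5 → Fin order
    mark  : Fin order

open Shape public

Linked-by : {n : ℕ} → List (Fin n × Fin n) → Fin n → Fin n → Set
Linked-by es i j = (i , j) ∈ es ⊎ (j , i) ∈ es

shift : {n : ℕ} → List (Fin n × Fin n) → List (Fin (suc n) × Fin (suc n))
shift = map (λ (i , j) → suc i , suc j)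

redirect : {n : ℕ} → Fin 5 → (Fin 5 → Fin n) → Fin 5 → Fin (suc n)
redirect i e j = if j == i then zero else suc (e j)

-- New vertices get number 0 and push the old ones up by one.
attach : (S : Shape) → Fin (order S) → Shape
attach S k = shape (suc (order S)) ((zero , suc k) ∷ shift (links S)) (suc ∘ exit S) (suc (mark S))

extend : Shape → Fin 5 → Shape
extend S i = record (attach S (exit S i)) { exit = redirect i (exit S) }

-- Nothing is placed between the old exit and the landing point, because that stretch of the path
-- may have no interior vertex. The Petersen cases have to work from this shape; `jump` is needed
-- only when a later exit edge starts at such an interior vertex.
join : Shape → Fin 5 → Shape
join S i = shape (suc (order S))
                 ((zero , suc (mark S)) ∷ (zero , suc (exit S i)) ∷ shift (links S))
                 (redirect i (exit S)) zero

-- A path from the mark lands on the i-th exit path; the new mark is a vertex of that path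
-- before the landing point.
jump : Shape → Fin 5 → Shape
jump S i = record (join (extend S i) i) { mark = suc zero }

-- single m is the domino with its m-th edge subdivided by the mark; double m arises from it by a
-- jump to the path leaving the centre.
data Form : Set where
  single : Fin 8 → Form
  double : Fin 2 → Form

subdivided : Fin 8 → Shape
subdivided m = shape 8 ((suc (proj₁ e) , zero) ∷ (zero , suc (proj₂ e)) ∷ shift (removeAt dominoEdges m))
                     (λ j → suc (Fin.inject≤ j (s≤s (s≤s (s≤s (s≤s (s≤s z≤n))))))) zero
  where e = List.lookup dominoEdges m

-- Edges 0 and 1 of `dominoEdges` are `x₁x₂` and `x₃x₄`, the two edges far from the centre; from the
-- other six a jump to the path at the centre is absorbed by another single form. In `double m`,
-- vertex 0 is the landing point y and the fifth exit, 1 is the mark between the centre and y, 2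
-- subdivides the edge, and the domino starts at 3.
⟦_⟧ : Form → Shape
⟦ single m ⟧ = subdivided m
⟦ double m ⟧ = jump (subdivided (Fin.inject≤ m (s≤s (s≤s z≤n)))) 4F

-- The two linkages of a crossed domino, with the exits attached to P (vertex 0) or Q (vertex 1).
data Crossing : Set where
  centre-in-Q centre-in-P : Crossing

side : Crossing → Fin 5 → Bool
side _ zero                                = true
side _ 1F                                  = false
side _ 2F                                  = true
side _ 3F                                  = false
side centre-in-Q (suc (suc (suc (suc _)))) = false
side centre-in-P (suc (suc (suc (suc _)))) = true

hub-of : {n : ℕ} → Bool → Fin (suc (suc n))
hub-of true  = zero
hub-of false = suc zero

-- The quotient of H that remains when a shape replaces the domino and the rest of G is contracted
-- to the edge between vertices 0 and 1.
closed : Crossing → (S : Shape) → List (Fin (2 + order S) × Fin (2 + order S))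
closed κ S = (zero , suc zero) ∷ map (λ j → hub-of (side κ j) , suc (suc (exit S j))) (allFin 5)
           ++ shift (shift (links S))

-- A decidable form of contraction. Fibres of diameter at most two suffice for every map of the
-- table, so no search for longer paths is needed; target edges must be covered, and further source
-- edges are simply dropped.
record Coarsens {n n′ : ℕ} (es : List (Fin n × Fin n)) (es′ : List (Fin n′ × Fin n′)) (f : Fin n → Fin n′) : Set where
  constructor coarse
  field
    fibres : ∀ i j → f i ≡ f j →
             i ≡ j ⊎ Linked-by es i j ⊎ Σ (Fin n) λ l → f i ≡ f l × Linked-by es i l × Linked-by es l j
    covers : All (λ (a , b) → Any (λ (i , j) → (f i ≡ a × f j ≡ b) ⊎ (f i ≡ b × f j ≡ a)) es) es′

linked-by? : {n : ℕ} (es : List (Fin n × Fin n)) → ∀ i j → Dec (Linked-by es i j)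
linked-by? es i j = ((i , j) ∈ₑ? es) ⊎-dec ((j , i) ∈ₑ? es)
  where open DecMembership (Productₚ.≡-dec _≟F_ _≟F_) renaming (_∈?_ to _∈ₑ?_)

coarsens? : {n n′ : ℕ} (es : List (Fin n × Fin n)) (es′ : List (Fin n′ × Fin n′)) (f : Fin n → Fin n′) →
            Dec (Coarsens es es′ f)
coarsens? es es′ f = map′ (λ (p , q) → coarse p q) (λ (coarse p q) → p , q)
  ((Finₚ.all? λ i → Finₚ.all? λ j → (f i ≟F f j) →-dec ((i ≟F j) ⊎-dec (linked-by? es i j ⊎-dec
     Finₚ.any? λ l → (f i ≟F f l) ×-dec (linked-by? es i l ×-dec linked-by? es l j))))
   ×-dec All.all? (λ (a , b) → Any.any? (λ (i , j) →
     ((f i ≟F a) ×-dec (f j ≟F b)) ⊎-dec ((f i ≟F b) ×-dec (f j ≟F a))) es) es′)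

petersenList : List (Fin 10 × Fin 10)
petersenList = map (λ (i , j) → i mod 10 , j mod 10) petersenEdges

data Outcome (S : Shape) (i : Fin 5) : Set where
  advances  : (φ : Form) (f : Fin (2 + order S) → Fin (order ⟦ φ ⟧)) → Coarsens (links (jump S i)) (links ⟦ φ ⟧) f →
              (∀ j → f (exit (jump S i) j) ≡ exit ⟦ φ ⟧ j) → f (mark (jump S i)) ≡ mark ⟦ φ ⟧ → Outcome S i
  petersen! : (κ : Crossing) (f : Fin (3 + order S) → Fin 10) → Coarsens (closed κ (join S i)) petersenList f →
              Outcome S i

private
  entries : ∀ {k n} .{{_ : NonZero n}} → Vec ℕ k → Fin k → Fin n
  entries {n = n} v i = lookup v i mod n

  advance : ∀ {S i} (φ : Form) (f : Fin (2 + order S) → Fin (order ⟦ φ ⟧)) →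
            {_ : True (coarsens? (links (jump S i)) (links ⟦ φ ⟧) f)}
            {_ : True (Finₚ.all? λ j → f (exit (jump S i) j) ≟F exit ⟦ φ ⟧ j)}
            {_ : True (f (mark (jump S i)) ≟F mark ⟦ φ ⟧)} → Outcome S i
  advance φ f {c} {e} {m} = advances φ f (toWitness c) (toWitness e) (toWitness m)

  pet : ∀ {S i} (κ : Crossing) (f : Fin (3 + order S) → Fin 10) →
        {_ : True (coarsens? (closed κ (join S i)) petersenList f)} → Outcome S i
  pet κ f {c} = petersen! κ f (toWitness c)

-- The case analysis of the theorem: a jump to an exit path can either be absorbed into the shape or,
-- after contracting one of the two linkages, yields the Petersen graph.  Found by computer search.
outcome : ∀ φ i → Outcome ⟦ φ ⟧ i
-- In an `advance` from a single form the entries are the images of the landing point, the new mark,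
-- the old mark and the seven domino vertices; in the target, 0 is the mark and the domino starts at
-- 1. Here the old `x₁` joins the new mark, while landing point and old mark together become the new
-- `x₁`.
outcome (single zero) zero = advance (single 2F) (entries (1 ∷ 0 ∷ 1 ∷ 0 ∷ 2 ∷ 3 ∷ 4 ∷ 5 ∷ 6 ∷ 7 ∷ []))
outcome (single zero) 1F = advance (single 5F) (entries (2 ∷ 0 ∷ 1 ∷ 1 ∷ 0 ∷ 3 ∷ 4 ∷ 5 ∷ 6 ∷ 7 ∷ []))
-- In a `pet` entry the two sides P and Q come first, followed by landing point, mark and domino.
-- With the centre, P has degree four: here its edge to `x₁` is dropped, and `x₁` is merged with its
-- neighbour 5.
outcome (single zero) 2F = pet centre-in-P (entries (0 ∷ 4 ∷ 5 ∷ 8 ∷ 6 ∷ 3 ∷ 7 ∷ 9 ∷ 1 ∷ 6 ∷ 2 ∷ []))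
outcome (single zero) 3F = pet centre-in-Q (entries (0 ∷ 1 ∷ 6 ∷ 9 ∷ 4 ∷ 9 ∷ 5 ∷ 8 ∷ 2 ∷ 3 ∷ 7 ∷ []))
outcome (single zero) 4F = advance (double 0F) (entries (0 ∷ 1 ∷ 2 ∷ 3 ∷ 4 ∷ 5 ∷ 6 ∷ 7 ∷ 8 ∷ 9 ∷ []))
outcome (single 1F) zero = pet centre-in-P (entries (0 ∷ 4 ∷ 5 ∷ 8 ∷ 7 ∷ 9 ∷ 8 ∷ 3 ∷ 1 ∷ 2 ∷ 6 ∷ []))
outcome (single 1F) 1F = pet centre-in-Q (entries (0 ∷ 1 ∷ 6 ∷ 8 ∷ 4 ∷ 9 ∷ 5 ∷ 3 ∷ 2 ∷ 3 ∷ 7 ∷ []))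
outcome (single 1F) 2F = advance (single 6F) (entries (3 ∷ 0 ∷ 3 ∷ 1 ∷ 2 ∷ 0 ∷ 4 ∷ 5 ∷ 6 ∷ 7 ∷ []))
outcome (single 1F) 3F = advance (single 3F) (entries (4 ∷ 0 ∷ 3 ∷ 1 ∷ 2 ∷ 3 ∷ 0 ∷ 5 ∷ 6 ∷ 7 ∷ []))
outcome (single 1F) 4F = advance (double 1F) (entries (0 ∷ 1 ∷ 2 ∷ 3 ∷ 4 ∷ 5 ∷ 6 ∷ 7 ∷ 8 ∷ 9 ∷ []))
outcome (single 2F) zero = advance (single 0F) (entries (1 ∷ 0 ∷ 1 ∷ 0 ∷ 2 ∷ 3 ∷ 4 ∷ 5 ∷ 6 ∷ 7 ∷ []))
outcome (single 2F) 1F = advance (single 5F) (entries (2 ∷ 0 ∷ 1 ∷ 1 ∷ 0 ∷ 3 ∷ 4 ∷ 5 ∷ 6 ∷ 7 ∷ []))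
outcome (single 2F) 2F = pet centre-in-P (entries (0 ∷ 4 ∷ 5 ∷ 7 ∷ 9 ∷ 9 ∷ 8 ∷ 3 ∷ 1 ∷ 2 ∷ 6 ∷ []))
outcome (single 2F) 3F = advance (single 1F) (entries (4 ∷ 0 ∷ 6 ∷ 1 ∷ 2 ∷ 3 ∷ 0 ∷ 5 ∷ 5 ∷ 7 ∷ []))
outcome (single 2F) 4F = advance (single 7F) (entries (5 ∷ 0 ∷ 6 ∷ 1 ∷ 2 ∷ 3 ∷ 4 ∷ 0 ∷ 4 ∷ 7 ∷ []))
outcome (single 3F) zero = advance (single 0F) (entries (1 ∷ 0 ∷ 6 ∷ 0 ∷ 2 ∷ 3 ∷ 4 ∷ 5 ∷ 5 ∷ 7 ∷ []))
outcome (single 3F) 1F = pet centre-in-Q (entries (0 ∷ 1 ∷ 6 ∷ 8 ∷ 4 ∷ 9 ∷ 5 ∷ 5 ∷ 2 ∷ 3 ∷ 7 ∷ []))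
outcome (single 3F) 2F = advance (single 6F) (entries (3 ∷ 0 ∷ 4 ∷ 1 ∷ 2 ∷ 0 ∷ 4 ∷ 5 ∷ 6 ∷ 7 ∷ []))
outcome (single 3F) 3F = advance (single 1F) (entries (4 ∷ 0 ∷ 4 ∷ 1 ∷ 2 ∷ 3 ∷ 0 ∷ 5 ∷ 6 ∷ 7 ∷ []))
outcome (single 3F) 4F = advance (single 7F) (entries (5 ∷ 0 ∷ 6 ∷ 1 ∷ 2 ∷ 3 ∷ 4 ∷ 0 ∷ 1 ∷ 7 ∷ []))
outcome (single 4F) zero = advance (single 0F) (entries (1 ∷ 0 ∷ 6 ∷ 0 ∷ 2 ∷ 3 ∷ 4 ∷ 5 ∷ 4 ∷ 7 ∷ []))
outcome (single 4F) 1F = pet centre-in-P (entries (0 ∷ 4 ∷ 9 ∷ 6 ∷ 5 ∷ 7 ∷ 3 ∷ 3 ∷ 1 ∷ 8 ∷ 2 ∷ []))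
outcome (single 4F) 2F = pet centre-in-Q (entries (0 ∷ 1 ∷ 4 ∷ 3 ∷ 5 ∷ 5 ∷ 9 ∷ 6 ∷ 2 ∷ 8 ∷ 7 ∷ []))
outcome (single 4F) 3F = advance (single 1F) (entries (4 ∷ 0 ∷ 6 ∷ 1 ∷ 2 ∷ 3 ∷ 0 ∷ 5 ∷ 1 ∷ 7 ∷ []))
outcome (single 4F) 4F = advance (single 7F) (entries (5 ∷ 0 ∷ 5 ∷ 1 ∷ 2 ∷ 3 ∷ 4 ∷ 0 ∷ 6 ∷ 7 ∷ []))
outcome (single 5F) zero = advance (single 2F) (entries (1 ∷ 0 ∷ 2 ∷ 0 ∷ 2 ∷ 3 ∷ 4 ∷ 5 ∷ 6 ∷ 7 ∷ []))
outcome (single 5F) 1F = advance (single 0F) (entries (2 ∷ 0 ∷ 2 ∷ 1 ∷ 0 ∷ 3 ∷ 4 ∷ 5 ∷ 6 ∷ 7 ∷ []))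
outcome (single 5F) 2F = advance (single 1F) (entries (3 ∷ 0 ∷ 7 ∷ 1 ∷ 2 ∷ 0 ∷ 4 ∷ 5 ∷ 6 ∷ 5 ∷ []))
outcome (single 5F) 3F = pet centre-in-Q (entries (0 ∷ 1 ∷ 6 ∷ 9 ∷ 4 ∷ 4 ∷ 5 ∷ 8 ∷ 2 ∷ 3 ∷ 7 ∷ []))
outcome (single 5F) 4F = advance (single 4F) (entries (5 ∷ 0 ∷ 7 ∷ 1 ∷ 2 ∷ 3 ∷ 4 ∷ 0 ∷ 6 ∷ 3 ∷ []))
outcome (single 6F) zero = pet centre-in-P (entries (0 ∷ 4 ∷ 5 ∷ 8 ∷ 7 ∷ 9 ∷ 3 ∷ 3 ∷ 1 ∷ 2 ∷ 6 ∷ []))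
outcome (single 6F) 1F = advance (single 0F) (entries (2 ∷ 0 ∷ 7 ∷ 1 ∷ 0 ∷ 3 ∷ 4 ∷ 5 ∷ 6 ∷ 5 ∷ []))
outcome (single 6F) 2F = advance (single 1F) (entries (3 ∷ 0 ∷ 3 ∷ 1 ∷ 2 ∷ 0 ∷ 4 ∷ 5 ∷ 6 ∷ 7 ∷ []))
outcome (single 6F) 3F = advance (single 3F) (entries (4 ∷ 0 ∷ 3 ∷ 1 ∷ 2 ∷ 3 ∷ 0 ∷ 5 ∷ 6 ∷ 7 ∷ []))
outcome (single 6F) 4F = advance (single 4F) (entries (5 ∷ 0 ∷ 7 ∷ 1 ∷ 2 ∷ 3 ∷ 4 ∷ 0 ∷ 6 ∷ 2 ∷ []))
outcome (single 7F) zero = pet centre-in-Q (entries (0 ∷ 1 ∷ 4 ∷ 3 ∷ 9 ∷ 6 ∷ 5 ∷ 5 ∷ 2 ∷ 7 ∷ 8 ∷ []))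
outcome (single 7F) 1F = advance (single 0F) (entries (2 ∷ 0 ∷ 7 ∷ 1 ∷ 0 ∷ 3 ∷ 4 ∷ 5 ∷ 6 ∷ 3 ∷ []))
outcome (single 7F) 2F = advance (single 1F) (entries (3 ∷ 0 ∷ 7 ∷ 1 ∷ 2 ∷ 0 ∷ 4 ∷ 5 ∷ 6 ∷ 2 ∷ []))
outcome (single 7F) 3F = pet centre-in-P (entries (0 ∷ 4 ∷ 3 ∷ 2 ∷ 6 ∷ 9 ∷ 5 ∷ 8 ∷ 1 ∷ 6 ∷ 7 ∷ []))
outcome (single 7F) 4F = advance (single 4F) (entries (5 ∷ 0 ∷ 5 ∷ 1 ∷ 2 ∷ 3 ∷ 4 ∷ 0 ∷ 6 ∷ 7 ∷ []))
outcome (double zero) zero = pet centre-in-Q (entries (0 ∷ 1 ∷ 4 ∷ 6 ∷ 9 ∷ 8 ∷ 3 ∷ 8 ∷ 0 ∷ 1 ∷ 7 ∷ 2 ∷ 5 ∷ []))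
outcome (double zero) 1F = pet centre-in-P (entries (0 ∷ 1 ∷ 2 ∷ 4 ∷ 3 ∷ 9 ∷ 9 ∷ 7 ∷ 0 ∷ 1 ∷ 8 ∷ 6 ∷ 5 ∷ []))
outcome (double zero) 2F = pet centre-in-Q (entries (0 ∷ 2 ∷ 0 ∷ 3 ∷ 4 ∷ 8 ∷ 5 ∷ 8 ∷ 1 ∷ 2 ∷ 9 ∷ 7 ∷ 6 ∷ []))
outcome (double zero) 3F = pet centre-in-P (entries (0 ∷ 3 ∷ 3 ∷ 1 ∷ 2 ∷ 6 ∷ 6 ∷ 8 ∷ 0 ∷ 4 ∷ 7 ∷ 9 ∷ 5 ∷ []))
-- The second jump returns to the single form. The centre takes over the old mark and the new
-- landing point; the subdividing vertex, y and the part of the path after y become the mark on the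
-- same edge.
outcome (double zero) 4F = advance (single 0F) (entries (5 ∷ 0 ∷ 0 ∷ 5 ∷ 0 ∷ 1 ∷ 2 ∷ 3 ∷ 4 ∷ 5 ∷ 6 ∷ 7 ∷ []))
outcome (double 1F) zero = pet centre-in-Q (entries (0 ∷ 7 ∷ 1 ∷ 7 ∷ 2 ∷ 0 ∷ 6 ∷ 9 ∷ 0 ∷ 5 ∷ 3 ∷ 8 ∷ 4 ∷ []))
outcome (double 1F) 1F = pet centre-in-P (entries (0 ∷ 2 ∷ 3 ∷ 0 ∷ 4 ∷ 2 ∷ 5 ∷ 8 ∷ 1 ∷ 2 ∷ 9 ∷ 7 ∷ 6 ∷ []))
outcome (double 1F) 2F = pet centre-in-Q (entries (0 ∷ 2 ∷ 0 ∷ 2 ∷ 1 ∷ 4 ∷ 5 ∷ 7 ∷ 4 ∷ 3 ∷ 6 ∷ 8 ∷ 9 ∷ []))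
outcome (double 1F) 3F = pet centre-in-P (entries (0 ∷ 2 ∷ 2 ∷ 0 ∷ 1 ∷ 4 ∷ 5 ∷ 7 ∷ 4 ∷ 3 ∷ 6 ∷ 8 ∷ 9 ∷ []))
outcome (double 1F) 4F = advance (single 1F) (entries (5 ∷ 0 ∷ 0 ∷ 5 ∷ 0 ∷ 1 ∷ 2 ∷ 3 ∷ 4 ∷ 5 ∷ 6 ∷ 7 ∷ []))

-- Cuts and forced circuits

length-filterᵇ-map : (f : A → B) (p : B → Bool) (xs : List A) →
                     length (filterᵇ p (map f xs)) ≡ length (filterᵇ (p ∘ f) xs)
length-filterᵇ-map f p [] = refl
length-filterᵇ-map f p (x ∷ xs) with p (f x)
... | true  = cong suc (length-filterᵇ-map f p xs)
... | false = length-filterᵇ-map f p xs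

filterᵇ-++ : (p : A → Bool) (xs ys : List A) → filterᵇ p (xs ++ ys) ≡ filterᵇ p xs ++ filterᵇ p ys
filterᵇ-++ p = filter-++ (T? ∘ p)

-- Turns the double sum of `cutSize` into the length of one list of pairs without repetitions, so
-- that cuts can be bounded by inclusion of lists.
length-filterᵇ-× : (p : A → B → Bool) (xs : List A) (ys : List B) →
  length (filterᵇ (λ (x , y) → p x y) (cartesianProduct xs ys)) ≡ sum (map (λ x → length (filterᵇ (p x) ys)) xs)
length-filterᵇ-× p []       ys = refl
length-filterᵇ-× p (x ∷ xs) ys = begin
  length (filterᵇ p′ (map (x ,_) ys ++ cartesianProduct xs ys))
    ≡⟨ cong length (filterᵇ-++ p′ (map (x ,_) ys) _) ⟩
  length (filterᵇ p′ (map (x ,_) ys) ++ filterᵇ p′ (cartesianProduct xs ys))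
    ≡⟨ length-++ (filterᵇ p′ (map (x ,_) ys)) ⟩
  length (filterᵇ p′ (map (x ,_) ys)) + length (filterᵇ p′ (cartesianProduct xs ys))
    ≡⟨ cong₂ _+_ (length-filterᵇ-map (x ,_) p′ ys) (length-filterᵇ-× p xs ys) ⟩
  length (filterᵇ (p x) ys) + sum (map (λ x → length (filterᵇ (p x) ys)) xs) ∎
  where
  open ≡-Reasoning
  p′ = λ (x , y) → p x y

module _ (G : Graph) (X : V G → Bool) where
  private
    crosses : V G → V G → Bool
    crosses u v = X u ∧ not (X v) ∧ adj G u v

    cut : List (V G × V G)
    cut = filterᵇ (λ (u , v) → crosses u v) (cartesianProduct (allFin _) (allFin _))

    cut-length : length cut ≡ cutSize G X
    cut-length = length-filterᵇ-× crosses (allFin _) (allFin _)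

    unique-cut : Unique cut
    unique-cut = unique-filterᵇ _ (Uniqueₚ.cartesianProduct⁺ (Uniqueₚ.allFin⁺ _) (Uniqueₚ.allFin⁺ _))

    ∈-cut⁻ : ∀ {u v} → (u , v) ∈ cut → X u ≡ true × X v ≡ false × Adj G u v
    ∈-cut⁻ {u} {v} e with ∧⁻ {X u} (proj₂ (∈-filterᵇ⁻ {p = λ (u , v) → crosses u v} {xs = cartesianProduct (allFin _) (allFin _)} e))
    ... | p , q with ∧⁻ {not (X v)} q
    ...   | r , s = p , not⁻ r , s

    ∈-cut⁺ : ∀ {u v} → X u ≡ true → X v ≡ false → Adj G u v → (u , v) ∈ cut
    ∈-cut⁺ {u} {v} p q a = ∈-filterᵇ⁺ {p = λ (u , v) → crosses u v}
      (∈-cartesianProduct⁺ (∈-allFin u) (∈-allFin v)) (∧⁺ p (∧⁺ (cong not q) a))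

  cut≤ : (L : List (V G × V G)) → (∀ {u v} → X u ≡ true → X v ≡ false → Adj G u v → (u , v) ∈ L) →
         cutSize G X ≤ length L
  cut≤ L sub = subst (_≤ length L) cut-length (unique-⊆-length unique-cut λ {(u , v)} e →
    let p , q , a = ∈-cut⁻ e in sub p q a)

  cut≥ : (L : List (V G × V G)) → Unique L →
         (∀ {u v} → (u , v) ∈ L → X u ≡ true × X v ≡ false × Adj G u v) → length L ≤ cutSize G X
  cut≥ L uq sub = subst (length L ≤_) cut-length (unique-⊆-length uq λ {(u , v)} e →
    let p , q , a = sub e in ∈-cut⁺ p q a)

linked-prefix : {R : A → A → Set} (X : List A) {c : A} {Z : List A} → Linked R (X ++ c ∷ Z) → Linked R (X ++ c ∷ [])
linked-prefix []          _       = [-]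
linked-prefix (x ∷ [])    (r ∷ _) = r ∷ [-]
linked-prefix (x ∷ y ∷ X) (r ∷ l) = r ∷ linked-prefix (y ∷ X) l

-- A walk that never turns back must run into itself, and then closes a circuit.
module _ {G : Graph} (irrG : ∀ {u} → ¬ Adj G u u) (symG : Symmetric G) (S : V G → Bool) (v₀ : V G)
         (next : ∀ u v → Adj G u v → S u ≡ true → S v ≡ true → v ≢ v₀ →
                 Σ (V G) λ w → Adj G v w × w ≢ u × S w ≡ true) where

  private
    -- The list is the walk read backwards. Since `v₀` lies in its tail and nothing repeats, the
    -- current vertex differs from `v₀` and `next` applies. Fuel can run out only when the list is
    -- longer than the number of vertices.
    run : (fuel : ℕ) (v u : V G) (L : List (V G)) → size G < fuel + length (v ∷ u ∷ L) →
          Unique (v ∷ u ∷ L) → Linked (Adj G) (v ∷ u ∷ L) → All (λ w → S w ≡ true) (v ∷ u ∷ L) →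
          v₀ ∈ u ∷ L → ContainsCircuit G S
    run zero v u L big uq _ _ _ = ⊥-elim (ℕₚ.<⇒≱ big (subst (length (v ∷ u ∷ L) ≤_) (length-tabulate id)
      (unique-⊆-length uq λ {w} _ → ∈-allFin w)))
    run (suc fuel) v u L big uq@(v∉ ∷ _) ln@(vu ∷ _) al@(sv ∷ su ∷ _) v₀∈
      with next u v (symG vu) su sv (λ e → All.lookup v∉ v₀∈ e)
    ... | w , vw , w≢u , sw with w ∈? (v ∷ u ∷ L)
    ...   | no w∉ = run fuel w v (u ∷ L) (subst (size G <_) (sym (ℕₚ.+-suc fuel _)) big)
                      (All.tabulate (λ i e → w∉ (subst (_∈ v ∷ u ∷ L) (sym e) i)) ∷ uq) (symG vw ∷ ln) (sw ∷ al) (there v₀∈)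
    ...   | yes (here refl) = ⊥-elim (irrG vw)
    ...   | yes (there (here refl)) = ⊥-elim (w≢u refl)
    ...   | yes (there (there w∈)) with ∈-∃++ w∈
    ...     | X , Z , refl = w ∷ v ∷ u ∷ X , (s≤s (s≤s z≤n) , uq′ , symG vw ∷ linked-prefix (v ∷ u ∷ X) ln)
                           , sw ∷ Allₚ.++⁻ˡ (v ∷ u ∷ X) al
      where
      uq′ : Unique (w ∷ v ∷ u ∷ X)
      uq′ with unique-++⁻ (v ∷ u ∷ X) uq
      ... | uX , _ , dis = All.tabulate (λ i e → dis i (here (sym e))) ∷ uX

  forced-circuit : ∀ {v₁} → Adj G v₀ v₁ → S v₀ ≡ true → S v₁ ≡ true → ContainsCircuit G S
  forced-circuit {v₁} a s₀ s₁ = run (size G) v₁ v₀ [] (ℕₚ.m<m+n (size G) (s≤s z≤n))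
    (((λ { refl → irrG a }) ∷ []) ∷ [] ∷ []) (symG a ∷ [-]) (s₁ ∷ s₀ ∷ []) (here refl)

-- Dominoes in cyclically five-connected graphs

corner : Fin 5 → Fin 7
corner j = Fin.inject≤ j (s≤s (s≤s (s≤s (s≤s (s≤s z≤n)))))

corner-injective : ∀ i j → corner i ≡ corner j → i ≡ j
corner-injective = toWitness {a? = Finₚ.all? λ i → Finₚ.all? λ j → (corner i ≟F corner j) →-dec (i ≟F j)} tt

_~_ : Fin 7 → Fin 7 → Set
_~_ = Linked-by dominoEdges

_~?_ : ∀ i j → Dec (i ~ j)
_~?_ = linked-by? dominoEdges

abstract
  -- The domino has diameter three, so a further edge between two of its vertices would close a
  -- circuit of length three or four. The inequalities in the last case make the four vertices of
  -- that circuit distinct.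
  near : ∀ i j → i ≡ j ⊎ i ~ j ⊎ (Σ (Fin 7) λ l → i ~ l × l ~ j) ⊎
         (Σ (Fin 7) λ l → i ~ l × Σ (Fin 7) λ m → l ~ m × m ~ j × l ≢ j × i ≢ m)
  near = toWitness {a? = Finₚ.all? λ i → Finₚ.all? λ j → (i ≟F j) ⊎-dec ((i ~? j) ⊎-dec
    ((Finₚ.any? λ l → (i ~? l) ×-dec (l ~? j)) ⊎-dec
     (Finₚ.any? λ l → (i ~? l) ×-dec Finₚ.any? λ m → (l ~? m) ×-dec ((m ~? j) ×-dec (¬? (l ≟F j) ×-dec ¬? (i ≟F m))))))} tt

  two : ∀ j → Σ (Fin 7) λ k → Σ (Fin 7) λ l → corner j ~ k × corner j ~ l × k ≢ l ×
        (∀ m → corner j ~ m → m ≡ k ⊎ m ≡ l)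
  two = toWitness {a? = Finₚ.all? λ j → Finₚ.any? λ k → Finₚ.any? λ l → (corner j ~? k) ×-dec ((corner j ~? l) ×-dec
    (¬? (k ≟F l) ×-dec Finₚ.all? λ m → (corner j ~? m) →-dec ((m ≟F k) ⊎-dec (m ≟F l))))} tt

  saturated : ∀ i → (Σ (Fin 5) λ j → i ≡ corner j) ⊎
    (Σ (Fin 7) λ k → Σ (Fin 7) λ l → Σ (Fin 7) λ m → i ~ k × i ~ l × i ~ m × k ≢ l × k ≢ m × l ≢ m)
  saturated = toWitness {a? = Finₚ.all? λ i → (Finₚ.any? λ j → i ≟F corner j) ⊎-dec
    (Finₚ.any? λ k → Finₚ.any? λ l → Finₚ.any? λ m → (i ~? k) ×-dec ((i ~? l) ×-dec ((i ~? m) ×-dec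
      (¬? (k ≟F l) ×-dec (¬? (k ≟F m) ×-dec ¬? (l ≟F m))))))} tt

  -- Each corner is at distance two from the centre, so a corner whose outer neighbour is also `z₅`
  -- would give a circuit of length four.
  through-hub : ∀ j → j ≡ 4F ⊎ Σ (Fin 7) λ l → 4F ~ l × l ~ corner j × l ≢ 4F
  through-hub = toWitness {a? = Finₚ.all? λ j → (j ≟F 4F) ⊎-dec
    Finₚ.any? λ l → (4F ~? l) ×-dec ((l ~? corner j) ×-dec ¬? (l ≟F 4F))} tt

data Bridge : Bool → Bool → Set where
  bridge : Bridge true false

-- For each crossing, halves contracts the graph outside the domino to two adjacent vertices.
record Frame (G : Graph) : Set where
  field
    d      : Fin 7 → V G
    d-inj  : ∀ {i j} → d i ≡ d j → i ≡ j
    d-adj  : ∀ {i j} → (i , j) ∈ dominoEdges → Adj G (d i) (d j)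
    d-only : ∀ {i j} → Adj G (d i) (d j) → Linked-by dominoEdges i j
    z      : Fin 5 → V G
    z-adj  : ∀ j → Adj G (d (corner j)) (z j)
    z-out  : ∀ j i → z j ≢ d i
    z-only : ∀ {i v} → Adj G (d i) v → (∀ k → v ≢ d k) → Σ (Fin 5) λ j → i ≡ corner j × v ≡ z j
    z₅-own : ∀ j → z j ≡ z 4F → j ≡ 4F
    halves : Crossing → Model G Bridge
    half-z : ∀ κ j → Model.lab (halves κ) (z j) ≡ just (side κ j)
    half-d : ∀ κ i → Model.lab (halves κ) (d i) ≡ nothing

module DominoFacts (G : Graph) (simple : IsSimple G) (cubic : ∀ v → degree G v ≡ 3) (cyc : CyclicallyConnected 5 G)
               (d : Fin 7 → V G) (d-inj : ∀ {i j} → d i ≡ d j → i ≡ j)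
               (d-adj : ∀ {i j} → (i , j) ∈ dominoEdges → Adj G (d i) (d j)) where

  symG : Symmetric G
  symG = simple⇒symmetric simple

  irrG : ∀ {u} → ¬ Adj G u u
  irrG = simple⇒irreflexive simple

  d-adj′ : ∀ {i j} → Linked-by dominoEdges i j → Adj G (d i) (d j)
  d-adj′ (inj₁ e) = d-adj e
  d-adj′ (inj₂ e) = symG (d-adj e)

  private
    apart : ∀ {i j} → i ~ j → d i ≢ d j
    apart l e = irrG (subst (Adj G _) (sym e) (d-adj′ l))

  d-only : ∀ {i j} → Adj G (d i) (d j) → i ~ j
  d-only {i} {j} a with near i j
  ... | inj₁ refl = ⊥-elim (irrG a)
  ... | inj₂ (inj₁ l) = l
  ... | inj₂ (inj₂ (inj₁ (l , p , q))) = ⊥-elim (ℕₚ.<⇒≱ (s≤s (s≤s (s≤s (s≤s z≤n))))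
    (proj₁ cyc (d i ∷ d l ∷ d j ∷ []) (s≤s (s≤s z≤n)
      , ((apart p ∷ (λ e → irrG (subst (Adj G _) (sym e) a)) ∷ []) ∷ (apart q ∷ []) ∷ [] ∷ [])
      , (d-adj′ p ∷ d-adj′ q ∷ symG a ∷ [-]))))
  ... | inj₂ (inj₂ (inj₂ (l , p , m , q , r , l≢j , i≢m))) = ⊥-elim (ℕₚ.<⇒≱ (s≤s (s≤s (s≤s (s≤s (s≤s z≤n)))))
    (proj₁ cyc (d i ∷ d l ∷ d m ∷ d j ∷ []) (s≤s (s≤s z≤n)
      , ((apart p ∷ (i≢m ∘ d-inj) ∷ (λ e → irrG (subst (Adj G _) (sym e) a)) ∷ []) ∷ (apart q ∷ (l≢j ∘ d-inj) ∷ [])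
         ∷ (apart r ∷ []) ∷ [] ∷ [])
      , (d-adj′ p ∷ d-adj′ q ∷ d-adj′ r ∷ symG a ∷ [-]))))

  Inside : V G → Set
  Inside v = Σ (Fin 7) λ i → v ≡ d i

  inside? : ∀ v → Dec (Inside v)
  inside? v = Finₚ.any? λ i → v ≟F d i

  private
    outer : ∀ j → Σ (V G) λ c → Adj G (d (corner j)) c × ¬ Inside c ×
            (∀ {w} → Adj G (d (corner j)) w → ¬ Inside w → w ≡ c)
    outer j with two j
    ... | k , l , p , q , k≢l , only
      with third-neighbour {G} (cubic (d (corner j))) (d-adj′ p) (d-adj′ q) (k≢l ∘ d-inj)
    ... | c , a , c≢k , c≢l , cover = c , a , out , uniq
      where
      out : ¬ Inside c
      out (m , refl) with only m (d-only a)
      ... | inj₁ refl = c≢k refl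
      ... | inj₂ refl = c≢l refl
      uniq : ∀ {w} → Adj G (d (corner j)) w → ¬ Inside w → w ≡ c
      uniq b out′ with cover b
      ... | inj₁ e = ⊥-elim (out′ (k , e))
      ... | inj₂ (inj₁ e) = ⊥-elim (out′ (l , e))
      ... | inj₂ (inj₂ e) = e

  z : Fin 5 → V G
  z j = proj₁ (outer j)

  z-adj : ∀ j → Adj G (d (corner j)) (z j)
  z-adj j = proj₁ (proj₂ (outer j))

  z-outside : ∀ j → ¬ Inside (z j)
  z-outside j = proj₁ (proj₂ (proj₂ (outer j)))

  z-unique : ∀ j {w} → Adj G (d (corner j)) w → ¬ Inside w → w ≡ z j
  z-unique j = proj₂ (proj₂ (proj₂ (outer j)))

  z-only : ∀ {i v} → Adj G (d i) v → ¬ Inside v → Σ (Fin 5) λ j → i ≡ corner j × v ≡ z j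
  z-only {i} {v} a out with saturated i
  ... | inj₁ (j , refl) = j , refl , z-unique j a out
  ... | inj₂ (k , l , m , p , q , r , k≢l , k≢m , l≢m) = ⊥-elim (no-four {G} (cubic (d i))
      (((k≢l ∘ d-inj) ∷ (k≢m ∘ d-inj) ∷ (λ e → out (k , sym e)) ∷ [])
       ∷ ((l≢m ∘ d-inj) ∷ (λ e → out (l , sym e)) ∷ []) ∷ ((λ e → out (m , sym e)) ∷ []) ∷ [] ∷ [])
      (d-adj′ p ∷ d-adj′ q ∷ d-adj′ r ∷ a ∷ []))

  z₅-own : ∀ j → z j ≡ z 4F → j ≡ 4F
  z₅-own j e with through-hub j | j ≟F 4F
  ... | inj₁ p | _     = p
  ... | _      | yes p = p
  ... | inj₂ (l , p , q , l≢4) | no j≢4 = ⊥-elim (ℕₚ.<⇒≱ (s≤s (s≤s (s≤s (s≤s (s≤s z≤n)))))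
    (proj₁ cyc (z 4F ∷ d 4F ∷ d l ∷ d (corner j) ∷ []) (s≤s (s≤s z≤n)
      , ((z-outside 4F ∘ (4F ,_)) ∷ (z-outside 4F ∘ (l ,_)) ∷ (z-outside 4F ∘ (corner j ,_)) ∷ [])
        ∷ (apart p ∷ (λ e′ → j≢4 (corner-injective j 4F (sym (d-inj e′)))) ∷ []) ∷ (apart q ∷ []) ∷ [] ∷ []
      , symG (z-adj 4F) ∷ d-adj′ p ∷ d-adj′ q ∷ subst (Adj G (d (corner j))) e (z-adj j) ∷ [-])))

  -- What a linkage gives directly: two disjoint connected sets outside the domino that contain the
  -- right `z j`. The edge between them is supplied by `halve`.
  record Sides (κ : Crossing) : Set where
    field
      part  : V G → Maybe Bool
      conn  : ∀ {b u v} → part u ≡ just b → part v ≡ just b → Within G (λ w → part w ≡ just b) u v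
      at-z  : ∀ j → part (z j) ≡ just (side κ j)
      off-d : ∀ i → part (d i) ≡ nothing
  open Sides

  halving : Crossing → Set
  halving κ = Σ (Model G Bridge) λ M → (∀ j → Model.lab M (z j) ≡ just (side κ j)) × (∀ i → Model.lab M (d i) ≡ nothing)

  private
    hexagon : (S : V G → Bool) → (∀ i → S (d i) ≡ false) → ContainsCircuit G (λ v → not (S v))
    hexagon S off = map d ks , (s≤s (s≤s z≤n) , Uniqueₚ.map⁺ d-inj uq
      , (d-adj (here refl) ∷ d-adj (there (there (there (there (there (here refl))))))
        ∷ symG (d-adj (there (there (there (there (there (there (here refl))))))))
        ∷ d-adj (there (here refl)) ∷ d-adj (there (there (there (here refl)))) ∷ symG (d-adj (there (there (here refl)))) ∷ [-]))
      , Allₚ.map⁺ (All.universal (λ i → cong not (off i)) ks)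
      where
      ks : List (Fin 7)
      ks = 0F ∷ 1F ∷ 6F ∷ 2F ∷ 3F ∷ 5F ∷ []
      uq : Unique ks
      uq = toWitness {a? = DecUnique.unique? _≟F_ ks} tt

    -- A set whose only edges to its complement are x_j z_j for two values of j contains a
    -- circuit, so it violates cyclic 5-connectivity.
    not-isolated : (S : V G → Bool) → (∀ i → S (d i) ≡ false) → (j₀ j₁ : Fin 5) → S (z j₀) ≡ true →
                   (∀ j → S (z j) ≡ true → j ≡ j₀ ⊎ j ≡ j₁) →
                   (∀ u v → Adj G u v → S u ≡ true → S v ≡ false → Inside v) → ⊥
    not-isolated S off j₀ j₁ at₀ only closed′ = ℕₚ.<⇒≱ {2} {5} (s≤s (s≤s (s≤s z≤n)))
      (ℕₚ.≤-trans (proj₂ cyc S circuit (hexagon S off)) (cut≤ G S ((z j₀ , d (corner j₀)) ∷ (z j₁ , d (corner j₁)) ∷ []) small))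
      where
      foot : ∀ {v i} → S v ≡ true → Adj G v (d i) → (v ≡ z j₀ × i ≡ corner j₀) ⊎ (v ≡ z j₁ × i ≡ corner j₁)
      foot {v} {i} s a with z-only (symG a) (λ { (k , refl) → true≢false s (off k) })
      ... | j , refl , refl with only j s
      ...   | inj₁ refl = inj₁ (refl , refl)
      ...   | inj₂ refl = inj₂ (refl , refl)
      small : ∀ {u v} → S u ≡ true → S v ≡ false → Adj G u v → (u , v) ∈ (z j₀ , d (corner j₀)) ∷ (z j₁ , d (corner j₁)) ∷ []
      small {u} {v} su sv a with closed′ u v a su sv
      ... | i , refl with foot su a
      ...   | inj₁ (refl , refl) = here refl
      ...   | inj₂ (refl , refl) = there (here refl)
      stays : ∀ {u v} → Adj G u v → S u ≡ true → ¬ Inside v → S v ≡ true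
      stays {u} {v} a su out with S v in e
      ... | true  = refl
      ... | false = ⊥-elim (out (closed′ u v a su e))
      -- Away from `z j₀`, only `z j₁` can lose a neighbour to the domino, and it loses just one;
      -- its third neighbour continues the walk.
      next : ∀ u v → Adj G u v → S u ≡ true → S v ≡ true → v ≢ z j₀ → Σ (V G) λ w → Adj G v w × w ≢ u × S w ≡ true
      next u v uv su sv v≢ with Finₚ.any? (λ i → adj G v (d i) Bool.≟ true)
      ... | no none with second-neighbour {G} {v} {u} (cubic v)
      ...   | w , vw , w≢u = w , vw , w≢u , stays vw sv λ { (i , refl) → none (i , vw) }
      next u v uv su sv v≢ | yes (i , vi) with foot sv vi
      ... | inj₁ (refl , _) = ⊥-elim (v≢ refl)
      ... | inj₂ (refl , refl) with third-neighbour {G} (cubic v) (symG uv) vi (λ { refl → true≢false su (off i) })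
      ...   | w , vw , w≢u , w≢i , _ = w , vw , w≢u , stays vw sv out
        where
        out : ¬ Inside w
        out (k , refl) with foot sv vw
        ... | inj₁ (e , _) = v≢ e
        ... | inj₂ (_ , refl) = w≢i refl
      -- The vertices `z j₀` and `z j₁` may coincide, so `z j₀` can have two neighbours in the
      -- domino, and the first step has to avoid both.
      begin′ : Σ (V G) λ w → Adj G (z j₀) w × ¬ Inside w
      begin′ with adj G (z j₀) (d (corner j₁)) Bool.≟ true | corner j₀ ≟F corner j₁
      ... | yes a | no ne with third-neighbour {G} (cubic (z j₀)) (symG (z-adj j₀)) a (ne ∘ d-inj)
      ...   | w , zw , w≢₀ , w≢₁ , _ = w , zw , λ where
        (k , refl) → case foot at₀ zw of λ where
          (inj₁ (_ , refl)) → w≢₀ refl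
          (inj₂ (_ , refl)) → w≢₁ refl
      begin′ | yes a | yes e with second-neighbour {G} {z j₀} {d (corner j₀)} (cubic (z j₀))
      ...   | w , zw , w≢ = w , zw , λ where
        (k , refl) → case foot at₀ zw of λ where
          (inj₁ (_ , refl)) → w≢ refl
          (inj₂ (_ , refl)) → w≢ (cong d (sym e))
      begin′ | no ¬a | _ with second-neighbour {G} {z j₀} {d (corner j₀)} (cubic (z j₀))
      ...   | w , zw , w≢ = w , zw , λ where
        (k , refl) → case foot at₀ zw of λ where
          (inj₁ (_ , refl)) → w≢ refl
          (inj₂ (_ , refl)) → ¬a zw
      circuit : ContainsCircuit G S
      circuit with begin′
      ... | w , a , out = forced-circuit irrG symG S (z j₀) next a at₀ (stays a at₀ out)

    -- The side without the centre is attached to the domino at two corners only.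
    lean : Crossing → Bool
    lean κ = not (side κ 4F)

    lean-exits : ∀ κ → Σ (Fin 5) λ j₀ → Σ (Fin 5) λ j₁ → side κ j₀ ≡ lean κ × (∀ j → side κ j ≡ lean κ → j ≡ j₀ ⊎ j ≡ j₁)
    lean-exits centre-in-Q = 0F , 2F , refl , toWitness {a? = Finₚ.all? λ j → (side centre-in-Q j Bool.≟ true) →-dec ((j ≟F 0F) ⊎-dec (j ≟F 2F))} tt
    lean-exits centre-in-P = 1F , 3F , refl , toWitness {a? = Finₚ.all? λ j → (side centre-in-P j Bool.≟ false) →-dec ((j ≟F 1F) ⊎-dec (j ≟F 3F))} tt

    just? : Bool → Maybe Bool → Bool
    just? true  (just true)  = true
    just? false (just false) = true
    just? _     _            = false

    just?⁻ : ∀ b m → just? b m ≡ true → m ≡ just b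
    just?⁻ true  (just true)  _ = refl
    just?⁻ false (just false) _ = refl

    just?⁺ : ∀ b {m} → m ≡ just b → just? b m ≡ true
    just?⁺ true  refl = refl
    just?⁺ false refl = refl

    bridged : ∀ {κ} (σ : Sides κ) b {u v} → part σ u ≡ just b → part σ v ≡ just (not b) → Adj G u v → halving κ
    bridged σ true {u} {v} pu pv a = record { lab = part σ ; conn = conn σ
      ; edge = λ where bridge → u , v , pu , pv , a } , at-z σ , off-d σ
    bridged σ false {u} {v} pu pv a = record { lab = part σ ; conn = conn σ
      ; edge = λ where bridge → v , u , pv , pu , symG a } , at-z σ , off-d σ

    add : ∀ {κ} (σ : Sides κ) b {u v} → part σ u ≡ just b → part σ v ≡ nothing → ¬ Inside v → Adj G u v → Sides κ
    add {κ} σ b {u} {v} pu pv out a = record { part = part′ ; conn = conn′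
      ; at-z = λ j → keep (at-z σ j) ; off-d = off′ }
      where
      part′ : V G → Maybe Bool
      part′ w with w ≟F v
      ... | yes _ = just b
      ... | no _  = part σ w
      keep : ∀ {w c} → part σ w ≡ just c → part′ w ≡ just c
      keep {w} e with w ≟F v
      ... | no _ = e
      ... | yes refl with trans (sym e) pv
      ...   | ()
      new : part′ v ≡ just b
      new with v ≟F v
      ... | yes _ = refl
      ... | no n  = ⊥-elim (n refl)
      off′ : ∀ i → part′ (d i) ≡ nothing
      off′ i with d i ≟F v
      ... | yes refl = ⊥-elim (out (i , refl))
      ... | no _     = off-d σ i
      F : Bool → V G → Set
      F c w = part′ w ≡ just c
      to-old : ∀ {c w} → part′ w ≡ just c → Σ (V G) λ w′ → part σ w′ ≡ just c × Within G (F c) w w′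
      to-old {c} {w} e with w ≟F v in eq
      ... | no _ = w , e , here (keep e)
      to-old {c} {w} refl | yes refl = u , pu , go new (symG a) (here (keep pu))
      conn′ : ∀ {c w x} → part′ w ≡ just c → part′ x ≡ just c → Within G (F c) w x
      conn′ p q with to-old p | to-old q
      ... | w′ , e , α | x′ , e′ , β = within-trans α (within-trans (within-map keep (conn σ e e′)) (within-sym symG β))

  -- The side without the centre absorbs unassigned neighbours outside the domino until it touches
  -- the other side. It cannot get stuck: then its only outgoing edges would be those to its two
  -- corners, contradicting `not-isolated`.
  halve : ∀ {κ} → Sides κ → halving κ
  halve {κ} σ₀ = grow (size G) σ₀ [] [] (ℕₚ.m≤m+n (size G) 0) (λ ())
    where
    b = lean κ
    j₀ = proj₁ (lean-exits κ)
    j₁ = proj₁ (proj₂ (lean-exits κ))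
    Grows : Sides κ → V G → V G → Set
    Grows σ u v = part σ u ≡ just b × part σ v ≢ just b × Adj G u v × ¬ Inside v
    grows? : ∀ σ u v → Dec (Grows σ u v)
    grows? σ u v = (part σ u ≟M just b) ×-dec (¬? (part σ v ≟M just b) ×-dec ((adj G u v Bool.≟ true) ×-dec ¬? (inside? v)))
      where _≟M_ = ≡-dec Bool._≟_
    -- L lists the vertices added so far.
    grow : (fuel : ℕ) (σ : Sides κ) (L : List (V G)) → Unique L → size G ≤ fuel + length L →
           (∀ {v} → v ∈ L → part σ v ≡ just b) → halving κ
    grow fuel σ L uq big inL with Finₚ.any? (λ u → Finₚ.any? λ v → grows? σ u v)
    ... | no stuck = ⊥-elim (not-isolated S off j₀ j₁ (just?⁺ b (trans (at-z σ j₀) (cong just (proj₁ (proj₂ (proj₂ (lean-exits κ)))))))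
            (λ j s → proj₂ (proj₂ (proj₂ (lean-exits κ))) j (just-injective (trans (sym (at-z σ j)) (just?⁻ b _ s)))) cl)
      where
      S : V G → Bool
      S v = just? b (part σ v)
      off : ∀ i → S (d i) ≡ false
      off i rewrite off-d σ i with b
      ... | true = refl
      ... | false = refl
      cl : ∀ u v → Adj G u v → S u ≡ true → S v ≡ false → Inside v
      cl u v a su sv with inside? v
      ... | yes i = i
      ... | no o = ⊥-elim (stuck (u , v , just?⁻ b _ su , (λ e → true≢false (just?⁺ b e) sv) , a , o))
    ... | yes (u , v , pu , pv , a , out) with part σ v in eq
    ...   | just c = bridged σ b pu (trans eq (cong just (other c b λ e → pv (cong just e)))) a
      where
      other : ∀ c b → c ≢ b → c ≡ not b
      other true true n = ⊥-elim (n refl)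
      other true false n = refl
      other false true n = refl
      other false false n = ⊥-elim (n refl)
    grow zero σ L uq big inL | yes (u , v , pu , pv , a , out) | nothing =
      ⊥-elim (ℕₚ.<⇒≱ (s≤s big) (subst (suc (length L) ≤_) (length-tabulate {n = size G} id)
        (unique-⊆-length {xs = v ∷ L} (All.tabulate (λ i e → pv (trans (sym eq) (inL (subst (_∈ L) (sym e) i)))) ∷ uq) λ {w} _ → ∈-allFin w)))
    grow (suc fuel) σ L uq big inL | yes (u , v , pu , pv , a , out) | nothing =
      grow fuel (add σ b pu eq out a) (v ∷ L)
        (All.tabulate (λ i e → pv (trans (sym eq) (inL (subst (_∈ L) (sym e) i)))) ∷ uq)
        (subst (size G ≤_) (sym (ℕₚ.+-suc fuel _)) big) inL′
      where
      inL′ : ∀ {w} → w ∈ v ∷ L → part (add σ b pu eq out a) w ≡ just b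
      inL′ {w} w∈ with w ≟F v
      ... | yes _ = refl
      inL′ (here e) | no n = ⊥-elim (n e)
      inL′ (there i) | no n = inL i

-- Crossed dominoes

abstract
  -- A connected subgraph that meets the domino in two vertices cannot consist of `x_j` alone, so it
  -- has an edge at `x_j`.
  partner : ∀ κ j → Σ (Fin 5) λ j′ → side κ j′ ≡ side κ j × j′ ≢ j
  partner centre-in-Q = toWitness {a? = Finₚ.all? λ j → Finₚ.any? λ j′ → (side centre-in-Q j′ Bool.≟ side centre-in-Q j) ×-dec ¬? (j′ ≟F j)} tt
  partner centre-in-P = toWitness {a? = Finₚ.all? λ j → Finₚ.any? λ j′ → (side centre-in-P j′ Bool.≟ side centre-in-P j) ×-dec ¬? (j′ ≟F j)} tt

module CrossedFacts (G : Graph) (simple : IsSimple G) (cubic : ∀ v → degree G v ≡ 3) (cyc : CyclicallyConnected 5 G)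
              (d : Fin 7 → V G) (d-inj : ∀ {i j} → d i ≡ d j → i ≡ j)
              (d-adj : ∀ {i j} → (i , j) ∈ dominoEdges → Adj G (d i) (d j))
              (D : Domino G) (ined : ∀ {i j} → i ~ j → InED D (d i) (d j)) where
  open DominoFacts G simple cubic cyc d d-inj d-adj public
  open ConnSubgraphOffD

  leaves : (S : ConnSubgraphOffD D) → ∀ {i v} → es S (d i) v ≡ true → ¬ Inside v
  leaves S {i} e (k , refl) = off-D S _ _ e (ined (d-only (es⊆G S _ _ e)))

  -- The domino is induced and `S` avoids its edges, so the first step of a walk in `S` from a
  -- corner or the centre goes to the unique outer neighbour.
  meets-z : (S : ConnSubgraphOffD D) → ∀ j {v} → vs S (d (corner j)) ≡ true → vs S v ≡ true → v ≢ d (corner j) →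
            vs S (z j) ≡ true
  meets-z S j {v} p q v≢ with connected S (d (corner j)) v p q
  ... | stop = ⊥-elim (v≢ refl)
  ... | step {w = w} e _ = subst (λ u → vs S u ≡ true) (z-unique j (es⊆G S _ _ e) (leaves S e))
                                 (proj₂ (es-ends S _ _ e))

  module _ (κ : Crossing) (S : Bool → ConnSubgraphOffD D) (disjoint : VDisjoint D (S true) (S false))
           (member : ∀ j → vs (S (side κ j)) (d (corner j)) ≡ true) where
    private
      part : V G → Maybe Bool
      part v with inside? v | vs (S true) v | vs (S false) v
      ... | yes _ | _     | _     = nothing
      ... | no _  | true  | _     = just true
      ... | no _  | false | true  = just false
      ... | no _  | false | false = nothing

      part⁻ : ∀ {b v} → part v ≡ just b → vs (S b) v ≡ true × ¬ Inside v
      part⁻ {b} {v} e with inside? v | vs (S true) v in p | vs (S false) v in q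
      part⁻ refl | no o | true  | _    = p , o
      part⁻ refl | no o | false | true = q , o

      part⁺ : ∀ {b v} → vs (S b) v ≡ true → ¬ Inside v → part v ≡ just b
      part⁺ {b} {v} e o with inside? v | vs (S true) v in p | vs (S false) v in q
      ... | yes i | _ | _ = ⊥-elim (o i)
      part⁺ {true}  e o | no _ | true | _ = refl
      part⁺ {false} {v} e o | no _ | true | _ = ⊥-elim (true≢false e (disjoint v p))
      part⁺ {true}  e o | no _ | false | _ with trans (sym p) e
      ... | ()
      part⁺ {false} e o | no _ | false | true = refl
      part⁺ {false} e o | no _ | false | false with trans (sym q) e
      ... | ()

      -- A walk in `S b` between outer vertices can visit the domino only by going from `z j` to
      -- `x_j` and straight back along the same edge, so each visit can be cut out.
      detour : ∀ b {u v} → Walk (es (S b)) u v → vs (S b) u ≡ true → ¬ Inside u → ¬ Inside v →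
               Within G (λ w → part w ≡ just b) u v
      detour b stop p o _ = here (part⁺ p o)
      detour b (step {u} {w} e α) p o o′ with inside? w
      ... | no out = go (part⁺ p o) (es⊆G (S b) _ _ e) (detour b α (proj₂ (es-ends (S b) _ _ e)) out o′)
      detour b (step e stop) p o o′ | yes i = ⊥-elim (o′ i)
      detour b (step {u} e (step {w = w} e′ α)) p o o′ | yes (i , refl)
        with z-only (symG (es⊆G (S b) _ _ e)) o | z-only (es⊆G (S b) _ _ e′) (leaves (S b) e′)
      ... | j , i≡ , refl | j′ , i≡′ , refl with corner-injective j j′ (trans (sym i≡) i≡′)
      ...   | refl = detour b α p o o′

    sides : Sides κ
    sides = record
      { part  = part
      ; conn  = λ {b} {u} {v} p q → let p′ , o = part⁻ p ; q′ , o′ = part⁻ q in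
                  detour b (connected (S b) u v p′ q′) p′ o o′
      ; at-z  = λ j → let j′ , same , ne = partner κ j in
                  part⁺ (meets-z (S (side κ j)) j (member j) (subst (λ b → vs (S b) (d (corner j′)) ≡ true) same (member j′))
                          (λ e → ne (corner-injective j′ j (d-inj e)))) (z-outside j)
      ; off-d = off }
      where
      off : ∀ i → part (d i) ≡ nothing
      off i with inside? (d i)
      ... | yes _ = refl
      ... | no n = ⊥-elim (n (i , refl))

  frame : (∀ κ → Sides κ) → Frame G
  frame σ = record
    { d = d ; d-inj = d-inj ; d-adj = d-adj ; d-only = d-only ; z = z ; z-adj = z-adj
    ; z-out = λ j i e → z-outside j (i , e)
    ; z-only = λ a out → z-only a λ (k , e) → out k e
    ; z₅-own = z₅-own
    ; halves = λ κ → proj₁ (halve (σ κ)) ; half-z = λ κ → proj₁ (proj₂ (halve (σ κ)))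
    ; half-d = λ κ → proj₂ (proj₂ (halve (σ κ))) }

-- The four automorphisms of the domino and the attachment sequence

symmetry : Fin 4 → Fin 7 → Fin 7
symmetry zero = lookup (0F ∷ 1F ∷ 2F ∷ 3F ∷ 4F ∷ 5F ∷ 6F ∷ [])
symmetry 1F   = lookup (1F ∷ 0F ∷ 3F ∷ 2F ∷ 4F ∷ 6F ∷ 5F ∷ [])
symmetry 2F   = lookup (2F ∷ 3F ∷ 0F ∷ 1F ∷ 4F ∷ 6F ∷ 5F ∷ [])
symmetry 3F   = lookup (3F ∷ 2F ∷ 1F ∷ 0F ∷ 4F ∷ 5F ∷ 6F ∷ [])

outer-corner : Fin 4 → Fin 5
outer-corner k = Fin.inject≤ k (s≤s (s≤s (s≤s (s≤s z≤n))))

private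
  corner⁴ : Fin 4 → Fin 7
  corner⁴ = corner ∘ outer-corner

abstract
  symmetry-injective : ∀ c i j → symmetry c i ≡ symmetry c j → i ≡ j
  symmetry-injective = toWitness {a? = Finₚ.all? λ c → Finₚ.all? λ i → Finₚ.all? λ j →
    (symmetry c i ≟F symmetry c j) →-dec (i ≟F j)} tt

  symmetry-edges : ∀ c → All (λ (i , j) → symmetry c i ~ symmetry c j) dominoEdges
  symmetry-edges = toWitness {a? = Finₚ.all? λ c → All.all? (λ (i , j) → symmetry c i ~? symmetry c j) dominoEdges} tt

  symmetry-links : ∀ c i j → i ~ j → symmetry c i ~ symmetry c j
  symmetry-links c i j (inj₁ e) = All.lookup (symmetry-edges c) e
  symmetry-links c i j (inj₂ e) = [ inj₂ , inj₁ ]′ (All.lookup (symmetry-edges c) e)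

  symmetry-onto : ∀ c k → Σ (Fin 7) λ i → symmetry c i ≡ k
  symmetry-onto = toWitness {a? = Finₚ.all? λ c → Finₚ.all? λ k → Finₚ.any? λ i → symmetry c i ≟F k} tt

  orientation : ∀ p₁ p₂ p₃ p₄ → p₁ ≢ p₃ → p₁ ≢ p₄ → p₂ ≢ p₄ → p₃ ≢ p₄ → corner⁴ p₁ ~ corner⁴ p₂ →
    (Σ (Fin 7) λ k → corner⁴ p₂ ~ k × corner⁴ p₃ ~ k) → p₂ ≢ p₃ →
    Σ (Fin 4) λ c → symmetry c 0F ≡ corner⁴ p₁ × symmetry c 1F ≡ corner⁴ p₂ × symmetry c 2F ≡ corner⁴ p₃ ×
                    symmetry c 3F ≡ corner⁴ p₄ × symmetry c 4F ≡ 4F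
  orientation = toWitness {a? = Finₚ.all? λ p₁ → Finₚ.all? λ p₂ → Finₚ.all? λ p₃ → Finₚ.all? λ p₄ →
    ¬? (p₁ ≟F p₃) →-dec (¬? (p₁ ≟F p₄) →-dec (¬? (p₂ ≟F p₄) →-dec (¬? (p₃ ≟F p₄) →-dec ((corner⁴ p₁ ~? corner⁴ p₂) →-dec
    ((Finₚ.any? λ k → (corner⁴ p₂ ~? k) ×-dec (corner⁴ p₃ ~? k)) →-dec (¬? (p₂ ≟F p₃) →-dec
    (Finₚ.any? λ c → (symmetry c 0F ≟F corner⁴ p₁) ×-dec ((symmetry c 1F ≟F corner⁴ p₂) ×-dec ((symmetry c 2F ≟F corner⁴ p₃)
      ×-dec ((symmetry c 3F ≟F corner⁴ p₄) ×-dec (symmetry c 4F ≟F 4F)))))))))))} tt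

record Setup (G : Graph) (D : Domino G) (x₁ x₂ x₃ x₄ x₅ z₅ : V G) : Set where
  field
    framed : Frame G
  open Frame framed public
  field
    x₁≡  : x₁ ≡ d 0F
    x₂≡  : x₂ ≡ d 1F
    x₃≡  : x₃ ≡ d 2F
    x₄≡  : x₄ ≡ d 3F
    x₅≡  : x₅ ≡ d 4F
    z₅≡  : z₅ ≡ z 4F
    inVD : ∀ {v} → InVD D v → Σ (Fin 7) λ i → v ≡ d i
    VDin : ∀ i → InVD D (d i)
    inED : ∀ {i j} → i ~ j → InED D (d i) (d j)

module _ {G : Graph} (cubicG : IsCubic G) (cyc : CyclicallyConnected 5 G) (D : Domino G) where
  open Domino D
  open ConnSubgraphOffD using (vs)
  private
    simple = proj₁ cubicG
    cubic = proj₂ cubicG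

    dom : Fin 7 → V G
    dom = lookup (a₁ ∷ a₂ ∷ b₂ ∷ b₁ ∷ c ∷ s ∷ t ∷ [])

    place : ∀ {v} → InVD D v → Σ (Fin 7) λ i → v ≡ dom i
    place (here e) = 5F , e
    place (there (here e)) = 6F , e
    place (there (there (here e))) = 4F , e
    place (there (there (there (here e)))) = 0F , e
    place (there (there (there (there (here e))))) = 1F , e
    place (there (there (there (there (there (here e)))))) = 3F , e
    place (there (there (there (there (there (there (here e))))))) = 2F , e

    position : Fin 7 → Fin 7
    position = lookup (3F ∷ 4F ∷ 6F ∷ 5F ∷ 2F ∷ 0F ∷ 1F ∷ [])

    vertices : List (V G)
    vertices = dVerts s t c a₁ a₂ b₁ b₂

    dom-position : ∀ i → dom i ≡ List.lookup vertices (position i)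
    dom-position zero = refl
    dom-position 1F = refl
    dom-position 2F = refl
    dom-position 3F = refl
    dom-position 4F = refl
    dom-position 5F = refl
    dom-position 6F = refl

    dom-in : ∀ i → InVD D (dom i)
    dom-in i = subst (_∈ vertices) (sym (dom-position i)) (∈-lookup (position i))

    position-injective : ∀ i j → position i ≡ position j → i ≡ j
    position-injective = toWitness {a? = Finₚ.all? λ i → Finₚ.all? λ j → (position i ≟F position j) →-dec (i ≟F j)} tt

    dom-inj : ∀ {i j} → dom i ≡ dom j → i ≡ j
    dom-inj {i} {j} e = position-injective i j
      (lookup-injective distinct (position i) (position j) (trans (sym (dom-position i)) (trans e (dom-position j))))
      where
      lookup-injective : ∀ {xs : List (V G)} → Unique xs → ∀ i j → List.lookup xs i ≡ List.lookup xs j → i ≡ j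
      lookup-injective (_ ∷ _) zero zero _ = refl
      lookup-injective (p ∷ _) zero (suc j) e = ⊥-elim (All.lookup p (subst (_∈ _) (sym e) (∈-lookup j)) refl)
      lookup-injective (p ∷ _) (suc i) zero e = ⊥-elim (All.lookup p (subst (_∈ _) e (∈-lookup i)) refl)
      lookup-injective (_ ∷ u) (suc i) (suc j) e = cong suc (lookup-injective u i j e)

    dom-ED : All (λ (i , j) → InED D (dom i) (dom j)) dominoEdges
    dom-ED = inj₁ (there (there (there (here refl)))) ∷ inj₂ (there (there (there (there (there (there (here refl)))))))
           ∷ inj₂ (there (there (here refl))) ∷ inj₂ (there (there (there (there (there (here refl))))))
           ∷ inj₂ (here refl) ∷ inj₁ (there (there (there (there (here refl)))))
           ∷ inj₁ (there (there (there (there (there (there (there (here refl))))))))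
           ∷ inj₁ (there (here refl)) ∷ []

    ED-swap : ∀ {u v} → InED D u v → InED D v u
    ED-swap (inj₁ e) = inj₂ e
    ED-swap (inj₂ e) = inj₁ e

    ED-adj : ∀ {u v} → InED D u v → Adj G u v
    ED-adj (inj₁ e) = All.lookup edges e
    ED-adj (inj₂ e) = simple⇒symmetric {G} simple (All.lookup edges e)

    dom-ined : ∀ {i j} → i ~ j → InED D (dom i) (dom j)
    dom-ined (inj₁ e) = All.lookup dom-ED e
    dom-ined (inj₂ e) = ED-swap (All.lookup dom-ED e)

    dom-corner : ∀ {v} → v ∈ corners D → Σ (Fin 4) λ k → v ≡ dom (corner⁴ k)
    dom-corner (here e) = 0F , e
    dom-corner (there (here e)) = 1F , e
    dom-corner (there (there (here e))) = 3F , e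
    dom-corner (there (there (there (here e)))) = 2F , e

    -- The facts are instantiated twice: here with an arbitrary orientation, in order to locate the
    -- attachment sequence in the domino, and later as `X` with the orientation that puts `x₁`, ...,
    -- `x₅` at 0, ..., 4.
    module Dom = CrossedFacts G simple cubic cyc dom dom-inj (ED-adj ∘ dom-ined ∘ inj₁) D dom-ined

    in-S : ∀ {S : ConnSubgraphOffD D} {L} → MeetsDIn D S L → ∀ {v} → v ∈ L → vs S v ≡ true
    in-S m v∈ = proj₁ (Equivalence.from (m _) v∈)

  setup : ∀ {x₁ x₂ x₃ x₄ x₅} → IsAttachmentSeq D x₁ x₂ x₃ x₄ x₅ → IsCrossed D x₁ x₂ x₃ x₄ x₅ →
          ∀ {z₅} → Adj G x₅ z₅ → ¬ InED D x₅ z₅ → Setup G D x₁ x₂ x₃ x₄ x₅ z₅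
  setup ((x₁≢x₂ ∷ x₁≢x₃ ∷ x₁≢x₄ ∷ []) ∷ (x₂≢x₃ ∷ x₂≢x₄ ∷ []) ∷ (x₃≢x₄ ∷ []) ∷ [] ∷ []
        , k₁ ∷ k₂ ∷ k₃ ∷ k₄ ∷ [] , refl , x₁x₂ , w , x₂w , x₃w)
        ((P , Q , dis , mP , mQ) , (P′ , Q′ , dis′ , mP′ , mQ′)) {z₅} xz nz
    with dom-corner k₁ | dom-corner k₂ | dom-corner k₃ | dom-corner k₄
  ... | p₁ , refl | p₂ , refl | p₃ , refl | p₄ , refl =
    let i , e₁ , e₂ , e₃ , e₄ , e₅ = oriented in build i e₁ e₂ e₃ e₄ e₅
    where
    -- Outside the domino, the common neighbour would be the outer neighbour of both `x₂` and `x₃`,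
    -- hence would lie in the disjoint subgraphs P and Q.
    common : Σ (Fin 7) λ k → corner⁴ p₂ ~ k × corner⁴ p₃ ~ k
    common with Dom.inside? w
    ... | yes (k , refl) = k , Dom.d-only x₂w , Dom.d-only x₃w
    ... | no out = ⊥-elim (true≢false w∈Q (dis w w∈P))
      where
      w∈P : vs P w ≡ true
      w∈P = subst (λ u → vs P u ≡ true) (sym (Dom.z-unique (outer-corner p₃) x₃w out))
              (Dom.meets-z P (outer-corner p₃) (in-S {P} mP (there (here refl))) (in-S {P} mP (here refl)) x₁≢x₃)
      w∈Q : vs Q w ≡ true
      w∈Q = subst (λ u → vs Q u ≡ true) (sym (Dom.z-unique (outer-corner p₂) x₂w out))
              (Dom.meets-z Q (outer-corner p₂) (in-S {Q} mQ (here refl)) (in-S {Q} mQ (there (here refl))) (x₂≢x₄ ∘ sym))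
    oriented = orientation p₁ p₂ p₃ p₄ (λ { refl → x₁≢x₃ refl }) (λ { refl → x₁≢x₄ refl }) (λ { refl → x₂≢x₄ refl })
                 (λ { refl → x₃≢x₄ refl }) (Dom.d-only x₁x₂) common (λ { refl → x₂≢x₃ refl })
    build : ∀ i → symmetry i 0F ≡ corner⁴ p₁ → symmetry i 1F ≡ corner⁴ p₂ → symmetry i 2F ≡ corner⁴ p₃ →
            symmetry i 3F ≡ corner⁴ p₄ → symmetry i 4F ≡ 4F →
            Setup G D (dom (corner⁴ p₁)) (dom (corner⁴ p₂)) (dom (corner⁴ p₃)) (dom (corner⁴ p₄)) c z₅
    build i e₁ e₂ e₃ e₄ e₅ = record
      { framed = X.frame halves′
      ; x₁≡ = cong dom (sym e₁) ; x₂≡ = cong dom (sym e₂) ; x₃≡ = cong dom (sym e₃) ; x₄≡ = cong dom (sym e₄)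
      ; x₅≡ = cong dom (sym e₅)
      ; z₅≡ = X.z-unique 4F (subst (λ u → Adj G u z₅) (cong dom (sym e₅)) xz)
                (λ { (k , refl) → nz (subst (λ u → InED D u (d k)) (cong dom e₅)
                     (ined (X.d-only (subst (λ u → Adj G u (d k)) (cong dom (sym e₅)) xz)))) })
      ; inVD = λ v∈ → let k , e = place v∈ ; l , e′ = symmetry-onto i k in l , trans e (cong dom (sym e′))
      ; VDin = λ k → dom-in (symmetry i k)
      ; inED = ined }
      where
      d : Fin 7 → V G
      d = dom ∘ symmetry i
      ined : ∀ {k l} → k ~ l → InED D (d k) (d l)
      ined {k} {l} e = dom-ined (symmetry-links i k l e)
      module X = CrossedFacts G simple cubic cyc d (λ {k} {l} e → symmetry-injective i k l (dom-inj e))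
                   (λ e → ED-adj (ined (inj₁ e))) D ined
      pick : {A : Set} → A → A → Bool → A
      pick p q true  = p
      pick p q false = q
      at-d : ∀ (S : ConnSubgraphOffD D) k {p} → symmetry i k ≡ p → vs S (dom p) ≡ true → vs S (d k) ≡ true
      at-d S k e m = subst (λ u → vs S u ≡ true) (cong dom (sym e)) m
      halves′ : ∀ κ → X.Sides κ
      halves′ centre-in-Q = X.sides centre-in-Q (pick P Q) dis λ where
        zero → at-d P _ e₁ (in-S {P} mP (here refl))
        1F → at-d Q _ e₂ (in-S {Q} mQ (here refl))
        2F → at-d P _ e₃ (in-S {P} mP (there (here refl)))
        3F → at-d Q _ e₄ (in-S {Q} mQ (there (here refl)))
        4F → at-d Q _ e₅ (in-S {Q} mQ (there (there (here refl))))
      halves′ centre-in-P = X.sides centre-in-P (pick P′ Q′) dis′ λ where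
        zero → at-d P′ _ e₁ (in-S {P′} mP′ (here refl))
        1F → at-d Q′ _ e₂ (in-S {Q′} mQ′ (here refl))
        2F → at-d P′ _ e₃ (in-S {P′} mP′ (there (here refl)))
        3F → at-d Q′ _ e₄ (in-S {Q′} mQ′ (there (here refl)))
        4F → at-d P′ _ e₅ (in-S {P′} mP′ (there (there (here refl))))

-- Labelling the vertices of H

module Paths {G H : Graph} (simpleG : IsSimple G) (simpleH : IsSimple H) (η : Embedding G H) where
  open Embedding η public

  symG : Symmetric G
  symG = simple⇒symmetric simpleG

  symH : Symmetric H
  symH = simple⇒symmetric simpleH

  path : V G → V G → List (V H)
  path a b = fullPath (vmap a) (inner a b) (vmap b)

  path-chain : ∀ {a b} → Adj G a b → Chain H (vmap a) (path a b) (vmap b)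
  path-chain e = linked-chain (proj₂ (isPath _ _ e))

  path-unique : ∀ {a b} → Adj G a b → Unique (path a b)
  path-unique e = proj₁ (isPath _ _ e)

  sameEdge? : ∀ (a b c d : V G) → Dec (SameEdge a b c d)
  sameEdge? a b c d = ((a ≟F c) ×-dec (b ≟F d)) ⊎-dec ((a ≟F d) ×-dec (b ≟F c))

  inner⊆path : ∀ {a b h} → h ∈ inner a b → h ∈ path a b
  inner⊆path h∈ = there (∈-++⁺ˡ h∈)

  inner-flip : ∀ {a b h} → Adj G a b → h ∈ inner a b → h ∈ inner b a
  inner-flip {a} {b} e h∈ = subst (_ ∈_) (sym (inner-sym a b e)) (∈-reverse⁺ h∈)

  inner-same : ∀ {a b c d h} → Adj G a b → Adj G c d → h ∈ inner a b → h ∈ inner c d → SameEdge a b c d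
  inner-same {a} {b} {c} {d} e e′ h∈ h∈′ with sameEdge? a b c d
  ... | yes s = s
  ... | no n  = ⊥-elim (vert-disj a b c d e e′ n _ h∈ (inner⊆path h∈′))

  vmap∉inner : ∀ {a b} → Adj G a b → ∀ v → vmap v ∉ inner a b
  vmap∉inner {a} {b} e v v∈ with path-unique e | Equivalence.to (ends a b e v) (inner⊆path v∈)
  ... | a∉ ∷ _ | inj₁ refl = All.lookup a∉ (∈-++⁺ˡ v∈) refl
  ... | _ ∷ u  | inj₂ refl = proj₂ (proj₂ (unique-++⁻ (inner a b) u)) v∈ (here refl)

  path-cases : ∀ {a b h} → h ∈ path a b → h ≡ vmap a ⊎ h ∈ inner a b ⊎ h ≡ vmap b
  path-cases (here e) = inj₁ e
  path-cases {a} {b} (there h∈) with ∈-++⁻ (inner a b) h∈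
  ... | inj₁ i = inj₂ (inj₁ i)
  ... | inj₂ (here e) = inj₂ (inj₂ e)

  vmap-inj′ : ∀ {u v} → vmap u ≡ vmap v → u ≡ v
  vmap-inj′ = vmap-inj _ _

  branch? : ∀ h → Dec (Σ (V G) λ v → vmap v ≡ h)
  branch? h = Finₚ.any? λ v → vmap v ≟F h

  Interior : V H → Set
  Interior h = Σ (V G) λ a → Σ (V G) λ b → Adj G a b × h ∈ inner a b

  interior? : ∀ h → Dec (Interior h)
  interior? h = Finₚ.any? λ a → Finₚ.any? λ b → (adj G a b Bool.≟ true) ×-dec (h ∈? inner a b)

  prefix-chain : ∀ {a b} X {h Z} → Adj G a b → inner a b ≡ X ++ h ∷ Z → Chain H (vmap a) (vmap a ∷ X ++ h ∷ []) h
  prefix-chain {a} {b} X {h} {Z} e eq =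
    proj₁ (chain-split (vmap a ∷ X) (path-chain e)
      (cong (vmap a ∷_) (trans (cong (_++ vmap b ∷ []) eq) (++-assoc X (h ∷ Z) (vmap b ∷ [])))))

  chain-start : ∀ {u x L t} → Chain H u (x ∷ L) t → u ≡ x
  chain-start one     = refl
  chain-start (_ ◂ _) = refl

  border : ∀ {u t} X W → Chain H u ((u ∷ X) ++ W) t → 0 < length W →
           Σ (V H) λ h → Σ (V H) λ h′ → Adj H h h′ × h ∈ u ∷ X × h′ ∈ W
  border [] (w ∷ W) (e ◂ one)     _ = _ , w , e , here refl , here refl
  border [] (w ∷ W) (e ◂ (_ ◂ _)) _ = _ , w , e , here refl , here refl
  border (x ∷ X) W (_ ◂ c) pos with chain-start c
  ... | refl with border X W c pos
  ...   | h , h′ , e , i , j = h , h′ , e , there i , j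

  chain-consec : ∀ {u L t} → Chain H u L t → ∀ {p q} → Consec p q L → Adj H p q
  chain-consec c (ys , zs , refl) with chain-split ys c refl
  ... | _ , (a ◂ one)     = a
  ... | _ , (a ◂ (_ ◂ _)) = a

  -- Assigns every vertex of η(G) to a vertex of G: branch vertices to their originals and interior
  -- vertices of η(ab) to a or b, in two blocks.
  record Labelling (Retained : V G → V G → Set) : Set where
    field
      own      : V H → Maybe (V G)
      own-vmap : ∀ v → own (vmap v) ≡ just v
      own-star : ∀ {h v} → own h ≡ just v → h ≡ vmap v ⊎ Σ (V G) λ b → Adj G v b ×
                 Σ (List (V H)) λ X → Σ (List (V H)) λ Z → inner v b ≡ X ++ h ∷ Z × All (λ x → own x ≡ just v) X
      own-edge : ∀ {a b} → Retained a b → Σ (V H) λ h → Σ (V H) λ h′ → own h ≡ just a × own h′ ≡ just b ×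
                 Adj H h h′ × h ∈ path a b × h′ ∈ path a b

  module Owner (Inside : V G → Set) (inside? : ∀ v → Dec (Inside v)) where

    -- Interiors of the five exit paths belong to the ends outside the domino, so the initial region
    -- contains just the first vertex of each. For the other edges the smaller end is taken only to
    -- make the choice independent of the direction.
    pick : V G → V G → V G
    pick a b with inside? a | inside? b
    ... | yes _ | no _ = b
    ... | no _ | yes _ = a
    ... | yes _ | yes _ = if ⌊ a Finₚ.<? b ⌋ then a else b
    ... | no _ | no _ = if ⌊ a Finₚ.<? b ⌋ then a else b

    private
      min-sym : ∀ (a b : V G) → (if ⌊ a Finₚ.<? b ⌋ then a else b) ≡ (if ⌊ b Finₚ.<? a ⌋ then b else a)
      min-sym a b with a Finₚ.<? b | b Finₚ.<? a
      ... | yes p | yes q = ⊥-elim (ℕₚ.<-asym p q)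
      ... | yes _ | no _  = refl
      ... | no _  | yes _ = refl
      ... | no p  | no q  = Finₚ.≤-antisym (ℕₚ.≮⇒≥ p) (ℕₚ.≮⇒≥ q)

      min-one : ∀ (a b : V G) → (if ⌊ a Finₚ.<? b ⌋ then a else b) ≡ a ⊎ (if ⌊ a Finₚ.<? b ⌋ then a else b) ≡ b
      min-one a b with a Finₚ.<? b
      ... | yes _ = inj₁ refl
      ... | no _  = inj₂ refl

    pick-sym : ∀ a b → pick a b ≡ pick b a
    pick-sym a b with inside? a | inside? b
    ... | yes _ | no _  = refl
    ... | no _  | yes _ = refl
    ... | yes _ | yes _ = min-sym a b
    ... | no _  | no _  = min-sym a b

    pick-one : ∀ a b → pick a b ≡ a ⊎ pick a b ≡ b
    pick-one a b with inside? a | inside? b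
    ... | yes _ | no _  = inj₂ refl
    ... | no _  | yes _ = inj₁ refl
    ... | yes _ | yes _ = min-one a b
    ... | no _  | no _  = min-one a b

    pick-outer : ∀ {a b} → Inside a → ¬ Inside b → pick a b ≡ b
    pick-outer {a} {b} i o with inside? a | inside? b
    ... | yes _ | no _  = refl
    ... | no n  | _     = ⊥-elim (n i)
    ... | yes _ | yes j = ⊥-elim (o j)

    pick-inside : ∀ {a b} → Inside (pick a b) → Inside a × Inside b
    pick-inside {a} {b} p with inside? a | inside? b
    ... | yes _ | no n  = ⊥-elim (n p)
    ... | no n  | yes _ = ⊥-elim (n p)
    ... | yes i | yes j = i , j
    ... | no n  | no m with min-one a b
    ...   | inj₁ e = ⊥-elim (n (subst Inside e p))
    ...   | inj₂ e = ⊥-elim (m (subst Inside e p))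

    owner : V H → Maybe (V G)
    owner h with branch? h | interior? h
    ... | yes (v , _) | _               = just v
    ... | no _        | yes (a , b , _) = just (pick a b)
    ... | no _        | no _            = nothing

    owner-vmap : ∀ v → owner (vmap v) ≡ just v
    owner-vmap v with branch? (vmap v) | interior? (vmap v)
    ... | yes (w , e) | _ = cong just (vmap-inj′ e)
    ... | no n        | _ = ⊥-elim (n (v , refl))

    owner-inner : ∀ {a b h} → Adj G a b → h ∈ inner a b → owner h ≡ just (pick a b)
    owner-inner {a} {b} {h} e h∈ with branch? h | interior? h
    ... | yes (w , refl) | _ = ⊥-elim (vmap∉inner e w h∈)
    ... | no _ | no n = ⊥-elim (n (a , b , e , h∈))
    ... | no _ | yes (a′ , b′ , e′ , h∈′) with inner-same e′ e h∈′ h∈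
    ...   | inj₁ (refl , refl) = refl
    ...   | inj₂ (refl , refl) = cong just (pick-sym a′ b′)

    owner-cases : ∀ {h v} → owner h ≡ just v → h ≡ vmap v ⊎ Σ (V G) λ b → Adj G v b × h ∈ inner v b × pick v b ≡ v
    owner-cases {h} eq with branch? h | interior? h
    owner-cases refl | yes (v , e) | _ = inj₁ (sym e)
    owner-cases refl | no _ | yes (a , b , e , h∈) with pick-one a b
    ... | inj₁ eq rewrite eq = inj₂ (b , e , h∈ , eq)
    ... | inj₂ eq rewrite eq = inj₂ (a , symG e , inner-flip e h∈ , trans (pick-sym b a) eq)

    free⇒∉ : ∀ {h a b} → Adj G a b → owner h ≡ nothing → h ∉ path a b
    free⇒∉ {h} {a} {b} e eq h∈ with path-cases {a} {b} h∈
    ... | inj₁ refl with trans (sym eq) (owner-vmap a)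
    ...   | ()
    free⇒∉ {h} {a} {b} e eq h∈ | inj₂ (inj₁ i) with trans (sym eq) (owner-inner e i)
    ...   | ()
    free⇒∉ {h} {a} {b} e eq h∈ | inj₂ (inj₂ refl) with trans (sym eq) (owner-vmap b)
    ...   | ()

    base-labelling : Labelling (Adj G)
    base-labelling = record { own = owner ; own-vmap = owner-vmap ; own-star = star ; own-edge = edge }
      where
      star : ∀ {h v} → owner h ≡ just v → h ≡ vmap v ⊎ Σ (V G) λ b → Adj G v b ×
             Σ (List (V H)) λ X → Σ (List (V H)) λ Z → inner v b ≡ X ++ h ∷ Z × All (λ x → owner x ≡ just v) X
      star eq with owner-cases eq
      ... | inj₁ e = inj₁ e
      ... | inj₂ (b , e , h∈ , p) with ∈-∃++ h∈
      ...   | X , Z , split = inj₂ (b , e , X , Z , split , All.tabulate λ i →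
              trans (owner-inner e (subst (_ ∈_) (sym split) (∈-++⁺ˡ i))) (cong just p))
      edge : ∀ {a b} → Adj G a b → Σ (V H) λ h → Σ (V H) λ h′ → owner h ≡ just a × owner h′ ≡ just b ×
             Adj H h h′ × h ∈ path a b × h′ ∈ path a b
      edge {a} {b} e with pick-one a b
      ... | inj₁ p with border (inner a b) (vmap b ∷ []) (path-chain e) (s≤s z≤n)
      ...   | h , h′ , hh′ , i , here refl = h , h′ , All.lookup own-a i , owner-vmap b , hh′ ,
                                          ∈-++⁺ˡ {xs = vmap a ∷ inner a b} i , ∈-++⁺ʳ (vmap a ∷ inner a b) (here refl)
        where
        own-a : All (λ x → owner x ≡ just a) (vmap a ∷ inner a b)
        own-a = owner-vmap a ∷ All.tabulate (λ i → trans (owner-inner e i) (cong just p))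
      edge {a} {b} e | inj₂ p with border [] (inner a b ++ vmap b ∷ []) (path-chain e) (positive (inner a b))
        where
        positive : ∀ L → 0 < length (L ++ vmap b ∷ [])
        positive []      = s≤s z≤n
        positive (_ ∷ _) = s≤s z≤n
      ...   | h , h′ , hh′ , here refl , i′ = h , h′ , owner-vmap a , All.lookup own-b i′ , hh′ , here refl , there i′
        where
        own-b : All (λ x → owner x ≡ just b) (inner a b ++ vmap b ∷ [])
        own-b = Allₚ.++⁺ (All.tabulate (λ i → trans (owner-inner e i) (cong just p))) (owner-vmap b ∷ [])

    -- The edge f₁f₂ is cut at the interior vertex q, which is left without a label.
    module Marked {f₁ f₂ : V G} (f : Adj G f₁ f₂) (same : Inside f₁ → Inside f₂) (same′ : Inside f₂ → Inside f₁)
                  {q : V H} {l r : List (V H)} (split : inner f₁ f₂ ≡ l ++ q ∷ r) where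

      own : V H → Maybe (V G)
      own h with h ≟F q | h ∈? l | h ∈? r
      ... | yes _ | _     | _     = nothing
      ... | no _  | yes _ | _     = just f₁
      ... | no _  | no _  | yes _ = just f₂
      ... | no _  | no _  | no _  = owner h

      private
        uq = unique-++⁻ l (subst Unique split (proj₁ (unique-++⁻ (inner f₁ f₂) (case path-unique f of λ where (_ ∷ u) → u))))

        l⊆ : ∀ {h} → h ∈ l → h ∈ inner f₁ f₂
        l⊆ i = subst (_ ∈_) (sym split) (∈-++⁺ˡ i)

        r⊆ : ∀ {h} → h ∈ r → h ∈ inner f₁ f₂
        r⊆ i = subst (_ ∈_) (sym split) (∈-++⁺ʳ l (there i))

        q∈ : q ∈ inner f₁ f₂
        q∈ = subst (q ∈_) (sym split) (∈-++⁺ʳ l (here refl))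

        q∉r : q ∉ r
        q∉r i with proj₁ (proj₂ uq)
        ... | p ∷ _ = All.lookup p i refl

      own-q : own q ≡ nothing
      own-q with q ≟F q
      ... | yes _ = refl
      ... | no n  = ⊥-elim (n refl)

      own-l : ∀ {h} → h ∈ l → own h ≡ just f₁
      own-l {h} i with h ≟F q | h ∈? l | h ∈? r
      ... | yes refl | _ | _ = ⊥-elim (proj₂ (proj₂ uq) i (here refl))
      ... | no _ | yes _ | _ = refl
      ... | no _ | no n | _ = ⊥-elim (n i)

      own-r : ∀ {h} → h ∈ r → own h ≡ just f₂
      own-r {h} i with h ≟F q | h ∈? l | h ∈? r
      ... | yes refl | _ | _ = ⊥-elim (q∉r i)
      ... | no _ | yes j | _ = ⊥-elim (proj₂ (proj₂ uq) j (there i))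
      ... | no _ | no _ | yes _ = refl
      ... | no _ | no _ | no n = ⊥-elim (n i)

      own-other : ∀ {h} → h ∉ inner f₁ f₂ → own h ≡ owner h
      own-other {h} n with h ≟F q | h ∈? l | h ∈? r
      ... | yes refl | _ | _ = ⊥-elim (n q∈)
      ... | no _ | yes i | _ = ⊥-elim (n (l⊆ i))
      ... | no _ | no _ | yes i = ⊥-elim (n (r⊆ i))
      ... | no _ | no _ | no _ = refl

      own-vmap : ∀ v → own (vmap v) ≡ just v
      own-vmap v = trans (own-other (vmap∉inner f v)) (owner-vmap v)

      -- The split reassigns interior vertices only between `f₁` and `f₂`, which are both inside the
      -- domino or both outside.
      own-side : ∀ {h v} → own h ≡ just v → Σ (V G) λ w → owner h ≡ just w × (Inside v → Inside w) × (Inside w → Inside v)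
      own-side {h} eq with h ≟F q | h ∈? l | h ∈? r
      own-side refl | no _ | yes i | _ with pick-one f₁ f₂
      ... | inj₁ p = _ , owner-inner f (l⊆ i) , subst Inside (sym p) , subst Inside p
      ... | inj₂ p = _ , owner-inner f (l⊆ i) , subst Inside (sym p) ∘ same , same′ ∘ subst Inside p
      own-side refl | no _ | no _ | yes i with pick-one f₁ f₂
      ... | inj₁ p = _ , owner-inner f (r⊆ i) , subst Inside (sym p) ∘ same′ , same ∘ subst Inside p
      ... | inj₂ p = _ , owner-inner f (r⊆ i) , subst Inside (sym p) , subst Inside p
      own-side eq | no _ | no _ | no _ = _ , eq , (λ i → i) , (λ i → i)

      private
        flipped : inner f₂ f₁ ≡ reverse r ++ q ∷ reverse l
        flipped = begin
          inner f₂ f₁                        ≡⟨ inner-sym f₁ f₂ f ⟩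
          reverse (inner f₁ f₂)              ≡⟨ cong reverse split ⟩
          reverse (l ++ q ∷ r)               ≡⟨ reverse-++ l (q ∷ r) ⟩
          reverse (q ∷ r) ++ reverse l       ≡⟨ cong (_++ reverse l) (unfold-reverse q r) ⟩
          (reverse r ++ q ∷ []) ++ reverse l ≡⟨ ++-assoc (reverse r) (q ∷ []) (reverse l) ⟩
          reverse r ++ q ∷ reverse l         ∎
          where open ≡-Reasoning

      labelling : Labelling (λ a b → Adj G a b × ¬ SameEdge a b f₁ f₂)
      labelling = record { own = own ; own-vmap = own-vmap ; own-star = star ; own-edge = edge }
        where
        star : ∀ {h v} → own h ≡ just v → h ≡ vmap v ⊎ Σ (V G) λ b → Adj G v b ×
               Σ (List (V H)) λ X → Σ (List (V H)) λ Z → inner v b ≡ X ++ h ∷ Z × All (λ x → own x ≡ just v) X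
        star {h} {v} eq with h ∈? inner f₁ f₂
        ... | no h∉ with Labelling.own-star base-labelling (trans (sym (own-other h∉)) eq)
        ...   | inj₁ e = inj₁ e
        ...   | inj₂ (b , vb , X , Z , sp , ow) = inj₂ (b , vb , X , Z , sp , All.tabulate λ {x} i →
                trans (own-other (λ x∈ → h∉ (case inner-same vb f (on-path (∈-++⁺ˡ i)) x∈ of λ where
                  (inj₁ (refl , refl)) → on-path (∈-++⁺ʳ X (here refl))
                  (inj₂ (refl , refl)) → inner-flip vb (on-path (∈-++⁺ʳ X (here refl)))))) (All.lookup ow i))
          where
          on-path : ∀ {x} → x ∈ X ++ h ∷ Z → x ∈ inner v b
          on-path = subst (_ ∈_) (sym sp)
        star {h} {v} eq | yes h∈ with ∈-++⁻ l (subst (h ∈_) split h∈)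
        ... | inj₂ (here refl) with trans (sym eq) own-q
        ...   | ()
        star {h} {v} eq | yes h∈ | inj₁ i with just-injective (trans (sym eq) (own-l i)) | ∈-∃++ i
        ... | refl | X , Z , refl = inj₂ (f₂ , f , X , Z ++ q ∷ r , trans split (++-assoc X (h ∷ Z) (q ∷ r)) ,
                                          All.tabulate λ j → own-l (∈-++⁺ˡ j))
        star {h} {v} eq | yes h∈ | inj₂ (there i) with just-injective (trans (sym eq) (own-r i)) | ∈-∃++ (∈-reverse⁺ i)
        ... | refl | X , Z , sp = inj₂ (f₁ , symG f , X , Z ++ q ∷ reverse l ,
              trans flipped (trans (cong (_++ q ∷ reverse l) sp) (++-assoc X (h ∷ Z) (q ∷ reverse l))) ,
              All.tabulate λ j → own-r (∈-reverse⁻ r (subst (_ ∈_) (sym sp) (∈-++⁺ˡ j))))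
        edge : ∀ {a b} → Adj G a b × ¬ SameEdge a b f₁ f₂ → Σ (V H) λ h → Σ (V H) λ h′ → own h ≡ just a × own h′ ≡ just b ×
               Adj H h h′ × h ∈ path a b × h′ ∈ path a b
        edge {a} {b} (e , ne) with Labelling.own-edge base-labelling e
        ... | h , h′ , lh , lh′ , hh′ , i , i′ = h , h′ , trans (own-other (off i)) lh , trans (own-other (off i′)) lh′ , hh′ , i , i′
          where
          off : ∀ {x} → x ∈ path a b → x ∉ inner f₁ f₂
          off {x} x∈ x∈f with path-cases {a} {b} x∈
          ... | inj₁ refl = vmap∉inner f _ x∈f
          ... | inj₂ (inj₁ j) = ne (inner-same e f j x∈f)
          ... | inj₂ (inj₂ refl) = vmap∉inner f _ x∈f

      q-near₁ : Σ (V H) λ h → own h ≡ just f₁ × Adj H h q × h ∈ vmap f₁ ∷ l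
      q-near₁ = before (vmap f₁) l (prefix-chain l f split) (own-vmap f₁ ∷ All.tabulate own-l) (λ i → i)
        where
        before : ∀ u L → Chain H u (u ∷ L ++ q ∷ []) q → All (λ x → own x ≡ just f₁) (u ∷ L) →
                 (∀ {v} → v ∈ u ∷ L → v ∈ vmap f₁ ∷ l) → Σ (V H) λ h → own h ≡ just f₁ × Adj H h q × h ∈ vmap f₁ ∷ l
        before u [] (e ◂ one) (p ∷ _) sub = u , p , e , sub (here refl)
        before u (x ∷ L) (e ◂ c) (_ ∷ ps) sub with chain-start c
        ... | refl = before x L c ps (sub ∘ there)

      q-near₂ : Σ (V H) λ h → own h ≡ just f₂ × Adj H q h × h ∈ r ++ vmap f₂ ∷ []
      q-near₂ with chain-split (vmap f₁ ∷ l) {c = q} {Z = r ++ vmap f₂ ∷ []} (path-chain f)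
                     (cong (vmap f₁ ∷_) (trans (cong (_++ vmap f₂ ∷ []) split) (++-assoc l (q ∷ r) (vmap f₂ ∷ []))))
      ... | _ , c = after r c (λ i → i) own-r
        where
        after : ∀ L → Chain H q (q ∷ L ++ vmap f₂ ∷ []) (vmap f₂) → (∀ {v} → v ∈ L ++ vmap f₂ ∷ [] → v ∈ r ++ vmap f₂ ∷ []) →
                (∀ {v} → v ∈ L → own v ≡ just f₂) →
                Σ (V H) λ h → own h ≡ just f₂ × Adj H q h × h ∈ r ++ vmap f₂ ∷ []
        after [] (e ◂ one) sub o = _ , own-vmap f₂ , e , sub (here refl)
        after (x ∷ L) (e ◂ c) sub o with chain-start c
        ... | refl = x , o (here refl) , e , sub (here refl)

-- Extending a placed shape

Edges : {n : ℕ} → List (Fin n × Fin n) → Fin n → Fin n → Set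
Edges es i j = (i , j) ∈ es

insert : {n : ℕ} → (Fin n → Bool) → Fin n → Fin n → Bool
insert Y h v = (v == h) ∨ Y v

insert-old : ∀ {n} {Y : Fin n → Bool} {h v} → Y v ≡ true → insert Y h v ≡ true
insert-old e = ∨⁺ (inj₂ e)

insert-new : ∀ {n} {Y : Fin n → Bool} {h} → insert Y h h ≡ true
insert-new {Y = Y} {h} = ∨⁺ {h == h} {Y h} (inj₁ (==⁺ refl))

insert-false : ∀ {n} {Y : Fin n → Bool} {h v} → Y v ≡ false → v ≢ h → insert Y h v ≡ false
insert-false {h = h} {v} e n with v ≟F h
... | yes p = ⊥-elim (n p)
... | no _  = e

redirected : (Fin 5 → A) → Fin 5 → A → Fin 5 → A
redirected e i h j = if j == i then h else e j

redirected-twice : ∀ (e : Fin 5 → A) i {h q} j → redirected (redirected e i h) i q j ≡ redirected e i q j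
redirected-twice e i j with j ≟F i
... | yes _ = refl
... | no _  = refl

redirected-at : ∀ (e : Fin 5 → A) i {h} → h ≡ redirected e i h i
redirected-at e i with i ≟F i
... | yes _ = refl
... | no n  = ⊥-elim (n refl)

-- u ∷ α ++ q ∷ [] is a path that leaves Y at its first step.
data Segment (H : Graph) (Y : V H → Bool) : V H → List (V H) → V H → Set where
  last : ∀ {u q} → Adj H u q → Y q ≡ false → Segment H Y u [] q
  more : ∀ {u h α q} → Adj H u h → Y h ≡ false → h ∉ α ++ q ∷ [] → Segment H Y h α q → Segment H Y u (h ∷ α) q

segment-insert : ∀ {H Y u α q h} → Segment H Y u α q → h ∉ α ++ q ∷ [] → Segment H (insert Y h) u α q
segment-insert {Y = Y} (last {q = q} a y) n = last a (insert-false {Y = Y} {v = q} y λ { refl → n (here refl) })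
segment-insert {Y = Y} (more {h = g} a y d s) n =
  more a (insert-false {Y = Y} {v = g} y λ { refl → n (here refl) }) d (segment-insert s (n ∘ there))

-- The mark is left out on purpose: all placements in one region share the set and the exits, but
-- which vertex must lie in the marked branch set depends on the exit edge under consideration.
record Placed (H : Graph) (S : Shape) (Y : V H → Bool) (e : Fin 5 → V H) : Set where
  field
    model : Model H (Edges (links S))
  open Model model public
  field
    support : ∀ {h k} → lab h ≡ just k → Y h ≡ true
    exits   : ∀ j → lab (e j) ≡ just (exit S j)

module _ {H : Graph} (symH : Symmetric H) where
  open Placed using (lab; support; exits)

  coarsen-by : ∀ {n n′} {es : List (Fin n × Fin n)} {es′ : List (Fin n′ × Fin n′)} {f : Fin n → Fin n′} →
               Coarsens es es′ f → {R : Fin n′ → Fin n′ → Set} → (∀ {a b} → R a b → Linked-by es′ a b) →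
               Model H (Edges es) → Model H R
  coarsen-by {n} {n′} {es} {es′} {f} (coarse fibres covers) {R} sub = coarsen symH (just ∘ f)
    (λ {i} {j} p q → link (just-injective p) (just-injective q)) (λ r → case sub r of λ where
      (inj₁ e) → cover e
      (inj₂ e) → let i , j , fi , fj , r = cover e in j , i , fj , fi , [ inj₂ , inj₁ ]′ r)
    where
    link : ∀ {i j a} → f i ≡ a → f j ≡ a → Linkage (Edges es) (just ∘ f) a i j
    link {i} {j} p q with fibres i j (trans p (sym q))
    ... | inj₁ refl = stop (cong just q)
    ... | inj₂ (inj₁ r) = move (cong just p) r (stop (cong just q))
    ... | inj₂ (inj₂ (l , e , r , r′)) = move (cong just p) r (move (cong just (trans (sym e) p)) r′ (stop (cong just q)))
    cover : ∀ {a b} → (a , b) ∈ es′ → ∃₂ λ i j → just (f i) ≡ just a × just (f j) ≡ just b × (Edges es i j ⊎ Edges es j i)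
    cover e = search (All.lookup covers e) {λ i → i}
      where
      search : ∀ {a b L} → Any (λ (i , j) → (f i ≡ a × f j ≡ b) ⊎ (f i ≡ b × f j ≡ a)) L → {_ : ∀ {x} → x ∈ L → x ∈ es} →
               ∃₂ λ i j → just (f i) ≡ just a × just (f j) ≡ just b × (Edges es i j ⊎ Edges es j i)
      search (here (inj₁ (p , q))) {s} = _ , _ , cong just p , cong just q , inj₁ (s (here refl))
      search (here (inj₂ (p , q))) {s} = _ , _ , cong just q , cong just p , inj₂ (s (here refl))
      search (there a) {s} = search a {s ∘ there}

  module _ {S : Shape} {Y : V H → Bool} {e : Fin 5 → V H} where

    weaken : ∀ {Y′} → (∀ {v} → Y v ≡ true → Y′ v ≡ true) → Placed H S Y e → Placed H S Y′ e
    weaken sub P = record { model = Placed.model P ; support = sub ∘ support P ; exits = exits P }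

    at-exits : ∀ {e′} → (∀ j → e j ≡ e′ j) → Placed H S Y e → Placed H S Y e′
    at-exits {e′} eq P = record { model = Placed.model P ; support = support P
                                ; exits = λ j → trans (cong (lab P) (sym (eq j))) (exits P j) }

    absorb : (P : Placed H S Y e) → ∀ {u h k} → lab P u ≡ just k → Y h ≡ false → Adj H u h →
             Σ (Placed H S (insert Y h) e) λ P′ → lab P′ h ≡ just k × (∀ {v j} → lab P v ≡ just j → lab P′ v ≡ just j)
    absorb P {u} {h} {k} lu yh a = record
      { model = record { lab = lab′ ; conn = conn′ ; edge = edge′ }
      ; support = support′ ; exits = λ j → keep (exits P j) } , new , keep
      where
      lab′ : V H → Maybe (Fin (order S))
      lab′ v with v ≟F h
      ... | yes _ = just k
      ... | no _  = lab P v
      keep : ∀ {v j} → lab P v ≡ just j → lab′ v ≡ just j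
      keep {v} l with v ≟F h
      ... | no _ = l
      ... | yes refl = ⊥-elim (true≢false (support P l) yh)
      new : lab′ h ≡ just k
      new with h ≟F h
      ... | yes _ = refl
      ... | no n  = ⊥-elim (n refl)
      F : Fin (order S) → V H → Set
      F j v = lab′ v ≡ just j
      to-old : ∀ {j v} → F j v → Σ (V H) λ v′ → lab P v′ ≡ just j × Within H (F j) v v′
      to-old {j} {v} l with v ≟F h
      ... | no _ = v , l , here (keep l)
      to-old {j} {v} refl | yes refl = u , lu , go new (symH a) (here (keep lu))
      conn′ : ∀ {j v w} → F j v → F j w → Within H (F j) v w
      conn′ {_} {v} {w} p q with to-old {v = v} p | to-old {v = w} q
      ... | v′ , l , α | w′ , l′ , β = within-trans α (within-trans (within-map (λ {x} → keep {x}) (Placed.conn P l l′)) (within-sym symH β))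
      edge′ : ∀ {i j} → Edges (links S) i j → ∃₂ λ v w → F i v × F j w × Adj H v w
      edge′ r with Placed.edge P r
      ... | v , w , l , l′ , vw = v , w , keep l , keep l′ , vw
      support′ : ∀ {v j} → lab′ v ≡ just j → insert Y h v ≡ true
      support′ {v} l with v ≟F h
      ... | yes _ = refl
      ... | no _ = support P l

    advance-exit : (P : Placed H S Y e) → ∀ i {h} → Y h ≡ false → Adj H (e i) h →
                   Σ (Placed H S (insert Y h) (redirected e i h)) λ P′ → ∀ {v j} → lab P v ≡ just j → lab P′ v ≡ just j
    advance-exit P i {h} yh a with absorb P (exits P i) yh a
    ... | P′ , new , keep = record { model = Placed.model P′ ; support = support P′ ; exits = exits′ } , keep
      where
      exits′ : ∀ j → lab P′ (redirected e i h j) ≡ just (exit S j)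
      exits′ j with j ≟F i
      ... | yes refl = new
      ... | no _ = exits P′ j

    attached : (P : Placed H S Y e) → ∀ {u h k} → lab P u ≡ just k → Y h ≡ false → Adj H u h →
               Σ (Placed H (attach S k) (insert Y h) e) λ P′ →
                 lab P′ h ≡ just zero × (∀ {v j} → lab P v ≡ just j → lab P′ v ≡ just (suc j))
    attached P {u} {h} {k} lu yh a = record
      { model = record { lab = lab′ ; conn = conn′ ; edge = edge′ }
      ; support = support′ ; exits = λ j → keep (exits P j) } , new , keep
      where
      lab′ : V H → Maybe (Fin (suc (order S)))
      lab′ v with v ≟F h
      ... | yes _ = just zero
      ... | no _  = mapMaybe suc (lab P v)
      keep : ∀ {v j} → lab P v ≡ just j → lab′ v ≡ just (suc j)
      keep {v} l with v ≟F h
      ... | no _ rewrite l = refl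
      ... | yes refl = ⊥-elim (true≢false (support P l) yh)
      new : lab′ h ≡ just zero
      new with h ≟F h
      ... | yes _ = refl
      ... | no n  = ⊥-elim (n refl)
      F : Fin (suc (order S)) → V H → Set
      F j v = lab′ v ≡ just j
      only : ∀ {v} → F zero v → v ≡ h
      only {v} l with v ≟F h
      ... | yes p = p
      ... | no _ with lab P v
      only {v} () | no _ | just _
      only {v} () | no _ | nothing
      old′ : ∀ {v j} → F (suc j) v → lab P v ≡ just j
      old′ {v} l with v ≟F h
      old′ {v} () | yes _
      ... | no _ with lab P v
      old′ {v} refl | no _ | just _ = refl
      conn′ : ∀ {j v w} → F j v → F j w → Within H (F j) v w
      conn′ {zero} {v} {w} p q with only {v} p | only {w} q
      ... | refl | refl = here p
      conn′ {suc j} {v} {w} p q = within-map (λ {x} → keep {x}) (Placed.conn P (old′ {v} p) (old′ {w} q))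
      edge′ : ∀ {i′ j′} → Edges (links (attach S k)) i′ j′ → ∃₂ λ v w → F i′ v × F j′ w × Adj H v w
      edge′ (here refl) = h , u , new , keep lu , symH a
      edge′ (there r) with ∈-map⁻ (λ (i , j) → suc i , suc j) r
      ... | _ , r′ , refl with Placed.edge P r′
      ...   | v , w , l , l′ , vw = v , w , keep l , keep l′ , vw
      support′ : ∀ {v j} → lab′ v ≡ just j → insert Y h v ≡ true
      support′ {v} l with v ≟F h
      ... | yes _ = refl
      ... | no _ with lab P v in eq
      ...   | just _ = support P eq
      support′ {v} () | no _ | nothing

    extend-exit : (P : Placed H S Y e) → ∀ i {h} → Y h ≡ false → Adj H (e i) h →
                  Σ (Placed H (extend S i) (insert Y h) (redirected e i h)) λ P′ →
                    lab P′ h ≡ just zero × (∀ {v j} → lab P v ≡ just j → lab P′ v ≡ just (suc j))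
    extend-exit P i {h} yh a with attached P (exits P i) yh a
    ... | P′ , new , keep = record { model = Placed.model P′ ; support = support P′ ; exits = exits′ } , new , keep
      where
      exits′ : ∀ j → lab P′ (redirected e i h j) ≡ just (exit (extend S i) j)
      exits′ j with j ≟F i
      ... | yes refl = new
      ... | no _ = exits P′ j

  private
    start : ∀ {Y e i h α q} → Segment H Y h α q → h ∉ α ++ q ∷ [] → Segment H (insert Y h) (redirected e i h i) α q
    start {Y} {e} {i} {h} {α} {q} s n = subst (λ u → Segment H (insert Y h) u α q) (redirected-at e i) (segment-insert s n)

    grown : ∀ {n} {Y Y′ : Fin n → Bool} {h} → (∀ {v} → Y v ≡ true → Y′ v ≡ true) → Y′ h ≡ true →
            ∀ {v} → insert Y h v ≡ true → Y′ v ≡ true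
    grown {Y = Y} {h = h} sub y′ {v} e with v ≟F h
    ... | yes refl = y′
    ... | no _ = sub e

  slide : ∀ {S Y e} α (P : Placed H S Y e) i {q Y′} → Segment H Y (e i) α q → (∀ {v} → Y v ≡ true → Y′ v ≡ true) →
          (∀ {v} → v ∈ α ++ q ∷ [] → Y′ v ≡ true) →
          Σ (Placed H S Y′ (redirected e i q)) λ P′ → ∀ {v j} → lab P v ≡ just j → lab P′ v ≡ just j
  slide [] P i (last a y) sub new with advance-exit P i y a
  ... | P′ , keep = weaken (grown sub (new (here refl))) P′ , keep
  slide {e = e} (h ∷ α) P i (more a y n s) sub new with advance-exit P i y a
  ... | P′ , keep with slide α P′ i (start {e = e} {i} s n) (grown sub (new (here refl))) (new ∘ there)
  ...   | P″ , keep′ = at-exits (redirected-twice e i) P″ , λ l → keep′ (keep l)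

  joined : ∀ {S Y e} α (P : Placed H S Y e) i {p q Y′} → lab P p ≡ just (mark S) → Adj H p q → Segment H Y (e i) α q →
           (∀ {v} → Y v ≡ true → Y′ v ≡ true) → (∀ {v} → v ∈ α ++ q ∷ [] → Y′ v ≡ true) →
           Σ (Placed H (join S i) Y′ (redirected e i q)) λ P′ → ∀ {v j} → lab P v ≡ just j → lab P′ v ≡ just (suc j)
  joined {S} [] P i {p} {q} lp pq (last a y) sub new with extend-exit P i y a
  ... | P′ , lq , keep = weaken (grown sub (new (here refl))) (record
    { model = record { lab = lab P′ ; conn = Placed.conn P′ ; edge = λ where
        (here refl) → q , p , lq , keep lp , symH pq
        (there r) → Placed.edge P′ r }
    ; support = support P′ ; exits = exits P′ }) , keep
  joined {e = e} (h ∷ α) P i lp pq (more a y n s) sub new with advance-exit P i y a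
  ... | P′ , keep with joined α P′ i (keep lp) pq (start {e = e} {i} s n) (grown sub (new (here refl))) (new ∘ there)
  ...   | P″ , keep′ = at-exits (redirected-twice e i) P″ , λ l → keep′ (keep l)

  -- The mark can be put at any chosen `w` on the stretch before `q`: the vertices before `w` join
  -- the branch set of the old exit, those after it join the new branch set of `w`, and `q` is the
  -- landing point.
  jumped : ∀ {S Y e} α (P : Placed H S Y e) i {p q Y′ w} → lab P p ≡ just (mark S) → Adj H p q → Segment H Y (e i) α q →
           (∀ {v} → Y v ≡ true → Y′ v ≡ true) → (∀ {v} → v ∈ α ++ q ∷ [] → Y′ v ≡ true) → w ∈ α →
           Σ (Placed H (jump S i) Y′ (redirected e i q)) λ P′ → lab P′ w ≡ just (mark (jump S i))
  jumped {e = e} (h ∷ α) P i lp pq (more a y n s) sub new (here refl) with extend-exit P i y a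
  ... | P′ , lh , keep with joined α P′ i (keep lp) pq (start {e = e} {i} s n) (grown sub (new (here refl))) (new ∘ there)
  ...   | P″ , keep′ = record { model = Placed.model P″ ; support = support P″
                              ; exits = exits (at-exits (redirected-twice e i) P″) } , keep′ lh
  jumped {e = e} (h ∷ α) P i lp pq (more a y n s) sub new (there w∈) with advance-exit P i y a
  ... | P′ , keep with jumped α P′ i (keep lp) pq (start {e = e} {i} s n) (grown sub (new (here refl))) (new ∘ there) w∈
  ...   | P″ , lw = record { model = Placed.model P″ ; support = support P″
                           ; exits = exits (at-exits (redirected-twice e i) P″) } , lw

-- Regions of H

module Host {G H : Graph} (cubicG : IsCubic G) (cubicH : IsCubic H) (F : Frame G) (η : Embedding G H) where
  open Frame F public
  open Paths (proj₁ cubicG) (proj₁ cubicH) η public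

  x : Fin 5 → V G
  x j = d (corner j)

  Inside : V G → Set
  Inside v = Σ (Fin 7) λ i → v ≡ d i

  inside? : ∀ v → Dec (Inside v)
  inside? v = Finₚ.any? λ i → v ≟F d i

  open Owner Inside inside? public renaming (owner to own₀)

  z-outside : ∀ j → ¬ Inside (z j)
  z-outside j (i , e) = z-out j i e

  exit-edge : ∀ {a b} → Adj G a b → Inside a → ¬ Inside b → Σ (Fin 5) λ j → a ≡ x j × b ≡ z j
  exit-edge e (i , refl) o with z-only e (λ k p → o (k , p))
  ... | j , refl , p = j , refl , p

  own₀-g : ∀ j {h} → h ∈ inner (x j) (z j) → own₀ h ≡ just (z j)
  own₀-g j h∈ = trans (owner-inner (z-adj j) h∈)
                      (cong just (pick-outer (corner j , refl) (z-outside j)))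

  -- A vertex set of H that contains the image of the domino, avoids the rest of η(G) except for
  -- initial segments of the five paths leaving the domino; the j-th path leaves it along e j, n j.
  record Region : Set where
    field
      Y      : V H → Bool
      pre    : Fin 5 → List (V H)
      e n    : Fin 5 → V H
      post   : Fin 5 → List (V H)
      split  : ∀ j → path (x j) (z j) ≡ pre j ++ e j ∷ n j ∷ post j
      inY    : ∀ j → All (λ h → Y h ≡ true) (pre j ++ e j ∷ [])
      outY   : ∀ j → All (λ h → Y h ≡ false) (n j ∷ post j)
      within : ∀ {h v} → own₀ h ≡ just v → Inside v → Y h ≡ true
      beyond : ∀ {h v} → own₀ h ≡ just v → ¬ Inside v → Y h ≡ true → Σ (Fin 5) λ j → h ∈ inner (x j) (z j)

  module RegionFacts (R : Region) where
    open Region R public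

    exit-adj : ∀ j → Adj H (e j) (n j)
    exit-adj j = chain-consec (path-chain (z-adj j)) (pre j , post j , split j)

    off-Y : ∀ {a b h} → Adj G a b → ¬ Inside a → ¬ Inside b → h ∈ path a b → Y h ≡ false
    off-Y {a} {b} {h} ab oa ob h∈ = ≢true⇒false λ y → case path-cases {a} {b} h∈ of λ where
        (inj₁ refl) → vmap∉inner (z-adj _) a (proj₂ (beyond (owner-vmap a) oa y))
        (inj₂ (inj₂ refl)) → vmap∉inner (z-adj _) b (proj₂ (beyond (owner-vmap b) ob y))
        (inj₂ (inj₁ i)) → inside-edge i (beyond (owner-inner ab i) (outer-pick (pick-one a b)) y)
      where
      outer-pick : pick a b ≡ a ⊎ pick a b ≡ b → ¬ Inside (pick a b)
      outer-pick (inj₁ e) i = oa (subst Inside e i)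
      outer-pick (inj₂ e) i = ob (subst Inside e i)
      inside-edge : h ∈ inner a b → (Σ (Fin 5) λ j → h ∈ inner (x j) (z j)) → ⊥
      inside-edge i (j , i′) with inner-same ab (z-adj j) i i′
      ... | inj₁ (refl , refl) = oa (_ , refl)
      ... | inj₂ (refl , refl) = ob (_ , refl)

    beyond-path : ∀ j {h} → h ∈ n j ∷ post j → h ≡ vmap (z j) ⊎ h ∈ inner (x j) (z j)
    beyond-path j {h} h∈ with path-cases {x j} {z j} (subst (h ∈_) (sym (split j)) (∈-++⁺ʳ (pre j) (there h∈)))
    ... | inj₁ refl = ⊥-elim (true≢false (within (owner-vmap (x j)) (_ , refl)) (All.lookup (outY j) h∈))
    ... | inj₂ (inj₁ i) = inj₂ i
    ... | inj₂ (inj₂ e) = inj₁ e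

    still-ahead : ∀ j {h} → h ∈ path (x j) (z j) → Y h ≡ false → h ∈ n j ∷ post j
    still-ahead j {h} h∈ y with ∈-++⁻ (pre j) (subst (h ∈_) (split j) h∈)
    ... | inj₁ i = ⊥-elim (true≢false (All.lookup (Allₚ.++⁻ˡ (pre j) (inY j)) i) y)
    ... | inj₂ (here refl) = ⊥-elim (true≢false (All.head (Allₚ.++⁻ʳ (pre j) (inY j))) y)
    ... | inj₂ (there i) = i

    rest-chain : ∀ j → Chain H (n j) (n j ∷ post j) (vmap (z j))
    rest-chain j with chain-split (pre j) (path-chain (z-adj j)) (split j)
    ... | _ , (_ ◂ c) with chain-start c
    ...   | refl = c

    ahead-unique : ∀ j → Unique (n j ∷ post j)
    ahead-unique j with proj₁ (proj₂ (unique-++⁻ (pre j) (subst Unique (split j) (path-unique (z-adj j)))))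
    ... | _ ∷ u = u

  -- The labelling used outside a possibly larger set `Y′`; by `fresh` the enlargement costs no
  -- labelled vertex. It is used with `Y` itself and with one unlabelled vertex `q` added.
  record Backdrop (R : Region) (Y′ : V H → Bool) : Set₁ where
    open Region R
    field
      Retained  : V G → V G → Set
      labelling : Labelling Retained
    open Labelling labelling public
    field
      retained-adj : ∀ {a b} → Retained a b → Adj G a b
      larger : ∀ {h} → Y h ≡ true → Y′ h ≡ true
      fresh  : ∀ {h v} → own h ≡ just v → Y h ≡ false → Y′ h ≡ false
      on-g   : ∀ j {h} → h ∈ inner (x j) (z j) → own h ≡ just (z j)

  -- The graph with a shape in place of the domino. Indices `inj₂ v` with `v` in the domino receive
  -- empty branch sets and occur in no edge; `Extra` will hold the two edges at a vertex that has
  -- landed on an edge outside the domino.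
  data Glued {k : ℕ} (es : List (Fin k × Fin k)) (ex : Fin 5 → Fin k) (Retained : V G → V G → Set)
             (Extra : Fin k → V G → Set) : Fin k ⊎ V G → Fin k ⊎ V G → Set where
    left  : ∀ {i j} → (i , j) ∈ es → Glued es ex Retained Extra (inj₁ i) (inj₁ j)
    cross : ∀ j → Glued es ex Retained Extra (inj₁ (ex j)) (inj₂ (z j))
    right : ∀ {a b} → Retained a b → ¬ Inside a → ¬ Inside b → Glued es ex Retained Extra (inj₂ a) (inj₂ b)
    extra : ∀ {i a} → Extra i a → Glued es ex Retained Extra (inj₁ i) (inj₂ a)

  module Gluing (R : Region) {Y′ : V H → Bool} (B : Backdrop R Y′) {S : Shape} (P : Placed H S Y′ (Region.e R))
                (Extra : Fin (order S) → V G → Set)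
                (witness : ∀ {i a} → Extra i a → ¬ Inside a × Σ (V H) λ u → Σ (V H) λ h →
                           Placed.lab P u ≡ just i × Backdrop.own B h ≡ just a × Y′ h ≡ false × Adj H u h) where
    open RegionFacts R
    open Backdrop B
    open Placed P using (support; exits) renaming (lab to labP; conn to connP; edge to edgeP)

    I : Set
    I = Fin (order S) ⊎ V G

    outer : Maybe (V G) → Maybe I
    outer nothing = nothing
    outer (just v) with inside? v
    ... | yes _ = nothing
    ... | no _  = just (inj₂ v)

    lab : V H → Maybe I
    lab h = if Y′ h then mapMaybe inj₁ (labP h) else outer (own h)

    lab-left : ∀ {h i} → labP h ≡ just i → lab h ≡ just (inj₁ i)
    lab-left l rewrite support l | l = refl

    lab-right : ∀ {h v} → Y′ h ≡ false → own h ≡ just v → ¬ Inside v → lab h ≡ just (inj₂ v)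
    lab-right {h} {v} y o out rewrite y | o with inside? v
    ... | yes i = ⊥-elim (out i)
    ... | no _  = refl

    outer⁻ : ∀ m {v} → outer m ≡ just (inj₂ v) → m ≡ just v × ¬ Inside v
    outer⁻ (just v) e with inside? v
    outer⁻ (just v) refl | no o = refl , o

    outer-left : ∀ m {i} → outer m ≢ just (inj₁ i)
    outer-left (just v) e with inside? v
    outer-left (just v) () | yes _
    outer-left (just v) () | no _

    left⁻ : ∀ {h i} → lab h ≡ just (inj₁ i) → labP h ≡ just i
    left⁻ {h} e with Y′ h
    ... | false = ⊥-elim (outer-left (own h) e)
    ... | true with labP h
    left⁻ refl | true | just i = refl

    right⁻ : ∀ {h v} → lab h ≡ just (inj₂ v) → Y′ h ≡ false × own h ≡ just v × ¬ Inside v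
    right⁻ {h} e with Y′ h
    ... | false = refl , outer⁻ (own h) e
    ... | true with labP h
    right⁻ () | true | just _
    right⁻ () | true | nothing

    Fibre : I → V H → Set
    Fibre i h = lab h ≡ just i

    smaller : ∀ {h} → Y′ h ≡ false → Y h ≡ false
    smaller y′ = ≢true⇒false λ y → true≢false (larger y) y′

    ahead-fibre : ∀ j → All (Fibre (inj₂ (z j))) (n j ∷ post j)
    ahead-fibre j = All.tabulate λ {h} i → let o = own-ahead i in
      lab-right (fresh o (All.lookup (outY j) i)) o (z-outside j)
      where
      own-ahead : ∀ {h} → h ∈ n j ∷ post j → own h ≡ just (z j)
      own-ahead i with beyond-path j i
      ... | inj₁ refl = own-vmap (z j)
      ... | inj₂ p = on-g j p

    -- On an exit path, everything still ahead of the region belongs to `z j` and leads to its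
    -- branch vertex. On any other path with an end `v`, the piece from `vmap v` to `h` belongs to
    -- `v` and avoids the region.
    to-branch : ∀ {h v} → Fibre (inj₂ v) h → Within H (Fibre (inj₂ v)) h (vmap v)
    to-branch {h} {v} l with right⁻ {h} l
    ... | y′ , o , out with own-star o
    ...   | inj₁ refl = here l
    ...   | inj₂ (b , vb , X , Z , sp , ows) with inside? b
    ...     | yes ib with exit-edge (symG vb) ib out
    ...       | j , refl , refl = within-trans (within-sym symH (reach h∈)) (reach (chain-last (rest-chain j)))
      where
      h∈ : h ∈ n j ∷ post j
      h∈ = still-ahead j (inner⊆path {x j} {z j} (inner-flip vb (subst (h ∈_) (sym sp) (∈-++⁺ʳ X (here refl))))) (smaller y′)
      reach : ∀ {w} → w ∈ n j ∷ post j → Within H (Fibre (inj₂ (z j))) (n j) w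
      reach = chain-within-∈ (rest-chain j) (ahead-fibre j)
    to-branch {h} {v} l | y′ , o , out | inj₂ (b , vb , X , Z , sp , ows) | no ob =
      within-sym symH (chain-within-∈ (prefix-chain X vb sp) (Allₚ.++⁺ {xs = vmap v ∷ X}
        (fib (here refl) (own-vmap v) ∷ All.tabulate λ {w} i →
          fib (inner⊆path {v} {b} (subst (w ∈_) (sym sp) (∈-++⁺ˡ i))) (All.lookup ows i)) (l ∷ []))
        (there (∈-++⁺ʳ X (here refl))))
      where
      fib : ∀ {w} → w ∈ path v b → own w ≡ just v → Fibre (inj₂ v) w
      fib w∈ ow = lab-right (fresh ow (off-Y vb out ob w∈)) ow out

    glued : Model H (Glued (links S) (exit S) Retained Extra)
    glued = record { lab = lab ; conn = conn′ ; edge = edge′ }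
      where
      conn′ : ∀ {i h h′} → Fibre i h → Fibre i h′ → Within H (Fibre i) h h′
      conn′ {inj₁ i} {h} {h′} p q = within-map (λ {w} → lab-left {w}) (connP (left⁻ {h} p) (left⁻ {h′} q))
      conn′ {inj₂ v} p q = within-trans (to-branch p) (within-sym symH (to-branch q))
      edge′ : ∀ {i j} → Glued (links S) (exit S) Retained Extra i j → ∃₂ λ h h′ → Fibre i h × Fibre j h′ × Adj H h h′
      edge′ (left r) with edgeP r
      ... | h , h′ , l , l′ , a = h , h′ , lab-left l , lab-left l′ , a
      edge′ (cross j) = e j , n j , lab-left (exits j) , All.head (ahead-fibre j) , exit-adj j
      edge′ (right {a} {b} r oa ob) with own-edge r
      ... | h , h′ , l , l′ , hh′ , h∈ , h′∈ = h , h′ , fib l oa h∈ , fib l′ ob h′∈ , hh′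
        where
        fib : ∀ {v w} → own w ≡ just v → ¬ Inside v → w ∈ path a b → Fibre (inj₂ v) w
        fib o out w∈ = lab-right (fresh o (off-Y (retained-adj r) oa ob w∈)) o out
      edge′ (extra r) with witness r
      ... | out , u , h , l , o , y , a = u , h , lab-left l , lab-right y o out , a

  base-backdrop : (R : Region) → Backdrop R (Region.Y R)
  base-backdrop R = record
    { labelling = base-labelling ; retained-adj = λ e → e
    ; larger = λ e → e ; fresh = λ _ e → e ; on-g = own₀-g }

  module Subdividing (R : Region) {f₁ f₂ : V G} (f : Adj G f₁ f₂) (o₁ : ¬ Inside f₁) (o₂ : ¬ Inside f₂)
                     {q : V H} {l r : List (V H)} (sp : inner f₁ f₂ ≡ l ++ q ∷ r) where
    open RegionFacts R
    module M = Marked f (λ i → ⊥-elim (o₁ i)) (λ i → ⊥-elim (o₂ i)) sp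

    marked-backdrop : Backdrop R (insert Y q)
    marked-backdrop = record
      { labelling = M.labelling ; retained-adj = proj₁
      ; larger = λ {h} → insert-old {Y = Y} {q} {h}
      ; fresh = λ {h} {v} o y → insert-false {Y = Y} {q} {h} y λ { refl → case trans (sym o) M.own-q of λ () }
      ; on-g = λ j {h} i → trans (M.own-other (λ i′ → case inner-same f (z-adj j) i′ i of λ where
          (inj₁ (refl , _)) → o₁ (_ , refl)
          (inj₂ (_ , refl)) → o₂ (_ , refl))) (own₀-g j i) }

  segment : ∀ {Y u t W q} α → Chain H u (u ∷ α ++ q ∷ W) t → All (λ h → Y h ≡ false) (α ++ q ∷ W) →
            Unique (α ++ q ∷ W) → Segment H Y u α q
  segment [] (a ◂ c) (y ∷ _) _ with chain-start c
  ... | refl = last a y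
  segment {W = W} {q} (h ∷ α) (a ◂ c) (y ∷ ys) (p ∷ u) with chain-start c
  ... | refl = more a y (λ i → All.lookup p (case ∈-++⁻ α i of λ where
                 (inj₁ j) → ∈-++⁺ˡ j
                 (inj₂ (here refl)) → ∈-++⁺ʳ α (here refl)) refl) (segment α c ys u)

  module Growing (R : Region) where
    open RegionFacts R

    enclose : ∀ q → own₀ q ≡ nothing → Region
    enclose q free = record
      { Y = insert Y q ; pre = pre ; e = e ; n = n ; post = post ; split = split
      ; inY = λ j → All.map (λ {h} → insert-old {Y = Y} {q} {h}) (inY j)
      ; outY = λ j → All.tabulate λ {h} i → insert-false {Y = Y} {q} {h} (All.lookup (outY j) i) λ { refl →
          free⇒∉ (z-adj j) free (subst (h ∈_) (sym (split j)) (∈-++⁺ʳ (pre j) (there i))) }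
      ; within = λ {h} o i → insert-old {Y = Y} {q} {h} (within o i)
      ; beyond = λ {h} o out y → beyond o out (old-member h o y) }
      where
      old-member : ∀ h {v} → own₀ h ≡ just v → insert Y q h ≡ true → Y h ≡ true
      old-member h o y with h ≟F q
      ... | no _ = y
      old-member h o y | yes refl with trans (sym o) free
      ... | ()

    module Along (i : Fin 5) (α : List (V H)) (q n′ : V H) (W : List (V H)) (ahead : n i ∷ post i ≡ α ++ q ∷ n′ ∷ W) where

      new : List (V H)
      new = α ++ q ∷ []

      Y⁺ : V H → Bool
      Y⁺ h = ⌊ h ∈? new ⌋ ∨ Y h

      Y⁺-old : ∀ {h} → Y h ≡ true → Y⁺ h ≡ true
      Y⁺-old {h} y = ∨⁺ {⌊ h ∈? new ⌋} (inj₂ y)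

      Y⁺-new : ∀ {h} → h ∈ new → Y⁺ h ≡ true
      Y⁺-new {h} h∈ with h ∈? new
      ... | yes _ = refl
      ... | no m  = ⊥-elim (m h∈)

      Y⁺-false : ∀ {h} → h ∉ new → Y h ≡ false → Y⁺ h ≡ false
      Y⁺-false {h} m y with h ∈? new
      ... | yes h∈ = ⊥-elim (m h∈)
      ... | no _   = y

      Y⁺-cases : ∀ {h} → Y⁺ h ≡ true → h ∈ new ⊎ Y h ≡ true
      Y⁺-cases {h} y with h ∈? new
      ... | yes h∈ = inj₁ h∈
      ... | no _   = inj₂ y

      ahead′ : n i ∷ post i ≡ new ++ n′ ∷ W
      ahead′ = trans ahead (sym (++-assoc α (q ∷ []) (n′ ∷ W)))

      new-ahead : ∀ {h} → h ∈ new → h ∈ n i ∷ post i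
      new-ahead {h} h∈ = subst (h ∈_) (sym ahead′) (∈-++⁺ˡ h∈)

      later : ∀ {h} → h ∈ n′ ∷ W → h ∈ n i ∷ post i × h ∉ new
      later {h} h∈ = subst (h ∈_) (sym ahead′) (∈-++⁺ʳ new h∈) ,
        λ m → proj₂ (proj₂ (unique-++⁻ new (subst Unique ahead′ (ahead-unique i)))) m h∈

      -- The path still has `n′` after `q`, so its end `vmap (z i)` lies beyond the newly enclosed
      -- stretch.
      new-inner : ∀ {h} → h ∈ new → h ∈ inner (x i) (z i)
      new-inner {h} h∈ with beyond-path i (new-ahead h∈)
      ... | inj₂ p = p
      ... | inj₁ refl = ⊥-elim (proj₂ (later last∈) h∈)
        where
        end : ∀ {u t} L → Chain H u (L ++ n′ ∷ W) t → t ∈ n′ ∷ W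
        end L c with chain-split L {c = n′} {Z = W} c refl
        ... | _ , c′ = chain-last c′
        last∈ : vmap (z i) ∈ n′ ∷ W
        last∈ = end new (subst (λ L → Chain H (n i) L (vmap (z i))) ahead′ (rest-chain i))

      segment-ahead : Segment H Y (e i) α q
      segment-ahead = segment α (subst (λ L → Chain H (e i) (e i ∷ L) (vmap (z i))) ahead (exit-adj i ◂ rest-chain i))
                        (subst (All _) ahead (outY i)) (subst Unique ahead (ahead-unique i))

      grown : Region
      grown = record
        { Y = Y⁺ ; pre = redirected pre i (pre i ++ e i ∷ α) ; e = redirected e i q ; n = redirected n i n′
        ; post = redirected post i W ; split = split⁺ ; inY = inY⁺ ; outY = outY⁺
        ; within = λ o p → Y⁺-old (within o p)
        ; beyond = λ o out y → case Y⁺-cases y of λ where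
            (inj₁ h∈) → i , new-inner h∈
            (inj₂ y′) → beyond o out y′ }
        where
        split⁺ : ∀ j → path (x j) (z j) ≡ redirected pre i (pre i ++ e i ∷ α) j ++ redirected e i q j ∷ redirected n i n′ j ∷ redirected post i W j
        split⁺ j with j ≟F i
        ... | no _ = split j
        ... | yes refl = trans (split i) (trans (cong (λ L → pre i ++ e i ∷ L) ahead)
                           (sym (++-assoc (pre i) (e i ∷ α) (q ∷ n′ ∷ W))))
        inY⁺ : ∀ j → All (λ h → Y⁺ h ≡ true) (redirected pre i (pre i ++ e i ∷ α) j ++ redirected e i q j ∷ [])
        inY⁺ j with j ≟F i
        ... | no _ = All.map Y⁺-old (inY j)
        ... | yes refl = Allₚ.++⁺ (Allₚ.++⁺ (All.map Y⁺-old (Allₚ.++⁻ˡ (pre i) (inY i)))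
                           (Y⁺-old (All.head (Allₚ.++⁻ʳ (pre i) (inY i))) ∷ All.tabulate λ k → Y⁺-new (∈-++⁺ˡ k)))
                           (Y⁺-new (∈-++⁺ʳ α (here refl)) ∷ [])
        outY⁺ : ∀ j → All (λ h → Y⁺ h ≡ false) (redirected n i n′ j ∷ redirected post i W j)
        outY⁺ j with j ≟F i
        ... | yes refl = All.tabulate λ k → let k′ , m = later k in Y⁺-false m (All.lookup (outY i) k′)
        ... | no j≢i = All.tabulate λ {h} k → Y⁺-false (apart k) (All.lookup (outY j) k)
          where
          apart : ∀ {h} → h ∈ n j ∷ post j → h ∉ new
          apart k m with beyond-path j k
          ... | inj₁ refl = vmap∉inner (z-adj i) (z j) (new-inner m)
          ... | inj₂ p with inner-same (z-adj j) (z-adj i) p (new-inner m)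
          ...   | inj₁ (eq , _) = j≢i (corner-injective j i (d-inj eq))
          ...   | inj₂ (eq , _) = z-out i (corner j) (sym eq)

    split-ahead : ∀ i {q} → q ∈ inner (x i) (z i) → Y q ≡ false →
                  Σ (List (V H)) λ α → Σ (V H) λ n′ → Σ (List (V H)) λ W → n i ∷ post i ≡ α ++ q ∷ n′ ∷ W
    split-ahead i {q} q∈ y with ∈-∃++ (still-ahead i (inner⊆path {x i} {z i} q∈) y)
    ... | α , n′ ∷ W , eq = α , n′ , W , eq
    ... | α , [] , eq = ⊥-elim (vmap∉inner (z-adj i) (z i) (subst (_∈ inner (x i) (z i)) q≡ q∈))
      where
      q≡ : q ≡ vmap (z i)
      q≡ = ∷ʳ-injectiveʳ (pre i ++ e i ∷ α) (vmap (x i) ∷ inner (x i) (z i))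
             (trans (++-assoc (pre i) (e i ∷ α) (q ∷ [])) (trans (cong (λ L → pre i ++ e i ∷ L) (sym eq)) (sym (split i))))

-- Leaving the domino

abstract
  petersen-edges : ∀ a b → Adj Petersen a b → Linked-by petersenList a b
  petersen-edges = toWitness {a? = Finₚ.all? λ a → Finₚ.all? λ b →
    (petersenAdj a b Bool.≟ true) →-dec linked-by? petersenList a b} tt

lookup-or-removeAt : (xs : List A) (m : Fin (length xs)) {y : A} → y ∈ xs → y ≡ List.lookup xs m ⊎ y ∈ removeAt xs m
lookup-or-removeAt (x ∷ xs) zero    (here e)  = inj₁ e
lookup-or-removeAt (x ∷ xs) zero    (there i) = inj₂ i
lookup-or-removeAt (x ∷ xs) (suc m) (here e)  = inj₂ (here e)
lookup-or-removeAt (x ∷ xs) (suc m) (there i) with lookup-or-removeAt xs m i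
... | inj₁ e = inj₁ e
... | inj₂ j = inj₂ (there j)

∈-shift : ∀ {n} {es : List (Fin n × Fin n)} {i j} → (i , j) ∈ es → (suc i , suc j) ∈ shift es
∈-shift = ∈-map⁺ (λ (i , j) → suc i , suc j)

linked-shift : ∀ {n} {es : List (Fin n × Fin n)} {i j} → Linked-by es i j → Linked-by (shift es) (suc i) (suc j)
linked-shift (inj₁ e) = inj₁ (∈-shift e)
linked-shift (inj₂ e) = inj₂ (∈-shift e)

linked-there : ∀ {n} {es : List (Fin n × Fin n)} {i j e} → Linked-by es i j → Linked-by (e ∷ es) i j
linked-there (inj₁ e) = inj₁ (there e)
linked-there (inj₂ e) = inj₂ (there e)

subdivided-links : ∀ m {i j} → i ~ j → let a , b = List.lookup dominoEdges m in ¬ SameEdge i j a b →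
                   Linked-by (links (subdivided m)) (suc i) (suc j)
subdivided-links m (inj₁ e) ne with lookup-or-removeAt dominoEdges m e
... | inj₁ p = ⊥-elim (ne (inj₁ (cong proj₁ p , cong proj₂ p)))
... | inj₂ r = linked-there (linked-there (linked-shift (inj₁ r)))
subdivided-links m (inj₂ e) ne with lookup-or-removeAt dominoEdges m e
... | inj₁ p = ⊥-elim (ne (inj₂ (cong proj₂ p , cong proj₁ p)))
... | inj₂ r = linked-there (linked-there (linked-shift (inj₂ r)))

-- Coarsening along a map whose fibres are stars around the representatives r a.
coarsen-stars : ∀ {H : Graph} → Symmetric H → {I I′ : Set} {R : I → I → Set} {R′ : I′ → I′ → Set}
                (g : I → Maybe I′) (r : I′ → I) → (∀ a → g (r a) ≡ just a) →
                (∀ i {a} → g i ≡ just a → i ≡ r a ⊎ (R i (r a) ⊎ R (r a) i)) →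
                (∀ {a b} → R′ a b → ∃₂ λ i j → g i ≡ just a × g j ≡ just b × (R i j ⊎ R j i)) → Model H R → Model H R′
coarsen-stars symH {I} {I′} {R} g r gr star covered = coarsen symH g link covered
  where
  link : ∀ {i j a} → g i ≡ just a → g j ≡ just a → Linkage R g a i j
  link {i} {j} {a} p q with star i p | star j q
  ... | inj₁ refl | inj₁ refl = stop p
  ... | inj₁ refl | inj₂ s    = move p ([ inj₂ , inj₁ ]′ s) (stop q)
  ... | inj₂ s    | inj₁ refl = move p s (stop q)
  ... | inj₂ s    | inj₂ s′   = move p s (move (gr a) ([ inj₂ , inj₁ ]′ s′) (stop q))

module Outcomes {G H : Graph} (cubicG : IsCubic G) (cubicH : IsCubic H) (F : Frame G) (η : Embedding G H) where
  open Host cubicG cubicH F η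

  irrG : ∀ {u} → ¬ Adj G u u
  irrG = simple⇒irreflexive (proj₁ cubicG)

  plus-embedding : ∀ {a b c e} → Adj G a b → Adj G c e → ¬ SameEdge c e a b → Model H (Adj (plus G a b c e)) →
                   Embedding (plus G a b c e) H
  plus-embedding ab ce ne = model⇒embedding (plus-trivalent (cubic-trivalent cubicG) ab ce ne) symH

  -- The outside is contracted by `halves κ`, which gives a model of the closed graph, and the map
  -- of the table is applied to that.
  petersen-in : (R : Region) {T : Shape} → Placed H T (Region.Y R) (Region.e R) → ∀ κ (f : Fin (2 + order T) → Fin 10) →
                Coarsens (closed κ T) petersenList f → Embedding Petersen H
  petersen-in R {T} P κ f c = model⇒embedding petersen-trivalent symH
    (coarsen-by symH c (λ {a} {b} → petersen-edges a b) (coarsen symH contract link cover glued))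
    where
    open Gluing R (base-backdrop R) P (λ _ _ → ⊥) (λ ()) using (glued)
    module Halves = Model (halves κ)
    part : V G → Maybe Bool
    part = Halves.lab
    Rel : Fin (order T) ⊎ V G → Fin (order T) ⊎ V G → Set
    Rel = Glued (links T) (exit T) (Adj G) (λ _ _ → ⊥)
    contract : Fin (order T) ⊎ V G → Maybe (Fin (2 + order T))
    contract (inj₁ k) = just (suc (suc k))
    contract (inj₂ v) = mapMaybe hub-of (part v)
    part-out : ∀ {b v} → part v ≡ just b → ¬ Inside v
    part-out p (i , refl) with trans (sym p) (half-d κ i)
    ... | ()
    contract-part : ∀ {b v} → part v ≡ just b → contract (inj₂ v) ≡ just (hub-of b)
    contract-part p = cong (mapMaybe hub-of) p
    part⁻ : ∀ {v a} → contract (inj₂ v) ≡ just a → Σ Bool λ b → part v ≡ just b × hub-of b ≡ a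
    part⁻ {v} e with part v
    part⁻ refl | just b = b , refl , refl
    hub-injective : ∀ b b′ → hub-of {order T} b ≡ hub-of b′ → b ≡ b′
    hub-injective true true _ = refl
    hub-injective false false _ = refl
    hub≢ : ∀ b {k : Fin (order T)} → hub-of b ≢ suc (suc k)
    hub≢ true ()
    hub≢ false ()
    along : ∀ {b u v} → Within G (λ w → part w ≡ just b) u v → Linkage Rel contract (hub-of b) (inj₂ u) (inj₂ v)
    along (here p) = stop (contract-part p)
    along (go p a w) = move (contract-part p) (inj₁ (right a (part-out p) (part-out (within-source w)))) (along w)
    link : ∀ {i j a} → contract i ≡ just a → contract j ≡ just a → Linkage Rel contract a i j
    link {inj₁ i} {inj₁ .i} refl refl = stop refl
    link {inj₁ i} {inj₂ v} refl q = case part⁻ {v} q of λ (b , _ , e) → ⊥-elim (hub≢ b e)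
    link {inj₂ v} {inj₁ i} p refl = case part⁻ {v} p of λ (b , _ , e) → ⊥-elim (hub≢ b e)
    link {inj₂ v} {inj₂ w} p q with part⁻ {v} p | part⁻ {w} q
    ... | b , pv , refl | b′ , pw , e with hub-injective b′ b e
    ...   | refl = along (Halves.conn pv pw)
    cover : ∀ {a b} → Edges (closed κ T) a b → ∃₂ λ i j → contract i ≡ just a × contract j ≡ just b × (Rel i j ⊎ Rel j i)
    cover (here refl) with Halves.edge bridge
    ... | u , v , pu , pv , a = inj₂ u , inj₂ v , contract-part pu , contract-part pv , inj₁ (right a (part-out pu) (part-out pv))
    cover (there e) with ∈-++⁻ (map (λ j → hub-of (side κ j) , suc (suc (exit T j))) (allFin 5)) e
    ... | inj₁ e′ with ∈-map⁻ (λ j → hub-of (side κ j) , suc (suc (exit T j))) e′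
    ...   | j , _ , refl = inj₂ (z j) , inj₁ (exit T j) , contract-part (half-z κ j) , refl , inj₂ (cross j)
    cover (there e) | inj₂ e′ with ∈-map⁻ (λ (i , j) → suc i , suc j) e′
    ... | _ , e″ , refl with ∈-map⁻ (λ (i , j) → suc i , suc j) e″
    ...   | (i , j) , r , refl = inj₁ i , inj₁ j , refl , refl , inj₁ (left r)

  outsider : ∀ {A : Set} → (V G → A) → V G → Maybe A
  outsider f v with inside? v
  ... | yes _ = nothing
  ... | no _  = just (f v)

  outsider⁻ : ∀ {A : Set} {f : V G → A} v {a} → outsider f v ≡ just a → ¬ Inside v × f v ≡ a
  outsider⁻ v e with inside? v
  outsider⁻ v refl | no o = o , refl

  outsider⁺ : ∀ {A : Set} {f : V G → A} {v} → ¬ Inside v → outsider f v ≡ just (f v)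
  outsider⁺ {v = v} o with inside? v
  ... | yes i = ⊥-elim (o i)
  ... | no _  = refl

  place : ∀ {k} → (Fin 7 → Fin k) → V G → Fin k ⊎ V G
  place ν v with inside? v
  ... | yes (i , _) = inj₁ (ν i)
  ... | no _        = inj₂ v

  place-d : ∀ {k} (ν : Fin 7 → Fin k) i → place ν (d i) ≡ inj₁ (ν i)
  place-d ν i with inside? (d i)
  ... | yes (k , e) = cong (inj₁ ∘ ν) (sym (d-inj e))
  ... | no n        = ⊥-elim (n (i , refl))

  place-out : ∀ {k} {ν : Fin 7 → Fin k} {v} → ¬ Inside v → place ν v ≡ inj₂ v
  place-out {v = v} o with inside? v
  ... | yes i = ⊥-elim (o i)
  ... | no _  = refl

  data End (k : ℕ) (f₁ f₂ : V G) : Fin (suc k) → V G → Set where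
    end₁ : End k f₁ f₂ zero f₁
    end₂ : End k f₁ f₂ zero f₂

  -- A jump from the marked vertex to an interior vertex q of η(f₁f₂), where f₁f₂ avoids the domino.
  module Leap (R : Region) {S : Shape} (P : Placed H S (Region.Y R) (Region.e R)) {p q : V H}
              (lp : Placed.lab P p ≡ just (mark S)) (pq : Adj H p q) (yq : Region.Y R q ≡ false)
              {f₁ f₂ : V G} (f : Adj G f₁ f₂) (o₁ : ¬ Inside f₁) (o₂ : ¬ Inside f₂) (q∈ : q ∈ inner f₁ f₂) where
    open RegionFacts R

    T : Shape
    T = attach S (mark S)

    Kept : V G → V G → Set
    Kept a b = Adj G a b × ¬ SameEdge a b f₁ f₂

    Rel : Fin (order T) ⊎ V G → Fin (order T) ⊎ V G → Set
    Rel = Glued (links T) (exit T) Kept (End (order S) f₁ f₂)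

    landed : Model H Rel
    landed with ∈-∃++ q∈ | attached symH P lp yq pq
    ... | l , r , sp | P′ , lq , _ = Gluing.glued R marked-backdrop P′ (End (order S) f₁ f₂) witness
      where
      open Subdividing R f o₁ o₂ sp
      not-q : ∀ {h v} → M.own h ≡ just v → h ≢ q
      not-q o refl with trans (sym o) M.own-q
      ... | ()
      witness : ∀ {i a} → End (order S) f₁ f₂ i a → ¬ Inside a × Σ (V H) λ u → Σ (V H) λ h →
                Placed.lab P′ u ≡ just i × M.own h ≡ just a × insert Y q h ≡ false × Adj H u h
      witness end₁ with M.q-near₁
      ... | h , o , a , h∈ = o₁ , q , h , lq , o ,
        insert-false {Y = Y} {q} {h} (off-Y f o₁ o₂ (sub h∈)) (not-q o) , symH a
        where
        sub : ∀ {h} → h ∈ vmap f₁ ∷ l → h ∈ path f₁ f₂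
        sub (here e)  = here e
        sub (there i) = inner⊆path {f₁} {f₂} (subst (_ ∈_) (sym sp) (∈-++⁺ˡ i))
      witness end₂ with M.q-near₂
      ... | h , o , a , h∈ = o₂ , q , h , lq , o ,
        insert-false {Y = Y} {q} {h} (off-Y f o₁ o₂ (sub h∈)) (not-q o) , a
        where
        sub : ∀ {h} → h ∈ r ++ vmap f₂ ∷ [] → h ∈ path f₁ f₂
        sub {h} i with ∈-++⁻ r i
        ... | inj₁ j = inner⊆path {f₁} {f₂} (subst (h ∈_) (sym sp) (∈-++⁺ʳ l (there j)))
        ... | inj₂ (here e) = there (∈-++⁺ʳ (inner f₁ f₂) (here e))

  module LeapSingle (R : Region) (m : Fin 8) (P : Placed H (subdivided m) (Region.Y R) (Region.e R)) {p q : V H}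
              (lp : Placed.lab P p ≡ just zero) (pq : Adj H p q) (yq : Region.Y R q ≡ false)
              {f₁ f₂ : V G} (f : Adj G f₁ f₂) (o₁ : ¬ Inside f₁) (o₂ : ¬ Inside f₂) (q∈ : q ∈ inner f₁ f₂) where
    open Leap R P lp pq yq f o₁ o₂ q∈
    private
      a b : Fin 7
      a = proj₁ (List.lookup dominoEdges m)
      b = proj₂ (List.lookup dominoEdges m)

    K : Graph
    K = plus G (d a) (d b) f₁ f₂

    private
      ab : Adj G (d a) (d b)
      ab = d-adj (∈-lookup m)

      apart : ¬ SameEdge f₁ f₂ (d a) (d b)
      apart (inj₁ (e , _)) = o₁ (_ , e)
      apart (inj₂ (e , _)) = o₁ (_ , e)

      -- After `attach`, vertex 0 is `q`, 1 is the mark, and the domino starts at 2; no contraction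
      -- is necessary.
      ν : Fin 7 → Fin 9
      ν i = suc (suc i)

      g : Fin 9 ⊎ V G → Maybe (V K)
      g (inj₁ zero)          = just newY
      g (inj₁ 1F)            = just newX
      g (inj₁ (suc (suc i))) = just (old (d i))
      g (inj₂ v)             = outsider old v

      r : V K → Fin 9 ⊎ V G
      r zero          = inj₁ 1F
      r 1F            = inj₁ zero
      r (suc (suc v)) = place ν v

      gr : ∀ k → g (r k) ≡ just k
      gr zero = refl
      gr 1F   = refl
      gr (suc (suc v)) with inside? v in eq
      ... | yes (i , refl) = refl
      ... | no o = outsider⁺ o

      star : ∀ i {k} → g i ≡ just k → i ≡ r k ⊎ (Rel i (r k) ⊎ Rel (r k) i)
      star (inj₁ zero) refl = inj₁ refl
      star (inj₁ 1F) refl = inj₁ refl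
      star (inj₁ (suc (suc i))) refl = inj₁ (sym (place-d ν i))
      star (inj₂ v) e with outsider⁻ v e
      ... | o , refl = inj₁ (sym (place-out o))

      Rel± : V K → V K → Set
      Rel± k l = Rel (r k) (r l) ⊎ Rel (r l) (r k)

      olds : ∀ u v → Adj G u v → ¬ SameEdge u v (d a) (d b) → ¬ SameEdge u v f₁ f₂ → Rel± (old u) (old v)
      olds u v e n n′ with inside? u | inside? v
      ... | no ou | no ov = inj₁ (right (e , n′) ou ov)
      ... | yes (i , refl) | yes (j , refl) = [ inj₁ ∘ left , inj₂ ∘ left ]′
        (linked-there (linked-shift (subdivided-links m (d-only e) λ s → n (cong-same s))))
        where
        cong-same : SameEdge i j a b → SameEdge (d i) (d j) (d a) (d b)
        cong-same (inj₁ (p , q)) = inj₁ (cong d p , cong d q)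
        cong-same (inj₂ (p , q)) = inj₂ (cong d p , cong d q)
      ... | yes (i , refl) | no ov with z-only e (λ k p → ov (k , p))
      ...   | j , refl , refl = inj₁ (cross j)
      olds u v e n n′ | no ou | yes (i , refl) with z-only (symG e) (λ k p → ou (k , p))
      ... | j , refl , refl = inj₂ (cross j)

      covered : ∀ k l → Adj K k l → Rel± k l
      covered zero 1F _ = inj₂ (left (here refl))
      covered 1F zero _ = inj₁ (left (here refl))
      covered zero (suc (suc v)) e with one-of⁻ {v = v} {d a} {d b} e
      ... | inj₁ refl rewrite place-d ν a = inj₂ (left (there (here refl)))
      ... | inj₂ refl rewrite place-d ν b = inj₁ (left (there (there (here refl))))
      covered (suc (suc v)) zero e with one-of⁻ {v = v} {d a} {d b} e
      ... | inj₁ refl rewrite place-d ν a = inj₁ (left (there (here refl)))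
      ... | inj₂ refl rewrite place-d ν b = inj₂ (left (there (there (here refl))))
      covered 1F (suc (suc v)) e with one-of⁻ {v = v} {f₁} {f₂} e
      ... | inj₁ refl rewrite place-out {ν = ν} o₁ = inj₁ (extra end₁)
      ... | inj₂ refl rewrite place-out {ν = ν} o₂ = inj₁ (extra end₂)
      covered (suc (suc v)) 1F e with one-of⁻ {v = v} {f₁} {f₂} e
      ... | inj₁ refl rewrite place-out {ν = ν} o₁ = inj₂ (extra end₁)
      ... | inj₂ refl rewrite place-out {ν = ν} o₂ = inj₂ (extra end₂)
      covered (suc (suc u)) (suc (suc v)) e with plus-old⁻ {G} {d a} {d b} {f₁} {f₂} {u} {v} e
      ... | uv , n , n′ = olds u v uv n n′

    single-leap : Embedding K H
    single-leap = plus-embedding ab f apart (coarsen-stars symH g r gr star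
      (λ {k} {l} e → r k , r l , gr k , gr l , covered k l e) landed)

-- Leaping from the path at the centre

module DoubleLeaps {G H : Graph} (cubicG : IsCubic G) (cubicH : IsCubic H) (F : Frame G) (η : Embedding G H) where
  open Host cubicG cubicH F η
  open Outcomes cubicG cubicH F η

  module LeapDouble (R : Region) (m : Fin 2) (P : Placed H ⟦ double m ⟧ (Region.Y R) (Region.e R)) {p q : V H}
              (lp : Placed.lab P p ≡ just 1F) (pq : Adj H p q) (yq : Region.Y R q ≡ false)
              {f₁ f₂ : V G} (f : Adj G f₁ f₂) (o₁ : ¬ Inside f₁) (o₂ : ¬ Inside f₂) (q∈ : q ∈ inner f₁ f₂) where
    open Leap R P lp pq yq f o₁ o₂ q∈
    m′ : Fin 8
    m′ = Fin.inject≤ m (s≤s (s≤s z≤n))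

    a b : Fin 7
    a = proj₁ (List.lookup dominoEdges m′)
    b = proj₂ (List.lookup dominoEdges m′)

    private
      ab : Adj G (d a) (d b)
      ab = d-adj (∈-lookup m′)

      x₅ z₅ : V G
      x₅ = d 4F
      z₅ = z 4F

      ν : Fin 7 → Fin 11
      ν i = suc (suc (suc (suc i)))

      -- `q#` is where the leap lands, `y#` is where the first jump landed and is now the fifth
      -- exit, `w#` is the mark between the centre and `y#`, and `x#` subdivides the edge `ab`. So
      -- `w#` and `q#` become the new vertices of the second addition.
      pattern q# = inj₁ zero
      pattern y# = inj₁ 1F
      pattern w# = inj₁ 2F
      pattern x# = inj₁ 3F
      pattern d# i = inj₁ (suc (suc (suc (suc i))))

      lifted : ∀ {i j} → i ~ j → ¬ SameEdge (d i) (d j) (d a) (d b) → Rel (d# i) (d# j) ⊎ Rel (d# j) (d# i)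
      lifted {i} {j} l n = [ inj₁ ∘ left , inj₂ ∘ left ]′
        (linked-there (linked-shift (linked-there (linked-there (linked-shift (linked-there (linked-shift
          (subdivided-links m′ l λ s → n (cong-same s)))))))))
        where
        cong-same : SameEdge i j a b → SameEdge (d i) (d j) (d a) (d b)
        cong-same (inj₁ (p , q)) = inj₁ (cong d p , cong d q)
        cong-same (inj₂ (p , q)) = inj₂ (cong d p , cong d q)

      crosses : ∀ j → j ≢ 4F → Rel (d# (corner j)) (inj₂ (z j))
      crosses zero n = cross zero
      crosses 1F n = cross 1F
      crosses 2F n = cross 2F
      crosses 3F n = cross 3F
      crosses 4F n = ⊥-elim (n refl)

      qw : Rel q# w#
      qw = left (here refl)
      yx : Rel y# x#
      yx = left (there (here refl))
      yw : Rel y# w#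
      yw = left (there (there (here refl)))
      wc : Rel w# (d# 4F)
      wc = left (there (there (there (here refl))))
      ax : Rel (d# a) x#
      ax = left (there (there (there (there (here refl)))))
      xb : Rel x# (d# b)
      xb = left (there (there (there (there (there (here refl))))))
      yz : Rel y# (inj₂ z₅)
      yz = cross 4F

    K₁ K : Graph
    K₁ = plus G (d a) (d b) x₅ z₅
    K = plus K₁ newY (old x₅) (old f₁) (old f₂)

    private
      g : Fin 11 ⊎ V G → Maybe (V K)
      g q# = just newY
      g y# = just (old newY)
      g w# = just newX
      g x# = just (old newX)
      g (d# i) = just (old (old (d i)))
      g (inj₂ v) = outsider (λ u → old (old u)) v

      r : V K → Fin 11 ⊎ V G
      r zero                      = w#
      r 1F                        = q#
      r 2F                        = x#
      r 3F                        = y#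
      r (suc (suc (suc (suc v)))) = place ν v

      gr : ∀ k → g (r k) ≡ just k
      gr zero = refl
      gr 1F   = refl
      gr 2F   = refl
      gr 3F   = refl
      gr (suc (suc (suc (suc v)))) with inside? v in eq
      ... | yes (i , refl) = refl
      ... | no o = outsider⁺ o

      star : ∀ i {k} → g i ≡ just k → i ≡ r k ⊎ (Rel i (r k) ⊎ Rel (r k) i)
      star q# refl = inj₁ refl
      star y# refl = inj₁ refl
      star w# refl = inj₁ refl
      star x# refl = inj₁ refl
      star (d# i) refl = inj₁ (sym (place-d ν i))
      star (inj₂ v) e with outsider⁻ v e
      ... | o , refl = inj₁ (sym (place-out o))

      Rel± : V K → V K → Set
      Rel± k l = Rel (r k) (r l) ⊎ Rel (r l) (r k)

      flip± : ∀ {k l} → Rel± k l → Rel± l k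
      flip± = [ inj₂ , inj₁ ]′

      olds : ∀ u v → Adj G u v → ¬ SameEdge u v (d a) (d b) → ¬ SameEdge u v x₅ z₅ → ¬ SameEdge u v f₁ f₂ →
             Rel± (old (old u)) (old (old v))
      olds u v e n n′ n″ with inside? u | inside? v
      ... | no ou | no ov = inj₁ (right (e , n″) ou ov)
      ... | yes (i , refl) | yes (j , refl) = lifted (d-only e) n
      ... | yes (i , refl) | no ov with z-only e (λ k p → ov (k , p))
      ...   | j , refl , refl = inj₁ (crosses j λ { refl → n′ (inj₁ (refl , refl)) })
      olds u v e n n′ n″ | no ou | yes (i , refl) with z-only (symG e) (λ k p → ou (k , p))
      ... | j , refl , refl = inj₂ (crosses j λ { refl → n′ (inj₂ (refl , refl)) })

      inner-covered : ∀ k l → Adj K₁ k l → ¬ SameEdge k l newY (old x₅) → ¬ SameEdge k l (old f₁) (old f₂) →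
                      Rel± (old k) (old l)
      inner-covered zero 1F e n n′ = inj₂ yx
      inner-covered 1F zero e n n′ = inj₁ yx
      inner-covered zero (suc (suc v)) e n n′ with one-of⁻ {v = v} {d a} {d b} e
      ... | inj₁ refl rewrite place-d ν a = inj₂ ax
      ... | inj₂ refl rewrite place-d ν b = inj₁ xb
      inner-covered (suc (suc v)) zero e n n′ with one-of⁻ {v = v} {d a} {d b} e
      ... | inj₁ refl rewrite place-d ν a = inj₁ ax
      ... | inj₂ refl rewrite place-d ν b = inj₂ xb
      inner-covered 1F (suc (suc v)) e n n′ with one-of⁻ {v = v} {x₅} {z₅} e
      ... | inj₁ refl = ⊥-elim (n (inj₁ (refl , refl)))
      ... | inj₂ refl rewrite place-out {ν = ν} (z-outside 4F) = inj₁ yz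
      inner-covered (suc (suc v)) 1F e n n′ with one-of⁻ {v = v} {x₅} {z₅} e
      ... | inj₁ refl = ⊥-elim (n (inj₂ (refl , refl)))
      ... | inj₂ refl rewrite place-out {ν = ν} (z-outside 4F) = inj₂ yz
      inner-covered (suc (suc u)) (suc (suc v)) e n n′ with plus-old⁻ {G} {d a} {d b} {x₅} {z₅} {u} {v} e
      ... | uv , n₁ , n₂ = olds u v uv n₁ n₂ λ where
        (inj₁ (refl , refl)) → n′ (inj₁ (refl , refl))
        (inj₂ (refl , refl)) → n′ (inj₂ (refl , refl))

      covered : ∀ k l → Adj K k l → Rel± k l
      covered zero 1F _ = inj₂ qw
      covered 1F zero _ = inj₁ qw
      covered zero (suc (suc v)) e with one-of⁻ {v = v} {newY} {old x₅} e
      ... | inj₁ refl = inj₂ yw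
      ... | inj₂ refl rewrite place-d ν 4F = inj₁ wc
      covered (suc (suc v)) zero e = flip± {zero} {suc (suc v)} (covered zero (suc (suc v)) e)
      covered 1F (suc (suc v)) e with one-of⁻ {v = v} {old f₁} {old f₂} e
      ... | inj₁ refl rewrite place-out {ν = ν} o₁ = inj₁ (extra end₁)
      ... | inj₂ refl rewrite place-out {ν = ν} o₂ = inj₁ (extra end₂)
      covered (suc (suc v)) 1F e = flip± {suc zero} {suc (suc v)} (covered 1F (suc (suc v)) e)
      covered (suc (suc u)) (suc (suc v)) e with plus-old⁻ {K₁} {newY} {old x₅} {old f₁} {old f₂} {u} {v} e
      ... | uv , n , n′ = inner-covered u v uv n n′

      xz : Adj G x₅ z₅
      xz = z-adj 4F

      apart₁ : ¬ SameEdge x₅ z₅ (d a) (d b)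
      apart₁ (inj₁ (_ , e)) = z-out 4F _ e
      apart₁ (inj₂ (_ , e)) = z-out 4F _ e

      f⁺ : Adj K₁ (old f₁) (old f₂)
      f⁺ = plus-old⁺ {G} {d a} {d b} {x₅} {z₅} f (λ where
          (inj₁ (e , _)) → o₁ (_ , e)
          (inj₂ (e , _)) → o₁ (_ , e)) (λ where
          (inj₁ (e , _)) → o₁ (_ , e)
          (inj₂ (_ , e)) → o₂ (_ , e))

      yx⁺ : Adj K₁ newY (old x₅)
      yx⁺ = one-of⁺ x₅ x₅ z₅ (inj₁ refl)

      apart₂ : ¬ SameEdge {V K₁} (old f₁) (old f₂) newY (old x₅)
      apart₂ (inj₁ (() , _))
      apart₂ (inj₂ (_ , ()))

    double-leap : Embedding K H
    double-leap = model⇒embedding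
      (plus-trivalent (plus-trivalent (cubic-trivalent cubicG) ab xz apart₁) yx⁺ f⁺ apart₂) symH
      (coarsen-stars symH g r gr star (λ {k} {l} e → r k , r l , gr k , gr l , covered k l e) landed)

    -- If f₁ is a neighbour of z₅, the old vertex z₅ is better represented by w, and the end of
    -- the first jump together with the former z₅ subdivides the third edge at z₅.
    module Close (f₁z : Adj G f₁ z₅) (f₁≢z : f₁ ≢ z₅) where
      private
        third = third-neighbour {G} (proj₂ cubicG z₅) (symG xz) (symG f₁z) (λ e → o₁ (_ , sym e))

      u₀ : V G
      u₀ = proj₁ third

      private
        zu : Adj G z₅ u₀
        zu = proj₁ (proj₂ third)

        u≢x : u₀ ≢ x₅
        u≢x = proj₁ (proj₂ (proj₂ third))

        u≢f : u₀ ≢ f₁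
        u≢f = proj₁ (proj₂ (proj₂ (proj₂ third)))

        at-z₅ : ∀ {w} → Adj G z₅ w → w ≡ x₅ ⊎ w ≡ f₁ ⊎ w ≡ u₀
        at-z₅ = proj₂ (proj₂ (proj₂ (proj₂ third)))

        oz : ¬ Inside z₅
        oz = z-outside 4F

      -- By `z₅-own` the only neighbour of `z₅` in the domino is `x₅`, so the third edge at `z₅`
      -- avoids the domino, as alternative (iii) demands.
      u₀-out : ¬ Inside u₀
      u₀-out (k , e) with z-only (symG (subst (Adj G z₅) e zu)) (z-out 4F)
      ... | j , k≡ , z≡ with z₅-own j (sym z≡)
      ...   | refl = u≢x (trans e (cong d k≡))

      z₅-out : ¬ Inside z₅
      z₅-out = oz

      z₅u₀ : Adj G z₅ u₀
      z₅u₀ = zu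

      K₂ : Graph
      K₂ = plus G (d a) (d b) z₅ u₀

      private
        u≢z : u₀ ≢ z₅
        u≢z e = irrG (subst (Adj G z₅) e zu)

        name : V G → V K₂
        name v with v ≟F z₅
        ... | yes _ = newY
        ... | no _  = old v

        name-z : name z₅ ≡ newY
        name-z with z₅ ≟F z₅
        ... | yes _ = refl
        ... | no n  = ⊥-elim (n refl)

        name-other : ∀ {v} → v ≢ z₅ → name v ≡ old v
        name-other {v} n with v ≟F z₅
        ... | yes e = ⊥-elim (n e)
        ... | no _  = refl

        g₂ : Fin 11 ⊎ V G → Maybe (V K₂)
        -- Merging `q#` into `f₁` turns the edge from `w#` to `q#` into the edge from the new `z₅`
        -- to `f₁`.
        g₂ q# = just (old f₁)
        g₂ y# = just newY
        g₂ w# = just (old z₅)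
        g₂ x# = just newX
        g₂ (d# i) = just (old (d i))
        g₂ (inj₂ v) = outsider name v

        r₂ : V K₂ → Fin 11 ⊎ V G
        r₂ zero = x#
        r₂ 1F   = y#
        r₂ (suc (suc v)) with v ≟F z₅
        ... | yes _ = w#
        ... | no _  = place ν v

        r₂-z : r₂ (old z₅) ≡ w#
        r₂-z with z₅ ≟F z₅
        ... | yes _ = refl
        ... | no n  = ⊥-elim (n refl)

        r₂-other : ∀ {v} → v ≢ z₅ → r₂ (old v) ≡ place ν v
        r₂-other {v} n with v ≟F z₅
        ... | yes e = ⊥-elim (n e)
        ... | no _  = refl

        d≢z : ∀ i → d i ≢ z₅
        d≢z i e = z-out 4F i (sym e)

        g₂-place : ∀ {v} → v ≢ z₅ → g₂ (place ν v) ≡ just (old v)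
        g₂-place {v} n with inside? v in eq
        ... | yes (i , refl) = refl
        ... | no o = trans (outsider⁺ o) (cong just (name-other n))

        g₂-out : ∀ {v} → ¬ Inside v → v ≢ z₅ → g₂ (inj₂ v) ≡ just (old v)
        g₂-out o n = trans (outsider⁺ o) (cong just (name-other n))

        g₂-z : g₂ (inj₂ z₅) ≡ just newY
        g₂-z = trans (outsider⁺ oz) (cong just name-z)

        gr₂ : ∀ k → g₂ (r₂ k) ≡ just k
        gr₂ zero = refl
        gr₂ 1F   = refl
        gr₂ (suc (suc v)) with v ≟F z₅
        ... | yes refl = refl
        ... | no n = g₂-place n

        star₂ : ∀ i {k} → g₂ i ≡ just k → i ≡ r₂ k ⊎ (Rel i (r₂ k) ⊎ Rel (r₂ k) i)
        star₂ q# refl rewrite r₂-other f₁≢z | place-out {ν = ν} o₁ = inj₂ (inj₁ (extra end₁))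
        star₂ y# refl = inj₁ refl
        star₂ w# refl = inj₁ (sym r₂-z)
        star₂ x# refl = inj₁ refl
        star₂ (d# i) refl = inj₁ (sym (trans (r₂-other (d≢z i)) (place-d ν i)))
        star₂ (inj₂ v) e with outsider⁻ v e
        ... | o , refl with v ≟F z₅ in eq
        ...   | yes refl = inj₂ (inj₂ yz)
        ...   | no n rewrite eq = inj₁ (sym (place-out o))

        Cov : V K₂ → V K₂ → Set
        Cov k l = ∃₂ λ i j → g₂ i ≡ just k × g₂ j ≡ just l × (Rel i j ⊎ Rel j i)

        flip₂ : ∀ {k l} → Cov k l → Cov l k
        flip₂ (i , j , p , q , s) = j , i , q , p , [ inj₂ , inj₁ ]′ s

        from-z : ∀ v → Adj G z₅ v → ¬ SameEdge z₅ v z₅ u₀ → Cov (old z₅) (old v)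
        from-z v e n with at-z₅ e
        ... | inj₁ refl = w# , d# 4F , refl , refl , inj₁ wc
        ... | inj₂ (inj₁ refl) = w# , q# , refl , refl , inj₂ qw
        ... | inj₂ (inj₂ refl) = ⊥-elim (n (inj₁ (refl , refl)))

        outward : ∀ i v → Adj G (d i) v → ¬ Inside v → v ≢ z₅ → Cov (old (d i)) (old v)
        outward i v e ov v≢ with z-only e (λ k p → ov (k , p))
        ... | j , refl , refl = d# (corner j) , inj₂ (z j) , refl , g₂-out ov v≢ , inj₁ (crosses j λ { refl → v≢ refl })

        olds₂ : ∀ u v → Adj G u v → ¬ SameEdge u v (d a) (d b) → ¬ SameEdge u v z₅ u₀ → Cov (old u) (old v)
        olds₂ u v e n n′ = cases (u ≟F z₅) (v ≟F z₅) (inside? u) (inside? v) (sameEdge? u v f₁ f₂)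
          where
          cases : Dec (u ≡ z₅) → Dec (v ≡ z₅) → Dec (Inside u) → Dec (Inside v) → Dec (SameEdge u v f₁ f₂) → Cov (old u) (old v)
          cases (yes refl) _ _ _ _ = from-z v e n′
          cases (no _) (yes refl) _ _ _ = flip₂ (from-z u (symG e) λ s → n′ (SameEdge-swap s))
          cases (no _) (no _) (yes (i , refl)) (yes (j , refl)) _ = d# i , d# j , refl , refl , lifted (d-only e) n
          cases (no _) (no v≢) (yes (i , refl)) (no ov) _ = outward i v e ov v≢
          cases (no u≢) (no _) (no ou) (yes (j , refl)) _ = flip₂ (outward j u (symG e) ou u≢)
          cases (no u≢) (no v≢) (no ou) (no ov) (no ns) =
            inj₂ u , inj₂ v , g₂-out ou u≢ , g₂-out ov v≢ , inj₁ (right (e , ns) ou ov)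
          cases (no u≢) (no v≢) (no ou) (no ov) (yes (inj₁ (refl , refl))) =
            q# , inj₂ v , refl , g₂-out ov v≢ , inj₁ (extra end₂)
          cases (no u≢) (no v≢) (no ou) (no ov) (yes (inj₂ (refl , refl))) =
            inj₂ u , q# , g₂-out ou u≢ , refl , inj₂ (extra end₂)

        covered₂ : ∀ k l → Adj K₂ k l → Cov k l
        covered₂ zero 1F _ = x# , y# , refl , refl , inj₂ yx
        covered₂ 1F zero _ = y# , x# , refl , refl , inj₁ yx
        covered₂ zero (suc (suc v)) e with one-of⁻ {v = v} {d a} {d b} e
        ... | inj₁ refl = x# , d# a , refl , refl , inj₂ ax
        ... | inj₂ refl = x# , d# b , refl , refl , inj₁ xb
        covered₂ (suc (suc v)) zero e = flip₂ (covered₂ zero (suc (suc v)) e)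
        covered₂ 1F (suc (suc v)) e with one-of⁻ {v = v} {z₅} {u₀} e
        ... | inj₁ refl = y# , w# , refl , refl , inj₁ yw
        ... | inj₂ refl = inj₂ z₅ , inj₂ u₀ , g₂-z , g₂-out u₀-out u≢z , inj₁ (right (zu , differ) oz u₀-out)
          where
          differ : ¬ SameEdge z₅ u₀ f₁ f₂
          differ (inj₁ (p , _)) = f₁≢z (sym p)
          differ (inj₂ (_ , p)) = u≢f p
        covered₂ (suc (suc v)) 1F e = flip₂ (covered₂ 1F (suc (suc v)) e)
        covered₂ (suc (suc u)) (suc (suc v)) e with plus-old⁻ {G} {d a} {d b} {z₅} {u₀} {u} {v} e
        ... | uv , n , n′ = olds₂ u v uv n n′

      close-leap : Embedding K₂ H
      close-leap = plus-embedding ab zu (λ where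
          (inj₁ (p , _)) → oz (_ , p)
          (inj₂ (p , _)) → oz (_ , p))
        (coarsen-stars symH g₂ r₂ gr₂ star₂ (λ {k} {l} e → covered₂ k l e) landed)

-- The search

consec-split : {p q e n : A} (X : List A) {W : List A} → Consec p q (X ++ e ∷ n ∷ W) →
               q ∈ X ++ e ∷ [] ⊎ (p ≡ e × q ≡ n) ⊎ p ∈ n ∷ W
consec-split []      ([]     , zs , refl) = inj₂ (inj₁ (refl , refl))
consec-split {p = p} [] (_ ∷ ys , zs , eq) = inj₂ (inj₂ (subst (p ∈_) (sym (proj₂ (∷-injective eq))) (∈-insert ys)))
consec-split (_ ∷ [])    ([]     , zs , refl) = inj₁ (there (here refl))
consec-split (_ ∷ _ ∷ _) ([]     , zs , refl) = inj₁ (there (here refl))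
consec-split (_ ∷ X) (_ ∷ ys , zs , eq) with consec-split X (ys , zs , proj₂ (∷-injective eq))
... | inj₁ i = inj₁ (there i)
... | inj₂ s = inj₂ s

consec-split-first : {p q e n : A} (X : List A) {W : List A} → Consec p q (X ++ e ∷ n ∷ W) →
                     p ∈ X ++ e ∷ [] ⊎ q ∈ n ∷ W
consec-split-first []      ([]     , zs , refl) = inj₁ (here refl)
consec-split-first {q = q} [] (_ ∷ ys , zs , eq) =
  inj₂ (subst (q ∈_) (sym (proj₂ (∷-injective eq))) (∈-++⁺ʳ ys (there (here refl))))
consec-split-first (_ ∷ [])    ([]     , zs , refl) = inj₁ (here refl)
consec-split-first (_ ∷ _ ∷ _) ([]     , zs , refl) = inj₁ (here refl)
consec-split-first (_ ∷ X) (_ ∷ ys , zs , eq) with consec-split-first X (ys , zs , proj₂ (∷-injective eq))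
... | inj₁ i = inj₁ (there i)
... | inj₂ i = inj₂ i

consec-reverse : {p q : A} {L : List A} → Consec p q L → Consec q p (reverse L)
consec-reverse {p = p} {q} (ys , zs , refl) = reverse zs , reverse ys , (begin
  reverse (ys ++ p ∷ q ∷ zs)               ≡⟨ reverse-++ ys (p ∷ q ∷ zs) ⟩
  reverse (p ∷ q ∷ zs) ++ reverse ys       ≡⟨ cong (_++ reverse ys) (reverse-++ (p ∷ q ∷ []) zs) ⟩
  (reverse zs ++ q ∷ p ∷ []) ++ reverse ys ≡⟨ ++-assoc (reverse zs) (q ∷ p ∷ []) (reverse ys) ⟩
  reverse zs ++ q ∷ p ∷ reverse ys         ∎)
  where open ≡-Reasoning

consec-prefix : {p q : A} (X : List A) {L : List A} → Consec p q L → Consec p q (X ++ L)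
consec-prefix X {L} (ys , zs , refl) = X ++ ys , zs , sym (++-assoc X ys _)

predecessor : (u : A) (X : List A) {q : A} {W : List A} → Σ A λ p → p ∈ u ∷ X × Consec p q (u ∷ X ++ q ∷ W)
predecessor u []      = u , here refl , [] , _ , refl
predecessor u (x ∷ X) with predecessor x X
... | p , i , ys , zs , eq = p , there i , u ∷ ys , zs , cong (u ∷_) eq

abstract
  other-edges : ∀ m → All (λ (i , j) → ¬ SameEdge i j (proj₁ (List.lookup dominoEdges m)) (proj₂ (List.lookup dominoEdges m)))
                          (removeAt dominoEdges m)
  other-edges = toWitness {a? = Finₚ.all? λ m → All.all? (λ (i , j) →
    ¬? (((i ≟F _) ×-dec (j ≟F _)) ⊎-dec ((i ≟F _) ×-dec (j ≟F _)))) (removeAt dominoEdges m)} tt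

removeAt-⊆ : (xs : List A) (m : Fin (length xs)) {y : A} → y ∈ removeAt xs m → y ∈ xs
removeAt-⊆ (x ∷ xs) zero    i         = there i
removeAt-⊆ (x ∷ xs) (suc m) (here e)  = here e
removeAt-⊆ (x ∷ xs) (suc m) (there i) = there (removeAt-⊆ xs m i)

module Search {G H : Graph} (cubicG : IsCubic G) (cubicH : IsCubic H) (F : Frame G) (η : Embedding G H) where
  open Host cubicG cubicH F η
  open Outcomes cubicG cubicH F η
  open DoubleLeaps cubicG cubicH F η

  z₅ : V G
  z₅ = z 4F

  data Found : Set where
    petersen : Embedding Petersen H → Found
    single⁺  : ∀ {i j f₁ f₂} → i ~ j → Adj G f₁ f₂ → ¬ Inside f₁ → ¬ Inside f₂ →
               Embedding (plus G (d i) (d j) f₁ f₂) H → Found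
    double⁺  : ∀ {m : Fin 2} {f₁ f₂} → Adj G f₁ f₂ → ¬ Inside f₁ → ¬ Inside f₂ → f₁ ≢ z₅ → f₂ ≢ z₅ →
               ¬ Adj G f₁ z₅ → ¬ Adj G f₂ z₅ →
               let e = List.lookup dominoEdges (Fin.inject≤ m (s≤s (s≤s z≤n))) in
               Embedding (plus (plus G (d (proj₁ e)) (d (proj₂ e)) (d 4F) z₅) newY (old (d 4F)) (old f₁) (old f₂)) H → Found

  path-flip : ∀ {a b} → Adj G a b → path b a ≡ reverse (path a b)
  path-flip {a} {b} e = begin
    vmap b ∷ inner b a ++ vmap a ∷ []             ≡⟨ cong (λ L → vmap b ∷ L ++ vmap a ∷ []) (inner-sym a b e) ⟩
    vmap b ∷ reverse (inner a b) ++ vmap a ∷ []   ≡⟨ cong (_++ vmap a ∷ []) (reverse-++ (inner a b) (vmap b ∷ [])) ⟨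
    reverse (inner a b ++ vmap b ∷ []) ++ vmap a ∷ [] ≡⟨ unfold-reverse (vmap a) (inner a b ++ vmap b ∷ []) ⟨
    reverse (path a b)                            ∎
    where open ≡-Reasoning

  -- The three paths at vmap v use up its degree.
  branch-edge : ∀ v {q} → Adj H (vmap v) q → Σ (V G) λ b → Adj G v b × Consec (vmap v) q (path v b)
  branch-edge v {q} vq with another-neighbour {G} (proj₂ cubicG v) [] (s≤s z≤n)
  ... | b₁ , vb₁ , _ with second-neighbour {G} {v} {b₁} (proj₂ cubicG v)
  ...   | b₂ , vb₂ , b₂≢ with third-neighbour {G} (proj₂ cubicG v) vb₁ vb₂ (b₂≢ ∘ sym)
  ...     | b₃ , vb₃ , b₃≢₁ , b₃≢₂ , _ = choose (q ≟F proj₁ s₁) (q ≟F proj₁ s₂) (q ≟F proj₁ s₃)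
    where
    Second : V G → V H → Set
    Second b h = Consec (vmap v) h (path v b) × (h ∈ inner v b ⊎ h ≡ vmap b)
    second : ∀ b → Σ (V H) (Second b)
    second b with inner v b
    ... | []    = vmap b , ([] , _ , refl) , inj₂ refl
    ... | h ∷ L = h , ([] , _ , refl) , inj₁ (here refl)
    s₁ = second b₁
    s₂ = second b₂
    s₃ = second b₃
    distinct : ∀ {b b′} → Adj G v b → Adj G v b′ → b ≢ b′ → (s : Σ (V H) (Second b)) (s′ : Σ (V H) (Second b′)) → proj₁ s ≢ proj₁ s′
    distinct e e′ ne (_ , _ , inj₁ i) (_ , _ , inj₁ i′) refl with inner-same e e′ i i′
    ... | inj₁ (_ , p) = ne p
    ... | inj₂ (p , p′) = ne (trans p′ p)
    distinct e e′ ne (_ , _ , inj₁ i) (_ , _ , inj₂ refl) refl = vmap∉inner e _ i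
    distinct e e′ ne (_ , _ , inj₂ refl) (_ , _ , inj₁ i) refl = vmap∉inner e′ _ i
    distinct e e′ ne (_ , _ , inj₂ p) (_ , _ , inj₂ p′) refl = ne (vmap-inj′ (trans (sym p) p′))
    adjacent : ∀ {b} → Adj G v b → (s : Σ (V H) (Second b)) → Adj H (vmap v) (proj₁ s)
    adjacent e (_ , c , _) = chain-consec (path-chain e) c
    choose : Dec (q ≡ proj₁ s₁) → Dec (q ≡ proj₁ s₂) → Dec (q ≡ proj₁ s₃) → Σ (V G) λ b → Adj G v b × Consec (vmap v) q (path v b)
    choose (yes p) _ _ = b₁ , vb₁ , subst (λ h → Consec (vmap v) h (path v b₁)) (sym p) (proj₁ (proj₂ s₁))
    choose _ (yes p) _ = b₂ , vb₂ , subst (λ h → Consec (vmap v) h (path v b₂)) (sym p) (proj₁ (proj₂ s₂))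
    choose _ _ (yes p) = b₃ , vb₃ , subst (λ h → Consec (vmap v) h (path v b₃)) (sym p) (proj₁ (proj₂ s₃))
    choose (no n₁) (no n₂) (no n₃) = ⊥-elim (no-four {H} (proj₂ cubicH (vmap v))
        ((n₁ ∷ n₂ ∷ n₃ ∷ []) ∷ (distinct vb₁ vb₂ (b₂≢ ∘ sym) s₁ s₂ ∷ distinct vb₁ vb₃ (b₃≢₁ ∘ sym) s₁ s₃ ∷ [])
          ∷ (distinct vb₂ vb₃ (b₃≢₂ ∘ sym) s₂ s₃ ∷ []) ∷ [] ∷ [])
        (vq ∷ adjacent vb₁ s₁ ∷ adjacent vb₂ s₂ ∷ adjacent vb₃ s₃ ∷ []))

  record Exit (R : Region) (p q : V H) : Set where
    constructor exits-by
    open Region R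
    field
      from    : Y p ≡ true
      to      : Y q ≡ false
      edge    : Adj H p q
      special : ∀ j → ¬ (p ≡ e j × q ≡ n j)

  Good : Region → V H → Set
  Good R p = Σ Form λ φ → Σ (Placed H ⟦ φ ⟧ (Region.Y R) (Region.e R)) λ P → Placed.lab P p ≡ just (mark ⟦ φ ⟧)

  -- The loop invariant: every edge leaving the region, except the five path edges, starts at a
  -- vertex that is the mark of some shape placed in the region.
  record State : Set where
    field
      region : Region
      good   : ∀ {p q} → Exit region p q → Good region p

  module _ (R : Region) where
    open RegionFacts R

    inside-path : ∀ {a b h} → Adj G a b → Inside a → Inside b → h ∈ path a b → Y h ≡ true
    inside-path {a} {b} e ia ib h∈ with path-cases {a} {b} h∈
    ... | inj₁ refl = within (owner-vmap a) ia
    ... | inj₂ (inj₂ refl) = within (owner-vmap b) ib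
    ... | inj₂ (inj₁ i) = within (owner-inner e i) (picked (pick-one a b))
      where
      picked : pick a b ≡ a ⊎ pick a b ≡ b → Inside (pick a b)
      picked (inj₁ p) = subst Inside (sym p) ia
      picked (inj₂ p) = subst Inside (sym p) ib

    -- A path with both ends on the same side of the domino lies wholly in the region or wholly off
    -- it, and an exit path leaves the region only along its special edge. Hence exits are never
    -- edges of the embedded graph.
    off-paths : ∀ {p q a b} → Exit R p q → Adj G a b → ¬ Consec p q (path a b)
    off-paths {p} {q} {a} {b} x e c with inside? a | inside? b
    ... | yes ia | yes ib = true≢false (inside-path e ia ib (proj₂ (Consec-∈ c))) (Exit.to x)
    ... | no oa | no ob = true≢false (Exit.from x) (off-Y e oa ob (proj₁ (Consec-∈ c)))
    ... | yes ia | no ob with exit-edge e ia ob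
    ...   | j , refl , refl with consec-split (pre j) (subst (Consec p q) (split j) c)
    ...     | inj₁ i = true≢false (All.lookup (inY j) i) (Exit.to x)
    ...     | inj₂ (inj₁ s) = Exit.special x j s
    ...     | inj₂ (inj₂ i) = true≢false (Exit.from x) (All.lookup (outY j) i)
    off-paths {p} {q} {a} {b} x e c | no oa | yes ib with exit-edge (symG e) ib oa
    ... | j , refl , refl with consec-split-first (pre j) (subst (Consec q p) (trans (sym (path-flip e)) (split j)) (consec-reverse c))
    ...   | inj₁ i = true≢false (All.lookup (inY j) i) (Exit.to x)
    ...   | inj₂ i = true≢false (Exit.from x) (All.lookup (outY j) i)

    -- By `branch-edge`, all edges at a branch vertex belong to paths of the embedding.
    not-branch : ∀ {v q} → ¬ Exit R (vmap v) q
    not-branch {v} x with branch-edge v (Exit.edge x)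
    ... | b , e , c = off-paths x e c

    not-branch′ : ∀ {p v} → ¬ Exit R p (vmap v)
    not-branch′ {p} {v} x with branch-edge v (symH (Exit.edge x))
    ... | b , e , c = off-paths x (symG e) (subst (Consec p (vmap v)) (sym (path-flip e)) (consec-reverse c))

  _⊑_ : Region → State → Set
  R ⊑ S = ∀ {h} → Region.Y R h ≡ true → Region.Y (State.region S) h ≡ true

  module Step (S₀ : State) {p q : V H} (x₀ : Exit (State.region S₀) p q) where
    open State S₀ renaming (region to R)
    open RegionFacts R
    open Exit x₀

    Next : Set
    Next = Found ⊎ (Σ State λ S → (R ⊑ S) × Region.Y (State.region S) q ≡ true)

    free-step : own₀ q ≡ nothing → Next
    free-step free = inj₂ (record { region = R′ ; good = good′ } , (λ {h} → insert-old {Y = Y} {q} {h}) , insert-new {Y = Y} {q})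
      where
      R′ : Region
      R′ = Growing.enclose R q free
      good′ : ∀ {p′ q′} → Exit R′ p′ q′ → Good R′ p′
      good′ {p′} {q′} (exits-by y y′ a s) with p′ ≟F q
      -- An exit starting at the new vertex: `q` joins the marked branch set of the placement that
      -- was good for `p`.
      ... | yes refl with good x₀
      ...   | φ , P , lp with absorb symH P lp to edge
      ...     | P′ , lq , _ = φ , P′ , lq
      good′ {p′} {q′} (exits-by y y′ a s) | no ne with good (exits-by y (≢true⇒false λ t → true≢false (insert-old {Y = Y} {q} {q′} t) y′) a s)
      ... | φ , P , lp = φ , weaken symH (λ {h} → insert-old {Y = Y} {q} {h}) P , lp

    path-step : ∀ i → q ∈ inner (x i) (z i) → Next
    path-step i q∈ with Growing.split-ahead R i q∈ to | good x₀
    ... | α , n′ , W , ahead | φ , P , lp = decide (outcome φ i)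
      where
      open Growing.Along R i α q n′ W ahead
      R′ : Region
      R′ = grown
      e′ : Fin 5 → V H
      e′ = Region.e R′
      decide : Outcome ⟦ φ ⟧ i → Next
      decide (petersen! κ f c) with joined symH α P i lp edge segment-ahead Y⁺-old Y⁺-new
      ... | P′ , _ = inj₁ (petersen (petersen-in R′ P′ κ f c))
      decide (advances ψ f c ex mk) = inj₂ (record { region = R′ ; good = good′ } , Y⁺-old , Y⁺-new (∈-++⁺ʳ α (here refl)))
        where
        prior : Σ (V H) λ p₁ → p₁ ∈ e i ∷ α × Consec p₁ q (path (x i) (z i))
        prior with predecessor (e i) α {q} {n′ ∷ W}
        ... | p₁ , p₁∈ , c₁ = p₁ , p₁∈ , subst (Consec p₁ q) (sym (trans (split i) (cong (λ L → pre i ++ e i ∷ L) ahead)))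
                                            (consec-prefix (pre i) c₁)
        next : Consec q n′ (path (x i) (z i))
        next = pre i ++ e i ∷ α , W , trans (split i) (trans (cong (λ L → pre i ++ e i ∷ L) ahead)
                 (sym (++-assoc (pre i) (e i ∷ α) (q ∷ n′ ∷ W))))
        e-in : Y (e i) ≡ true
        e-in = All.head (Allₚ.++⁻ʳ (pre i) (inY i))
        n′-out : Y⁺ n′ ≡ false
        n′-out = let k , m = later (here refl) in Y⁺-false m (All.lookup (outY i) k)
        -- q has no room for another edge: it is adjacent to p and to its two neighbours on the path.
        crowded : ∀ {q′} → Exit R′ q q′ → ⊥
        crowded {q′} (exits-by _ y′ a s) with prior
        ... | p₁ , p₁∈ , c₁ = no-four {H} (proj₂ cubicH q)
            (((λ { refl → true≢false (Y⁺-old from) y′ }) ∷ (λ { refl → true≢false p₁-in y′ })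
                ∷ (λ { refl → s i (redirected-at e i , redirected-at n i) }) ∷ [])
             ∷ ((λ { refl → off-paths R x₀ (z-adj i) c₁ }) ∷ (λ { refl → true≢false (Y⁺-old from) n′-out }) ∷ [])
             ∷ ((λ { refl → true≢false p₁-in n′-out }) ∷ []) ∷ [] ∷ [])
            (a ∷ symH edge ∷ symH (chain-consec (path-chain (z-adj i)) c₁) ∷ chain-consec (path-chain (z-adj i)) next ∷ [])
          where
          p₁-in : Y⁺ p₁ ≡ true
          p₁-in = case p₁∈ of λ where
            (here refl) → Y⁺-old e-in
            (there k) → Y⁺-new (∈-++⁺ˡ k)
        old-exit : ∀ {p′ q′} → Exit R′ p′ q′ → Y p′ ≡ true → Exit R p′ q′
        old-exit {p′} {q′} (exits-by y y′ a s) yp = exits-by yp (≢true⇒false λ t → true≢false (Y⁺-old t) y′) a special′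
          where
          n-new : Y⁺ (n i) ≡ true
          n-new = Y⁺-new (first α ahead)
            where
            first : ∀ α {m W′ W″} → m ∷ W′ ≡ α ++ q ∷ W″ → m ∈ α ++ q ∷ []
            first []      refl = here refl
            first (_ ∷ _) refl = here refl
          special′ : ∀ j → ¬ (p′ ≡ e j × q′ ≡ n j)
          special′ j (p≡ , q≡) with j ≟F i
          ... | yes refl = true≢false n-new (subst (λ h → Y⁺ h ≡ false) q≡ y′)
          ... | no j≢i = s j (trans p≡ (unchanged e) , trans q≡ (unchanged n))
            where
            unchanged : ∀ {A : Set} (t : Fin 5 → A) {b} → t j ≡ redirected t i b j
            unchanged t with j ≟F i
            ... | yes eq = ⊥-elim (j≢i eq)
            ... | no _ = refl
        good′ : ∀ {p′ q′} → Exit R′ p′ q′ → Good R′ p′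
        good′ {p′} ex′ with Y⁺-cases (Exit.from ex′)
        -- Starts inside the old region keep their form and mark; only the branch set of the `i`-th
        -- exit is prolonged to `q`.
        ... | inj₂ yp with good (old-exit ex′ yp)
        ...   | φ′ , P′ , lp′ with slide symH α P′ i segment-ahead Y⁺-old Y⁺-new
        ...     | P″ , keep = φ′ , P″ , keep lp′
        good′ {p′} ex′ | inj₁ p∈ with ∈-++⁻ α p∈
        ... | inj₂ (here refl) = ⊥-elim (crowded ex′)
        -- A start on the newly enclosed stretch becomes the mark of a jump. The same map of the
        -- table serves all these starts, since it does not depend on where on the stretch the mark
        -- lies.
        ... | inj₁ p∈α with jumped symH α P i lp edge segment-ahead Y⁺-old Y⁺-new p∈α
        ...   | P′ , lp′ = ψ , record
          { model = coarsen-by symH c (λ e → inj₁ e) (Placed.model P′)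
          ; support = λ {h} l → case >>=-just (Placed.lab P′ h) l of λ (_ , l′ , _) → Placed.support P′ l′
          ; exits = λ j → trans (cong (λ m → m >>= (just ∘ f)) (Placed.exits P′ j)) (cong just (ex j)) }
          , trans (cong (λ m → m >>= (just ∘ f)) lp′) (cong just mk)

    leap-step : ∀ {f₁ f₂} → Adj G f₁ f₂ → ¬ Inside f₁ → ¬ Inside f₂ → q ∈ inner f₁ f₂ → Next
    leap-step {f₁} {f₂} f o₁ o₂ q∈ with good x₀
    ... | single m , P , lp = inj₁ (single⁺ (inj₁ (∈-lookup m)) f o₁ o₂
            (LeapSingle.single-leap R m P lp edge to f o₁ o₂ q∈))
    ... | double m , P , lp = inj₁ (cases (f₁ ≟F z₅) (f₂ ≟F z₅) (adj G f₁ z₅ Bool.≟ true) (adj G f₂ z₅ Bool.≟ true))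
      where
      near₁ : Adj G f₁ z₅ → f₁ ≢ z₅ → Found
      near₁ a ne = single⁺ (inj₁ (∈-lookup L.m′)) C.z₅u₀ C.z₅-out C.u₀-out C.close-leap
        where
        module L = LeapDouble R m P lp edge to f o₁ o₂ q∈
        module C = L.Close a ne
      near₂ : Adj G f₂ z₅ → f₂ ≢ z₅ → Found
      near₂ a ne = single⁺ (inj₁ (∈-lookup L.m′)) C.z₅u₀ C.z₅-out C.u₀-out C.close-leap
        where
        module L = LeapDouble R m P lp edge to (symG f) o₂ o₁ (inner-flip f q∈)
        module C = L.Close a ne
      cases : Dec (f₁ ≡ z₅) → Dec (f₂ ≡ z₅) → Dec (Adj G f₁ z₅) → Dec (Adj G f₂ z₅) → Found
      -- If one end of `f` is `z₅`, the other end is a neighbour of `z₅`, so this too is handled by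
      -- `Close`.
      cases (yes e₁) _ _ _ = near₂ (subst (Adj G f₂) e₁ (symG f)) λ e₂ → irrG (subst (λ u → Adj G u f₂) (trans e₁ (sym e₂)) f)
      cases (no n₁) (yes e₂) _ _ = near₁ (subst (Adj G f₁) e₂ f) n₁
      cases (no n₁) (no n₂) (yes a) _ = near₁ a n₁
      cases (no n₁) (no n₂) (no _) (yes a) = near₂ a n₂
      cases (no n₁) (no n₂) (no m₁) (no m₂) = double⁺ {m = m} f o₁ o₂ n₁ n₂ m₁ m₂ (LeapDouble.double-leap R m P lp edge to f o₁ o₂ q∈)

    step! : Next
    step! with own₀ q in oq
    ... | nothing = free-step oq
    ... | just v with owner-cases oq
    ...   | inj₁ refl = ⊥-elim (not-branch′ R x₀)
    ...   | inj₂ (b , vb , q∈ , _) with inside? v | inside? b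
    ...     | yes iv | _ = ⊥-elim (true≢false (within oq iv) to)
    ...     | no ov | no ob = leap-step vb ov ob q∈
    ...     | no ov | yes ib with exit-edge (symG vb) ib ov
    ...       | j , refl , refl = path-step j (inner-flip vb q∈)

  Separated : Set
  Separated = Σ (V H → Bool) λ X → cutSize H X ≡ 5 × (∀ v → (X (vmap v) ≡ true) ⇔ Inside v)

  -- With no exit left, the cut consists of the edges from `e j` to `n j`; these five are different
  -- because the paths of an embedding share no edge.
  separated : (R : Region) → (∀ p q → ¬ Exit R p q) → Separated
  separated R none = Y , ℕₚ.≤-antisym (cut≤ H Y L all-special) (cut≥ H Y L unique-L crossing) , λ v →
    mk⇔ (λ y → case inside? v of λ where
          (yes i) → i
          (no o) → ⊥-elim (vmap∉inner (z-adj _) v (proj₂ (beyond (owner-vmap v) o y))))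
        (within (owner-vmap v))
    where
    open RegionFacts R
    L : List (V H × V H)
    L = map (λ j → e j , n j) (allFin 5)
    all-special : ∀ {u v} → Y u ≡ true → Y v ≡ false → Adj H u v → (u , v) ∈ L
    all-special {u} {v} yu yv a with Finₚ.any? (λ j → (u ≟F e j) ×-dec (v ≟F n j))
    ... | yes (j , refl , refl) = ∈-map⁺ (λ j → e j , n j) (∈-allFin j)
    ... | no s = ⊥-elim (none u v (exits-by yu yv a λ j p → s (j , p)))
    consecutive : ∀ j → Consec (e j) (n j) (path (x j) (z j))
    consecutive j = pre j , post j , split j
    injective : ∀ {j k} → (e j , n j) ≡ (e k , n k) → j ≡ k
    injective {j} {k} eq with j ≟F k
    ... | yes p = p
    ... | no j≢k = ⊥-elim (edge-disj _ _ _ _ (z-adj j) (z-adj k) apart (e j) (n j) (consecutive j)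
            (inj₁ (subst (λ (a , b) → Consec a b (path (x k) (z k))) (sym eq) (consecutive k))))
      where
      apart : ¬ SameEdge (x j) (z j) (x k) (z k)
      apart (inj₁ (p , _)) = j≢k (corner-injective j k (d-inj p))
      apart (inj₂ (p , _)) = z-out k _ (sym p)
    unique-L : Unique L
    unique-L = Uniqueₚ.map⁺ injective (Uniqueₚ.allFin⁺ 5)
    crossing : ∀ {u v} → (u , v) ∈ L → Y u ≡ true × Y v ≡ false × Adj H u v
    crossing i with ∈-map⁻ (λ j → e j , n j) i
    ... | j , _ , refl = All.head (Allₚ.++⁻ʳ (pre j) (inY j)) , All.head (outY j) , exit-adj j

  -- Every unsuccessful step encloses a vertex that was outside the region. `L` collects these
  -- vertices, so there are at most `size H` such steps.
  search : State → Found ⊎ Separated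
  search S₀ = loop (size H) S₀ [] [] (ℕₚ.m≤m+n (size H) 0) (λ ())
    where
    exit? : ∀ R p q → Dec (Exit R p q)
    exit? R p q = map′ (λ (a , b , c , s) → exits-by a b c s) (λ (exits-by a b c s) → a , b , c , s)
      ((Y p Bool.≟ true) ×-dec ((Y q Bool.≟ false) ×-dec ((adj H p q Bool.≟ true) ×-dec
        Finₚ.all? λ j → ¬? ((p ≟F e j) ×-dec (q ≟F n j)))))
      where open Region R
    loop : (fuel : ℕ) (S : State) (L : List (V H)) → Unique L → size H ≤ fuel + length L →
           (∀ {h} → h ∈ L → Region.Y (State.region S) h ≡ true) → Found ⊎ Separated
    loop fuel S L uq big inL with Finₚ.any? (λ p → Finₚ.any? λ q → exit? (State.region S) p q)
    ... | no none = inj₂ (separated (State.region S) λ p q x → none (p , q , x))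
    ... | yes (p , q , x) with Step.step! S x
    ...   | inj₁ found = inj₁ found
    ...   | inj₂ (S′ , sub , yq) with fuel
    ...     | zero = ⊥-elim (ℕₚ.<⇒≱ (s≤s big) (subst (suc (length L) ≤_) (length-tabulate {n = size H} id)
                (unique-⊆-length {xs = q ∷ L} (fresh ∷ uq) λ {w} _ → ∈-allFin w)))
      where
      fresh : All (q ≢_) L
      fresh = All.tabulate λ i e → true≢false (inL (subst (_∈ L) (sym e) i)) (Exit.to x)
    ...     | suc fuel′ = loop fuel′ S′ (q ∷ L) (fresh ∷ uq) (subst (size H ≤_) (sym (ℕₚ.+-suc fuel′ _)) big) λ where
                (here refl) → yq
                (there i) → sub (inL i)
      where
      fresh : All (q ≢_) L
      fresh = All.tabulate λ i e → true≢false (inL (subst (_∈ L) (sym e) i)) (Exit.to x)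

  module Initial where
    inside-label : Maybe (V G) → Bool
    inside-label nothing  = false
    inside-label (just v) = ⌊ inside? v ⌋

    Y₀ : V H → Bool
    Y₀ h = inside-label (own₀ h)

    Y₀-in : ∀ {h v} → own₀ h ≡ just v → Inside v → Y₀ h ≡ true
    Y₀-in {v = v} o i rewrite o with inside? v
    ... | yes _ = refl
    ... | no n  = ⊥-elim (n i)

    Y₀-out : ∀ {h v} → own₀ h ≡ just v → ¬ Inside v → Y₀ h ≡ false
    Y₀-out {v = v} o n rewrite o with inside? v
    ... | yes i = ⊥-elim (n i)
    ... | no _  = refl

    Y₀⁻ : ∀ {h} → Y₀ h ≡ true → Σ (V G) λ v → own₀ h ≡ just v × Inside v
    Y₀⁻ {h} y with own₀ h
    ... | just v with inside? v
    ...   | yes i = v , refl , i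

    uncons : (L : List (V H)) (b : V H) → Σ (V H) λ h → Σ (List (V H)) λ t → L ++ b ∷ [] ≡ h ∷ t
    uncons []      b = b , [] , refl
    uncons (a ∷ L) b = a , L ++ b ∷ [] , refl

    first : ∀ j → Σ (V H) λ h → Σ (List (V H)) λ t → inner (x j) (z j) ++ vmap (z j) ∷ [] ≡ h ∷ t
    first j = uncons (inner (x j) (z j)) (vmap (z j))

    R₀ : Region
    R₀ = record
      { Y = Y₀ ; pre = λ _ → [] ; e = λ j → vmap (x j) ; n = λ j → proj₁ (first j) ; post = λ j → proj₁ (proj₂ (first j))
      ; split = λ j → cong (vmap (x j) ∷_) (proj₂ (proj₂ (first j)))
      ; inY = λ j → Y₀-in (owner-vmap (x j)) (_ , refl) ∷ []
      ; outY = λ j → subst (All (λ h → Y₀ h ≡ false)) (proj₂ (proj₂ (first j)))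
          (Allₚ.++⁺ (All.tabulate λ i → Y₀-out (own₀-g j i) (z-outside j))
                    (Y₀-out (owner-vmap (z j)) (z-outside j) ∷ []))
      ; within = Y₀-in
      ; beyond = λ o n y → ⊥-elim (true≢false y (Y₀-out o n)) }

    index : V G → Maybe (Fin 7)
    index v with inside? v
    ... | yes (i , _) = just i
    ... | no _        = nothing

    index-d : ∀ i → index (d i) ≡ just i
    index-d i with inside? (d i)
    ... | yes (k , e) = cong just (sym (d-inj e))
    ... | no n        = ⊥-elim (n (i , refl))

    index⁻ : ∀ {v i} → index v ≡ just i → v ≡ d i
    index⁻ {v} e with inside? v
    index⁻ refl | yes (i , e) = e

    module On (m : Fin 8) where
      a b : Fin 7
      a = proj₁ (List.lookup dominoEdges m)
      b = proj₂ (List.lookup dominoEdges m)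

      ab : Adj G (d a) (d b)
      ab = d-adj (∈-lookup m)

      -- The domino without its `m`-th edge; the mark 0 is a placeholder until `start` attaches `p`
      -- in the gap.
      core : Shape
      core = shape 7 (removeAt dominoEdges m) corner zero

      module _ {p : V H} {l r : List (V H)} (sp : inner (d a) (d b) ≡ l ++ p ∷ r) where
        open Marked ab (λ _ → b , refl) (λ _ → a , refl) sp
        open Labelling labelling using (own-star; own-edge)

        lab₀ : V H → Maybe (Fin 7)
        lab₀ h = own h >>= index

        lab⁺ : ∀ h {i} → own h ≡ just (d i) → lab₀ h ≡ just i
        lab⁺ h {i} o rewrite o = index-d i

        lab⁻ : ∀ {h i} → lab₀ h ≡ just i → own h ≡ just (d i)
        lab⁻ {h} l with >>=-just (own h) l
        ... | v , o , e = trans o (cong just (index⁻ e))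

        -- `attached` accepts only a vertex outside the current set, so `p` is taken out of `Y₀` and
        -- put back in `start`.
        Y₁ : V H → Bool
        Y₁ h = Y₀ h ∧ not (h == p)

        in-Y₁ : ∀ {h i} → own h ≡ just (d i) → Y₁ h ≡ true
        in-Y₁ {h} {i} o with own-side {h} o
        ... | w , o′ , f , _ = ∧⁺ (Y₀-in {h} o′ (f (i , refl))) (cong not (≢true⇒false λ e → case trans (sym o) (trans (cong own (==⁻ e)) own-q) of λ ()))

        to-branch : ∀ {h i} → lab₀ h ≡ just i → Within H (λ v → lab₀ v ≡ just i) (vmap (d i)) h
        to-branch {h} {i} l with own-star {h} (lab⁻ {h} l)
        ... | inj₁ refl = here l
        ... | inj₂ (c , e , X , Z , s , ows) = chain-within-∈ (prefix-chain X e s)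
          (Allₚ.++⁺ {xs = vmap (d i) ∷ X} (lab⁺ (vmap (d i)) (own-vmap (d i)) ∷ All.map (λ {w} → lab⁺ w) ows) (l ∷ []))
          (there (∈-++⁺ʳ X (here refl)))

        core-placed : Placed H core Y₁ (λ j → vmap (x j))
        core-placed = record
          { model = record
            { lab = lab₀
            ; conn = λ {i} {h} {h′} q q′ → within-trans (within-sym symH (to-branch {h} q)) (to-branch {h′} q′)
            ; edge = edge′ }
          ; support = λ {h} l → in-Y₁ {h} (lab⁻ {h} l)
          ; exits = λ j → lab⁺ (vmap (x j)) (own-vmap (x j)) }
          where
          edge′ : ∀ {i j} → (i , j) ∈ removeAt dominoEdges m → ∃₂ λ h h′ → lab₀ h ≡ just i × lab₀ h′ ≡ just j × Adj H h h′
          edge′ {i} {j} e with own-edge (d-adj (removeAt-⊆ dominoEdges m e) , λ s → All.lookup (other-edges m) e (uncong s))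
            where
            uncong : SameEdge (d i) (d j) (d a) (d b) → SameEdge i j a b
            uncong (inj₁ (q , q′)) = inj₁ (d-inj q , d-inj q′)
            uncong (inj₂ (q , q′)) = inj₂ (d-inj q , d-inj q′)
          ... | h , h′ , o , o′ , hh′ , _ = h , h′ , lab⁺ h o , lab⁺ h′ o′ , hh′

        p-out : Y₁ p ≡ false
        p-out with Y₀ p
        ... | false = refl
        ... | true rewrite ==⁺ {u = p} refl = refl

        start : Σ (Placed H (subdivided m) Y₀ (λ j → vmap (x j))) λ P → Placed.lab P p ≡ just zero
        start with q-near₁ | q-near₂
        ... | h , o , hp , _ | h′ , o′ , ph′ , _ with attached symH core-placed (lab⁺ h o) p-out hp
        ...   | P , lp , keep = record
          { model = record { lab = Placed.lab P ; conn = Placed.conn P ; edge = λ where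
              (here refl) → h , p , keep (lab⁺ h o) , lp , hp
              (there (here refl)) → p , h′ , lp , keep (lab⁺ h′ o′) , ph′
              (there (there e)) → Placed.edge P (there e) }
          ; support = λ {v} l → shrink v (Placed.support P l)
          ; exits = Placed.exits P } , lp
          where
          p-in : Y₀ p ≡ true
          p-in = inside-path R₀ ab (_ , refl) (_ , refl)
                   (inner⊆path {d a} {d b} (subst (p ∈_) (sym sp) (∈-++⁺ʳ l (here refl))))
          shrink : ∀ v → insert Y₁ p v ≡ true → Y₀ v ≡ true
          shrink v y with v ≟F p
          ... | yes refl = p-in
          ... | no _ = proj₁ (∧⁻ {Y₀ v} y)

    good-on-edge : ∀ {p k l} → (k , l) ∈ dominoEdges → p ∈ inner (d k) (d l) → Good R₀ p
    good-on-edge e p∈ with Any.index e | Anyₚ.lookup-index e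
    ... | m | refl with ∈-∃++ p∈
    ...   | X , Z , sp = single m , On.start m sp

    good₀ : ∀ {p q} → Exit R₀ p q → Good R₀ p
    good₀ x₀ with Y₀⁻ (Exit.from x₀)
    ... | v , o , iv with owner-cases o
    ...   | inj₁ refl = ⊥-elim (not-branch R₀ x₀)
    -- Interiors of exit paths belong to outer vertices, so `p` lies on the image of an edge with
    -- both ends in the domino, and that edge is a domino edge by `d-only`.
    ...   | inj₂ (b , vb , p∈ , pk) with pick-inside {v} {b} (subst Inside (sym pk) iv)
    ...     | (k , refl) , (l , refl) = [ (λ e → good-on-edge e p∈) , (λ e → good-on-edge e (inner-flip vb p∈)) ]′ (d-only vb)

  conclusion : Found ⊎ Separated
  conclusion = search (record { region = Initial.R₀ ; good = Initial.good₀ })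

-- From the result of the search to the four alternatives

module _ {G : Graph} (cubicG : IsCubic G) {D : Domino G} {x₁ x₂ x₃ x₄ x₅ z : V G}
         {H : Graph} (cubicH : IsCubic H) (η : Embedding G H) where

  finish : Setup G D x₁ x₂ x₃ x₄ x₅ z →
    (Σ (V H → Bool) λ X → cutSize H X ≡ 5 × (∀ v → (X (Embedding.vmap η v) ≡ true) ⇔ InVD D v))
    ⊎ Contains H Petersen
    ⊎ (Σ (V G) λ e₁ → Σ (V G) λ e₂ → Σ (V G) λ f₁ → Σ (V G) λ f₂ →
       InED D e₁ e₂ × InEGminusD D f₁ f₂ × Contains H (plus G e₁ e₂ f₁ f₂))
    ⊎ (Σ (V G) λ e₁ → Σ (V G) λ e₂ → Σ (V G) λ f₁ → Σ (V G) λ f₂ →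
       ((e₁ , e₂) ∈ (x₁ , x₂) ∷ (x₃ , x₄) ∷ []) × InEGminusD D f₁ f₂ × Diverse G f₁ f₂ x₅ z ×
       Contains H (plus (plus G e₁ e₂ x₅ z) newY (old x₅) (old f₁) (old f₂)))
  finish record { framed = F ; x₁≡ = refl ; x₂≡ = refl ; x₃≡ = refl ; x₄≡ = refl ; x₅≡ = refl ; z₅≡ = refl
                ; inVD = inVD ; VDin = VDin ; inED = inED } = answer conclusion
    where
    open Search cubicG cubicH F η
    open Frame F
    simpleG = proj₁ cubicG
    outside : ∀ {v} → ¬ (Σ (Fin 7) λ i → v ≡ d i) → ¬ InVD D v
    outside o i = o (inVD i)
    only-z₅ : ∀ {f} → ¬ (Σ (Fin 7) λ i → f ≡ d i) → f ≢ z₅ → ¬ Adj G f (d 4F)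
    only-z₅ o ne a with z-only (simple⇒symmetric {G} simpleG a) (λ k e → o (k , e))
    ... | j , p , refl = ne (cong Frame-z (corner-injective j 4F (sym p)))
      where Frame-z = Frame.z F
    answer : Found ⊎ Separated → _
    answer (inj₂ (X , cut , iff)) = inj₁ (X , cut , λ v → mk⇔
      (λ y → case Equivalence.to (iff v) y of λ where (i , refl) → VDin i) (λ i → Equivalence.from (iff v) (inVD i)))
    answer (inj₁ (petersen P)) = inj₂ (inj₁ P)
    answer (inj₁ (single⁺ {i} {j} {f₁} {f₂} l f o₁ o₂ E)) =
      inj₂ (inj₂ (inj₁ (d i , d j , f₁ , f₂ , inED l , (f , outside o₁ , outside o₂) , E)))
    answer (inj₁ (double⁺ {m} {f₁} {f₂} f o₁ o₂ n₁ n₂ m₁ m₂ E)) =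
      inj₂ (inj₂ (inj₂ (_ , _ , f₁ , f₂ , chosen m , (f , outside o₁ , outside o₂) , diverse , E)))
      where
      chosen : ∀ m → let e = List.lookup dominoEdges (Fin.inject≤ m (s≤s (s≤s z≤n))) in
               (d (proj₁ e) , d (proj₂ e)) ∈ (d 0F , d 1F) ∷ (d 2F , d 3F) ∷ []
      chosen zero = here refl
      chosen 1F   = there (here refl)
      diverse : Diverse G f₁ f₂ (d 4F) z₅
      diverse = (((λ { refl → simple⇒irreflexive {G} simpleG f }) ∷ (λ e → o₁ (_ , e)) ∷ n₁ ∷ [])
                 ∷ ((λ e → o₂ (_ , e)) ∷ n₂ ∷ []) ∷ ((λ e → z-out 4F _ (sym e)) ∷ []) ∷ [] ∷ [])
              , only-z₅ o₁ n₁ , m₁ , only-z₅ o₂ n₂ , m₂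

theorem17p2 : (G : Graph) → IsCubic G → CyclicallyConnected 5 G → 14 ≤ size G →
    (D : Domino G) → (x₁ x₂ x₃ x₄ x₅ : V G) →
    IsAttachmentSeq D x₁ x₂ x₃ x₄ x₅ → IsCrossed D x₁ x₂ x₃ x₄ x₅ →
    (z : V G) → Adj G x₅ z → ¬ InED D x₅ z →
    (H : Graph) → IsCubic H → CyclicallyConnected 5 H →
    (η : Embedding G H) →
    (Σ (V H → Bool) λ X → cutSize H X ≡ 5 ×
    (∀ v → (X (Embedding.vmap η v) ≡ true) ⇔ InVD D v))
    ⊎
    Contains H Petersen
    ⊎
    (Σ (V G) λ e₁ → Σ (V G) λ e₂ → Σ (V G) λ f₁ → Σ (V G) λ f₂ →
    InED D e₁ e₂ × InEGminusD D f₁ f₂ × Contains H (plus G e₁ e₂ f₁ f₂))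
    ⊎
    (Σ (V G) λ e₁ → Σ (V G) λ e₂ → Σ (V G) λ f₁ → Σ (V G) λ f₂ →
    ((e₁ , e₂) ∈ (x₁ , x₂) ∷ (x₃ , x₄) ∷ []) ×
    InEGminusD D f₁ f₂ ×
    Diverse G f₁ f₂ x₅ z ×
    Contains H (plus (plus G e₁ e₂ x₅ z) newY (old x₅) (old f₁) (old f₂)))
theorem17p2 G cubicG cycG _ D x₁ x₂ x₃ x₄ x₅ attachment crossed z x₅z z∉D H cubicH _ η =
  finish cubicG cubicH η (setup cubicG cycG D attachment crossed x₅z z∉D)
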